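{- Let $\Phi$ be a (possibly reducible) finite crystallographic root system, with Weyl group $W$, simple system $\Pi$, fundamental chamber $\mathcal C$ and root polytope $\mathcal P_\Phi$, and let $F$ be a face of $\mathcal P_\Phi$. (1) $F$ is standard if and only if the barycenter $\beta_F$ is dominant. In this case, the stabilizer $\mathrm{Stab}_W(F)$ of $F$ is the standard parabolic subgroup of $W$ generated by $\Pi\cap\beta_F^\perp$ (that is, by the reflections $s_\alpha$ with $\alpha\in\Pi\cap\beta_F^\perp$). (2) The orbit $W\cdot F$ of $F$ under the action of $W$ on the faces of $\mathcal P_\Phi$ contains exactly one standard face.
   Context: $\Phi$ is a finite reduced crystallographic root system in the real vector space $\mathbb E=\mathrm{Span}_{\mathbb R}\Phi$ with ($W$-invariant) positive definite bilinear form $(\cdot,\cdot)$; $\Pi$ is a set of simple roots, $W$ the Weyl group, $s_\alpha$ the reflection with respect to $\alpha$. $\mathcal C=\{x\in\mathbb E:(x,\alpha)\ge 0\ \forall \alpha\in\Pi\}$ is the (closed) fundamental chamber associated with $\Pi$; $x\in\mathbb E$ is dominant if $x\in\mathcal C$. The root polytope $\mathcal P_\Phi$ is the convex hull of all roots in $\Phi$. For a face $F$ of $\mathcal P_\Phi$ with vertex set $V$, $\beta_F=\frac1{|V|}\sum_{v\in V}v$ is the barycenter of $V$, and $\mathrm{Stab}_W(F)=\{w\in W: w(F)=F\}$. The relative interior of $F$ is its interior within the affine hull of $F$. A face $F$ is called standard if either its relative interior meets $\mathcal C$, or $F=\emptyset$. -}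

module Defs where

open import Algebra.Bundles using (CommutativeRing)
open import Algebra.Definitions.RawMonoid using (sum)
open import Algebra.Module.Bundles using (Module)
open import Data.Fin.Base using (Fin)
open import Data.Integer.Base using (ℤ; +_; -[1+_])
open import Data.Nat.Base using (ℕ; zero; suc)
open import Data.Product.Base using (∃-syntax; _×_)
open import Data.Sum.Base using (_⊎_)
open import Function.Base using (_∘_; id)
open import Function.Definitions using (Injective)
open import Level using (Level; _⊔_) renaming (suc to lsuc)
open import Relation.Binary.Core using (Rel)
open import Relation.Binary.PropositionalEquality.Core using (_≡_)
open import Relation.Binary.Structures using (IsDecTotalOrder)
open import Relation.Nullary.Negation using (¬_)
open import Relation.Unary using (Pred; _∈_; _≐_; _∩_; _≬_; Empty; Satisfiable)

-- The field of real numbers, axiomatised as a Dedekind-complete ordered field.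
-- The order is decidable, as it is for the classical real numbers.
record RealField c ℓ₁ ℓ₂ : Set (lsuc (c ⊔ ℓ₁ ⊔ ℓ₂)) where
  infix 4 _≤_ _<_
  infix 9 _⁻¹
  field
    commutativeRing : CommutativeRing c ℓ₁

  open CommutativeRing commutativeRing public

  field
    0≉1             : ¬ (0# ≈ 1#)
    -- A total function; the value at 0# is unspecified.
    _⁻¹             : Carrier → Carrier
    ⁻¹-cong         : ∀ {x y} → x ≈ y → x ⁻¹ ≈ y ⁻¹
    ⁻¹-inverseʳ     : ∀ {x} → ¬ (x ≈ 0#) → x * x ⁻¹ ≈ 1#
    _≤_             : Rel Carrier ℓ₂
    isDecTotalOrder : IsDecTotalOrder _≈_ _≤_
    +-monoˡ-≤       : ∀ z {x y} → x ≤ y → x + z ≤ y + z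
    *-nonNegative   : ∀ {x y} → 0# ≤ x → 0# ≤ y → 0# ≤ x * y

  _<_ : Rel Carrier (ℓ₁ ⊔ ℓ₂)
  x < y = x ≤ y × ¬ (x ≈ y)

  UpperBound : ∀ {p} → Pred Carrier p → Pred Carrier (c ⊔ ℓ₂ ⊔ p)
  UpperBound S b = ∀ {x} → x ∈ S → x ≤ b

  field
    completeness : (S : Pred Carrier (c ⊔ ℓ₁ ⊔ ℓ₂)) →
                   Satisfiable S → Satisfiable (UpperBound S) →
                   ∃[ s ] s ∈ UpperBound S × (∀ {b} → b ∈ UpperBound S → s ≤ b)

  fromℕ : ℕ → Carrier
  fromℕ zero    = 0#
  fromℕ (suc n) = 1# + fromℕ n

  fromℤ : ℤ → Carrier
  fromℤ (+ n)      = fromℕ n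
  fromℤ (-[1+ n ]) = - fromℕ (suc n)

-- No dimension is imposed here; root systems are required to span, which makes
-- the space finite-dimensional.
record InnerProductSpace {c ℓ₁ ℓ₂} (ℝ : RealField c ℓ₁ ℓ₂) m ℓm
       : Set (c ⊔ ℓ₁ ⊔ ℓ₂ ⊔ lsuc (m ⊔ ℓm)) where
  open RealField ℝ
  field
    vectorSpace : Module commutativeRing m ℓm

  open Module vectorSpace public

  field
    ⟪_,_⟫       : Carrierᴹ → Carrierᴹ → Carrier
    ⟪⟫-cong     : ∀ {x x′ y y′} → x ≈ᴹ x′ → y ≈ᴹ y′ → ⟪ x , y ⟫ ≈ ⟪ x′ , y′ ⟫
    ⟪⟫-+ˡ       : ∀ x y z → ⟪ x +ᴹ y , z ⟫ ≈ ⟪ x , z ⟫ + ⟪ y , z ⟫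
    ⟪⟫-*ˡ       : ∀ a x y → ⟪ a *ₗ x , y ⟫ ≈ a * ⟪ x , y ⟫
    ⟪⟫-sym      : ∀ x y → ⟪ x , y ⟫ ≈ ⟪ y , x ⟫
    ⟪⟫-nonNeg   : ∀ x → 0# ≤ ⟪ x , x ⟫
    ⟪⟫-definite : ∀ {x} → ⟪ x , x ⟫ ≈ 0# → x ≈ᴹ 0ᴹ

module Geometry {c ℓ₁ ℓ₂ m ℓm} {ℝ : RealField c ℓ₁ ℓ₂}
                (𝔼 : InnerProductSpace ℝ m ℓm) where
  open RealField ℝ
  open InnerProductSpace 𝔼

  private variable
    a b   : Level
    n N r : ℕ

  ℓ𝔼 : Level
  ℓ𝔼 = c ⊔ ℓ₁ ⊔ ℓ₂ ⊔ m ⊔ ℓm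

  Subset : Set (lsuc ℓ𝔼)
  Subset = Pred Carrierᴹ ℓ𝔼

  infixl 6 _-ᴹ_
  _-ᴹ_ : Carrierᴹ → Carrierᴹ → Carrierᴹ
  x -ᴹ y = x +ᴹ (-ᴹ y)

  Σᴷ : (Fin n → Carrier) → Carrier
  Σᴷ = sum +-rawMonoid

  Σᴹ : (Fin n → Carrierᴹ) → Carrierᴹ
  Σᴹ = sum +ᴹ-rawMonoid

  combination : (Fin n → Carrier) → (Fin n → Carrierᴹ) → Carrierᴹ
  combination t v = Σᴹ (λ i → t i *ₗ v i)

  Range : (Fin n → Carrierᴹ) → Pred Carrierᴹ ℓm
  Range v x = ∃[ i ] x ≈ᴹ v i

  image : (Carrierᴹ → Carrierᴹ) → Subset → Subset
  image w S y = ∃[ x ] x ∈ S × y ≈ᴹ w x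

  LinearlyIndependent : (Fin n → Carrierᴹ) → Set (c ⊔ ℓ₁ ⊔ ℓm)
  LinearlyIndependent v = ∀ t → combination t v ≈ᴹ 0ᴹ → ∀ i → t i ≈ 0#

  affineHull : Pred Carrierᴹ a → Pred Carrierᴹ (c ⊔ ℓ₁ ⊔ m ⊔ ℓm ⊔ a)
  affineHull S x = ∃[ n ] ∃[ t ] ∃[ v ]
    (∀ (i : Fin n) → v i ∈ S) × Σᴷ t ≈ 1# × x ≈ᴹ combination t v

  convexHull : Pred Carrierᴹ a → Pred Carrierᴹ (ℓ𝔼 ⊔ a)
  convexHull S x = ∃[ n ] ∃[ t ] ∃[ v ]
    (∀ (i : Fin n) → v i ∈ S) × (∀ i → 0# ≤ t i) × Σᴷ t ≈ 1# × x ≈ᴹ combination t v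

  relativeInterior : Pred Carrierᴹ a → Pred Carrierᴹ (ℓ𝔼 ⊔ a)
  relativeInterior S x = x ∈ S × (∃[ ε ] 0# < ε ×
    (∀ y → y ∈ affineHull S → ⟪ y -ᴹ x , y -ᴹ x ⟫ < ε * ε → y ∈ S))

  -- Faces are cut out by valid inequalities ⟪ u , x ⟫ ≤ k. Both improper faces
  -- occur: u = 0, k = 0 gives the whole set and u = 0, k = 1 the empty one.
  IsFaceOf : Pred Carrierᴹ a → Pred Carrierᴹ b → Set (c ⊔ ℓ₁ ⊔ ℓ₂ ⊔ m ⊔ a ⊔ b)
  IsFaceOf Q F = ∃[ u ] ∃[ k ]
    (∀ {x} → x ∈ Q → ⟪ u , x ⟫ ≤ k) × F ≐ (Q ∩ λ x → ⟪ u , x ⟫ ≈ k)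

  -- A vertex is a face consisting of a single point.
  IsVertexOf : Pred Carrierᴹ a → Pred Carrierᴹ (ℓ𝔼 ⊔ a)
  IsVertexOf Q v = IsFaceOf Q (_≈ᴹ v)

  -- β is the barycenter of the vertex set of Q. The vertices are enumerated
  -- without repetition; if there are none, this forces β ≈ᴹ 0ᴹ (an empty sum),
  -- whatever the value of 0# ⁻¹.
  IsBarycenter : Pred Carrierᴹ a → Pred Carrierᴹ (ℓ𝔼 ⊔ a)
  IsBarycenter Q β = ∃[ n ] ∃[ v ]
    Injective {A = Fin n} _≡_ _≈ᴹ_ v ×
    IsVertexOf Q ≐ Range v ×
    β ≈ᴹ fromℕ n ⁻¹ *ₗ Σᴹ v

  -- ⟨β,α^∨⟩ = 2(β,α)/(α,α), for α ≠ 0.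
  cartan : Carrierᴹ → Carrierᴹ → Carrier
  cartan β α = (1# + 1#) * ⟪ β , α ⟫ * ⟪ α , α ⟫ ⁻¹

  reflection : Carrierᴹ → Carrierᴹ → Carrierᴹ
  reflection α x = x -ᴹ (cartan x α *ₗ α)

  -- The group generated by the reflections s_α, α ∈ S, as a set of maps 𝔼 → 𝔼.
  data ReflectionGroup (S : Pred Carrierᴹ a) : Pred (Carrierᴹ → Carrierᴹ) (m ⊔ ℓm ⊔ a) where
    generator : ∀ {α} → α ∈ S → ReflectionGroup S (reflection α)
    identity  : ReflectionGroup S id
    compose   : ∀ {w w′} → ReflectionGroup S w → ReflectionGroup S w′ →
                ReflectionGroup S (w ∘ w′)
    inverse   : ∀ {w w′} → ReflectionGroup S w →
                (∀ x → w (w′ x) ≈ᴹ x) → (∀ x → w′ (w x) ≈ᴹ x) →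
                ReflectionGroup S w′
    pointwise : ∀ {w w′} → ReflectionGroup S w → (∀ x → w′ x ≈ᴹ w x) →
                ReflectionGroup S w′

  -- A finite set of roots is given by a listing of its elements, in which
  -- repetitions are harmless. The reflections are orthogonal for ⟪_,_⟫, so the
  -- form is automatically invariant under the Weyl group.
  record IsRootSystem (Φ : Fin N → Carrierᴹ) : Set ℓ𝔼 where
    field
      spanning         : ∀ x → ∃[ t ] x ≈ᴹ combination t Φ
      nonzero          : ∀ i → ¬ (Φ i ≈ᴹ 0ᴹ)
      reflectionClosed : ∀ i j → reflection (Φ i) (Φ j) ∈ Range Φ
      crystallographic : ∀ i j → ∃[ z ] cartan (Φ i) (Φ j) ≈ fromℤ z
      reduced          : ∀ i t → t *ₗ Φ i ∈ Range Φ → t ≈ 1# ⊎ t ≈ - 1#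

  record IsSimpleSystem (Φ : Fin N → Carrierᴹ) (Π : Fin r → Carrierᴹ) : Set ℓ𝔼 where
    field
      simpleRoots : ∀ i → Π i ∈ Range Φ
      independent : LinearlyIndependent Π
      sameSign    : ∀ j → ∃[ t ] Φ j ≈ᴹ combination t Π ×
                    ((∀ i → 0# ≤ t i) ⊎ (∀ i → t i ≤ 0#))

  weylGroup : (Fin N → Carrierᴹ) → Pred (Carrierᴹ → Carrierᴹ) (m ⊔ ℓm)
  weylGroup Φ = ReflectionGroup (Range Φ)

  rootPolytope : (Fin N → Carrierᴹ) → Subset
  rootPolytope Φ = convexHull (Range Φ)

  chamber : (Fin r → Carrierᴹ) → Pred Carrierᴹ ℓ₂
  chamber Π x = ∀ i → 0# ≤ ⟪ x , Π i ⟫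

  _⊥ : Carrierᴹ → Pred Carrierᴹ ℓ₁
  (β ⊥) x = ⟪ x , β ⟫ ≈ 0#

  IsStandardFace : (Fin N → Carrierᴹ) → (Fin r → Carrierᴹ) → Pred Subset ℓ𝔼
  IsStandardFace Φ Π F =
    IsFaceOf (rootPolytope Φ) F × (relativeInterior F ≬ chamber Π ⊎ Empty F)

  stabilizer : (Fin N → Carrierᴹ) → Subset → Pred (Carrierᴹ → Carrierᴹ) ℓ𝔼
  stabilizer Φ F w = w ∈ weylGroup Φ × image w F ≐ F

  orbit : (Fin N → Carrierᴹ) → Subset → Pred Subset ℓ𝔼
  orbit Φ F G = ∃[ w ] w ∈ weylGroup Φ × G ≐ image w F

{-# OPTIONS --safe #-}
module Submission where

open import Defs
open import Algebra.Solver.Ring.AlmostCommutativeRing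
  using (fromCommutativeRing; _-Raw-AlmostCommutative⟶_)
open import Data.Empty using (⊥-elim)
open import Data.Fin.Base using (Fin; zero; suc)
open import Data.Fin.Induction using (spo-wellFounded)
open import Data.Fin.Permutation using (Permutation′; permutation; _⟨$⟩ʳ_)
open import Data.Fin.Properties using (any?; all?; ¬∀⟶∃¬) renaming (_≟_ to _≟ꟳ_)
open import Data.Integer.Base as ℤ using (ℤ; +_; -[1+_])
open import Data.List.Base using (List; []; _∷_; _++_; _∷ʳ_; reverse; length)
open import Data.List.Properties using (unfold-reverse; length-reverse)
open import Data.Maybe.Base as Maybe using (Maybe)
open import Data.Nat.Base as ℕ using (ℕ; zero; suc)
open import Data.Nat.Induction using (<-wellFounded)
open import Data.Product using (_×_; _,_; proj₁; proj₂; ∃; ∃-syntax; ∃!)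
open import Data.Sum.Base using (_⊎_; inj₁; inj₂; [_,_]′)
open import Function.Base using (_∘_; id)
open import Function.Bundles using (_⇔_; mk⇔)
open import Function.Definitions using (Injective)
open import Induction.WellFounded using (WellFounded; Acc; acc)
open import Level using (_⊔_)
open import Relation.Binary.PropositionalEquality as ≡ using (_≡_)
open import Relation.Binary.Structures using (IsDecTotalOrder)
open import Relation.Nullary using (¬_; yes; no; Dec; _×-dec_; _⊎-dec_; ¬?)
open import Relation.Nullary.Decidable using (dec⇒maybe)
open import Relation.Unary using (Pred; _∈_; _≐_; _∩_; _≬_; Empty)
import Algebra.Solver.Ring as RingSolver
import Data.Integer.Properties as ℤ
import Data.Nat.Properties as ℕ
import Algebra.Properties.CommutativeMonoid.Sum ℕ.+-0-commutativeMonoid as Σℕ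

-- If x, y lie in the relative interior of a face F and a simple root α has
-- ⟪ x , α ⟫ ≥ 0 ≥ ⟪ y , α ⟫, then s_α F = F: writing F = {⟪ u , · ⟫ = k}, the sign
-- of ⟪ u , α ⟫ either gives s_α F = F at once or forces ⟪ · , α ⟫ to have constant
-- sign on F, hence to vanish there. By induction on the length of w, with the
-- exchange condition, it follows that if F and w F both meet the chamber in their
-- relative interiors then w F = F and w is a product of simple reflections
-- preserving F. This yields the uniqueness in the orbit and the stabilizer;
-- existence comes from moving a relatively interior point into the chamber.
--
-- The barycenter is relatively interior because F is the hull of its vertices: a
-- root orthogonal to all longer roots is exposed by the functional it defines, and
-- any other root of F is, by integrality, in the hull of longer roots on F.

-- In the classical argument about dominant points a simple reflection ends up fixing the point.
-- Here `x` and `w y` may be different points of the same face and a simple reflection need fix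
-- neither; only the face survives, and relative interiority is what turns a one-sided sign
-- condition into vanishing. The orbit statement comes with no barycenter, so the induction works
-- with arbitrary relatively interior points.
--
-- The link with `β ⊥` is separate: a simple reflection preserving F permutes its vertices, so its
-- root is orthogonal to their sum; conversely, if `Π i` is orthogonal to `β`, then `β` serves as
-- both points of the sign argument.
--
-- The barycenter needs care because the polytope is the hull of all roots, `β` averages vertices
-- only, and short roots on a face may fail to be vertices. The mean of a finite family is
-- relatively interior to the hull of that family, so it remains to see that the vertices generate
-- the face. This is done by hand, from long roots to short ones: two roots of different lengths
-- that are not orthogonal have, up to sign, a Cartan integer at least 2.

module OrderedField {c ℓ₁ ℓ₂} (ℝ : RealField c ℓ₁ ℓ₂) where
  open RealField ℝ hiding (zero)
  open IsDecTotalOrder isDecTotalOrder public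
    using (total; antisym; _≟_; _≤?_; ≤-respˡ-≈; ≤-respʳ-≈)
    renaming (trans to ≤-trans; reflexive to ≤-reflexive)
  open import Algebra.Properties.Ring ring using (-‿distribˡ-*; -‿distribʳ-*)
  open import Algebra.Properties.AbelianGroup +-abelianGroup
    using (⁻¹-∙-comm; ⁻¹-involutive; ε⁻¹≈ε; xyx⁻¹≈y)
  open import Algebra.Properties.Semiring.Sum semiring
    using (sum; sum-permute; sum-cong-≋; ∑-comm; ∑-distrib-+; *-distribˡ-sum; *-distribʳ-sum; sum-replicate-zero)
  open import Relation.Binary.Reasoning.Setoid setoid

  ≤-refl : ∀ {x} → x ≤ x
  ≤-refl = ≤-reflexive refl

  -- Integer coefficients for the ring solver

  fromℕ-+ : ∀ m n → fromℕ (m ℕ.+ n) ≈ fromℕ m + fromℕ n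
  fromℕ-+ zero    n = sym (+-identityˡ _)
  fromℕ-+ (suc m) n = trans (+-congˡ (fromℕ-+ m n)) (sym (+-assoc _ _ _))

  fromℕ-* : ∀ m n → fromℕ (m ℕ.* n) ≈ fromℕ m * fromℕ n
  fromℕ-* zero    n = sym (zeroˡ _)
  fromℕ-* (suc m) n = begin
    fromℕ (n ℕ.+ m ℕ.* n)               ≈⟨ fromℕ-+ n (m ℕ.* n) ⟩
    fromℕ n + fromℕ (m ℕ.* n)           ≈⟨ +-cong (sym (*-identityˡ _)) (fromℕ-* m n) ⟩
    1# * fromℕ n + fromℕ m * fromℕ n    ≈⟨ distribʳ _ _ _ ⟨
    (1# + fromℕ m) * fromℕ n            ∎

  fromℤ-⊖ : ∀ m n → fromℤ (m ℤ.⊖ n) ≈ fromℕ m - fromℕ n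
  fromℤ-⊖ m zero = sym (trans (+-congˡ ε⁻¹≈ε) (+-identityʳ _))
  fromℤ-⊖ zero (suc n) = sym (+-identityˡ _)
  fromℤ-⊖ (suc m) (suc n) = begin
    fromℤ (suc m ℤ.⊖ suc n)                ≡⟨ ≡.cong fromℤ (ℤ.[1+m]⊖[1+n]≡m⊖n m n) ⟩
    fromℤ (m ℤ.⊖ n)                        ≈⟨ fromℤ-⊖ m n ⟩
    fromℕ m - fromℕ n                      ≈⟨ +-congʳ (xyx⁻¹≈y 1# (fromℕ m)) ⟨
    (1# + fromℕ m - 1#) - fromℕ n          ≈⟨ +-assoc _ _ _ ⟩
    (1# + fromℕ m) + (- 1# - fromℕ n)      ≈⟨ +-congˡ (⁻¹-∙-comm _ _) ⟩
    (1# + fromℕ m) - (1# + fromℕ n)        ∎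

  fromℤ-neg : ∀ i → fromℤ (ℤ.- i) ≈ - fromℤ i
  fromℤ-neg (+ zero)  = sym ε⁻¹≈ε
  fromℤ-neg (+ suc n) = refl
  fromℤ-neg -[1+ n ]  = sym (⁻¹-involutive _)

  fromℤ-+ : ∀ i j → fromℤ (i ℤ.+ j) ≈ fromℤ i + fromℤ j
  fromℤ-+ (+ m)    (+ n)    = fromℕ-+ m n
  fromℤ-+ (+ m)    -[1+ n ] = fromℤ-⊖ m (suc n)
  fromℤ-+ -[1+ m ] (+ n)    = trans (fromℤ-⊖ n (suc m)) (+-comm _ _)
  fromℤ-+ -[1+ m ] -[1+ n ] = begin
    - fromℕ (suc (suc (m ℕ.+ n)))        ≡⟨ ≡.cong (λ k → - fromℕ (suc k)) (≡.sym (ℕ.+-suc m n)) ⟩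
    - fromℕ (suc m ℕ.+ suc n)            ≈⟨ -‿cong (fromℕ-+ (suc m) (suc n)) ⟩
    - (fromℕ (suc m) + fromℕ (suc n))    ≈⟨ ⁻¹-∙-comm _ _ ⟨
    - fromℕ (suc m) - fromℕ (suc n)      ∎

  fromℤ-*⁺ : ∀ m j → fromℤ (+ m ℤ.* j) ≈ fromℕ m * fromℤ j
  fromℤ-*⁺ m (+ n) = trans (reflexive (≡.cong fromℤ (≡.sym (ℤ.pos-* m n)))) (fromℕ-* m n)
  fromℤ-*⁺ m -[1+ n ] = begin
    fromℤ (+ m ℤ.* (ℤ.- (+ suc n)))    ≡⟨ ≡.cong fromℤ (≡.sym (ℤ.neg-distribʳ-* (+ m) (+ suc n))) ⟩
    fromℤ (ℤ.- (+ m ℤ.* + suc n))      ≈⟨ fromℤ-neg (+ m ℤ.* + suc n) ⟩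
    - fromℤ (+ m ℤ.* + suc n)          ≈⟨ -‿cong (fromℤ-*⁺ m (+ suc n)) ⟩
    - (fromℕ m * fromℕ (suc n))        ≈⟨ -‿distribʳ-* _ _ ⟩
    fromℕ m * - fromℕ (suc n)          ∎

  fromℤ-* : ∀ i j → fromℤ (i ℤ.* j) ≈ fromℤ i * fromℤ j
  fromℤ-* (+ m)    j = fromℤ-*⁺ m j
  fromℤ-* -[1+ m ] j = begin
    fromℤ ((ℤ.- (+ suc m)) ℤ.* j)    ≡⟨ ≡.cong fromℤ (≡.sym (ℤ.neg-distribˡ-* (+ suc m) j)) ⟩
    fromℤ (ℤ.- (+ suc m ℤ.* j))      ≈⟨ fromℤ-neg (+ suc m ℤ.* j) ⟩
    - fromℤ (+ suc m ℤ.* j)          ≈⟨ -‿cong (fromℤ-*⁺ (suc m) j) ⟩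
    - (fromℕ (suc m) * fromℤ j)      ≈⟨ -‿distribˡ-* _ _ ⟩
    - fromℕ (suc m) * fromℤ j        ∎

  -- Agrees with fromℤ, but sends + 1 to 1# itself rather than to 1# + 0#, so that
  -- goals mentioning 1# are syntactically in the image of the solver's constants.
  literal : ℤ → Carrier
  literal (+ 1) = 1#
  literal i     = fromℤ i

  literal≈fromℤ : ∀ i → literal i ≈ fromℤ i
  literal≈fromℤ (+ zero)        = refl
  literal≈fromℤ (+ 1)           = sym (+-identityʳ 1#)
  literal≈fromℤ (+ suc (suc n)) = refl
  literal≈fromℤ -[1+ n ]        = refl

  literal-morphism : ℤ.+-*-rawRing -Raw-AlmostCommutative⟶ fromCommutativeRing commutativeRing
  literal-morphism = record
    { ⟦_⟧    = literal
    ; +-homo = λ i j → homo (i ℤ.+ j) (trans (fromℤ-+ i j) (sym (+-cong (literal≈fromℤ i) (literal≈fromℤ j))))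
    ; *-homo = λ i j → homo (i ℤ.* j) (trans (fromℤ-* i j) (sym (*-cong (literal≈fromℤ i) (literal≈fromℤ j))))
    ; -‿homo = λ i → homo (ℤ.- i) (trans (fromℤ-neg i) (sym (-‿cong (literal≈fromℤ i))))
    ; 0-homo = refl
    ; 1-homo = refl
    }
    where
    homo : ∀ i {x} → fromℤ i ≈ x → literal i ≈ x
    homo i = trans (literal≈fromℤ i)

  literal-≟ : ∀ i j → Maybe (literal i ≈ literal j)
  literal-≟ i j = Maybe.map (λ p → reflexive (≡.cong literal p)) (dec⇒maybe (i ℤ.≟ j))

  open RingSolver ℤ.+-*-rawRing (fromCommutativeRing commutativeRing) literal-morphism literal-≟ public
    using (solve; _:=_; con; _:+_; _:*_; :-_; _:-_)

  pattern :0 = con (+ 0)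
  pattern :1 = con (+ 1)

  -- Order arithmetic and finite sums

  ≤⇒0≤- : ∀ {x y} → x ≤ y → 0# ≤ y - x
  ≤⇒0≤- {x} {y} x≤y = ≤-respˡ-≈ (-‿inverseʳ x) (+-monoˡ-≤ (- x) x≤y)

  0≤-⇒≤ : ∀ {x y} → 0# ≤ y - x → x ≤ y
  0≤-⇒≤ {x} {y} p = ≤-respˡ-≈ (+-identityˡ x)
    (≤-respʳ-≈ (solve 2 (λ x y → (y :- x) :+ x := y) refl x y) (+-monoˡ-≤ x p))

  0≤-resp : ∀ {x y} → x ≈ y → 0# ≤ x → 0# ≤ y
  0≤-resp = ≤-respʳ-≈

  ≤0⇒0≤- : ∀ {x} → x ≤ 0# → 0# ≤ - x
  ≤0⇒0≤- p = 0≤-resp (+-identityˡ _) (≤⇒0≤- p)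

  0≤-⇒≤0 : ∀ {x} → 0# ≤ - x → x ≤ 0#
  0≤-⇒≤0 p = 0≤-⇒≤ (0≤-resp (sym (+-identityˡ _)) p)

  0≤x+y : ∀ {x y} → 0# ≤ x → 0# ≤ y → 0# ≤ x + y
  0≤x+y {x} {y} p q = ≤-trans q (≤-respˡ-≈ (+-identityˡ y) (+-monoˡ-≤ y p))

  +-mono-≤ : ∀ {x y u v} → x ≤ y → u ≤ v → x + u ≤ y + v
  +-mono-≤ {x} {y} {u} {v} p q = 0≤-⇒≤ (0≤-resp
    (solve 4 (λ x y u v → (y :- x) :+ (v :- u) := (y :+ v) :- (x :+ u)) refl x y u v)
    (0≤x+y (≤⇒0≤- p) (≤⇒0≤- q)))

  *-monoˡ-≤ : ∀ {x y z} → 0# ≤ x → y ≤ z → x * y ≤ x * z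
  *-monoˡ-≤ {x} {y} {z} p q = 0≤-⇒≤ (0≤-resp
    (solve 3 (λ x y z → x :* (z :- y) := x :* z :- x :* y) refl x y z)
    (*-nonNegative p (≤⇒0≤- q)))

  0≤x² : ∀ x → 0# ≤ x * x
  0≤x² x with total 0# x
  ... | inj₁ p = *-nonNegative p p
  ... | inj₂ p = 0≤-resp (solve 1 (λ x → :- x :* :- x := x :* x) refl x)
                   (*-nonNegative (≤0⇒0≤- p) (≤0⇒0≤- p))

  0≤1 : 0# ≤ 1#
  0≤1 = 0≤-resp (*-identityˡ 1#) (0≤x² 1#)

  pos : ∀ {x} → 0# ≤ x → ¬ (x ≈ 0#) → 0# < x
  pos p q = p , q ∘ sym

  pos⇒≉0 : ∀ {x} → 0# < x → ¬ (x ≈ 0#)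
  pos⇒≉0 p = proj₂ p ∘ sym

  0<1 : 0# < 1#
  0<1 = 0≤1 , 0≉1

  0<-resp : ∀ {x y} → x ≈ y → 0# < x → 0# < y
  0<-resp e (p , q) = 0≤-resp e p , λ z → q (trans z (sym e))

  ≰⇒> : ∀ {x y} → ¬ (x ≤ y) → y < x
  ≰⇒> {x} {y} p with total x y
  ... | inj₁ q = ⊥-elim (p q)
  ... | inj₂ q = q , λ e → p (≤-reflexive (sym e))

  <⇒≱ : ∀ {x y} → x < y → ¬ (y ≤ x)
  <⇒≱ (p , q) r = q (antisym p r)

  ≮⇒≥ : ∀ {x y} → ¬ (x < y) → y ≤ x
  ≮⇒≥ {x} {y} p with y ≤? x
  ... | yes q = q
  ... | no q  = ⊥-elim (p (≰⇒> q))

  <⇒0<- : ∀ {x y} → x < y → 0# < y - x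
  <⇒0<- {x} {y} (p , q) = ≤⇒0≤- p , λ e → q (begin
    x              ≈⟨ +-identityˡ x ⟨
    0# + x         ≈⟨ +-congʳ e ⟩
    (y - x) + x    ≈⟨ solve 2 (λ x y → (y :- x) :+ x := y) refl x y ⟩
    y              ∎)

  0<x+y : ∀ {x y} → 0# < x → 0# ≤ y → 0# < x + y
  0<x+y {x} {y} p q = 0≤x+y (proj₁ p) q , λ e → <⇒≱ p (0≤-⇒≤0 (0≤-resp
    (trans (solve 2 (λ x y → y := (x :+ y) :- x) refl x y) (trans (+-congʳ (sym e)) (+-identityˡ _))) q))

  <-trans : ∀ {x y z} → x < y → y < z → x < z
  <-trans (p , q) (p′ , q′) = ≤-trans p p′ , λ e → q (antisym p (≤-respʳ-≈ (sym e) p′))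

  <-respˡ : ∀ {x y z} → x ≈ y → x < z → y < z
  <-respˡ e (p , q) = ≤-respˡ-≈ e p , λ r → q (trans e r)

  <-respʳ : ∀ {x y z} → x ≈ y → z < x → z < y
  <-respʳ e (p , q) = ≤-respʳ-≈ e p , λ r → q (trans r (sym e))

  _<?_ : ∀ x y → Dec (x < y)
  x <? y with y ≤? x
  ... | yes p = no λ q → <⇒≱ q p
  ... | no p  = yes (≰⇒> p)

  ⁻¹-inverseˡ : ∀ {x} → ¬ (x ≈ 0#) → x ⁻¹ * x ≈ 1#
  ⁻¹-inverseˡ p = trans (*-comm _ _) (⁻¹-inverseʳ p)

  *-cancelˡ-0 : ∀ {x y} → ¬ (x ≈ 0#) → x * y ≈ 0# → y ≈ 0#
  *-cancelˡ-0 {x} {y} p e = begin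
    y               ≈⟨ *-identityˡ y ⟨
    1# * y          ≈⟨ *-congʳ (⁻¹-inverseˡ p) ⟨
    x ⁻¹ * x * y    ≈⟨ *-assoc _ _ _ ⟩
    x ⁻¹ * (x * y)  ≈⟨ *-congˡ e ⟩
    x ⁻¹ * 0#       ≈⟨ zeroʳ _ ⟩
    0#              ∎

  0<x*y : ∀ {x y} → 0# < x → 0# < y → 0# < x * y
  0<x*y p q = *-nonNegative (proj₁ p) (proj₁ q) , λ e →
    proj₂ q (sym (*-cancelˡ-0 (pos⇒≉0 p) (sym e)))

  *-cancelˡ-0≤ : ∀ {x y} → 0# < x → 0# ≤ x * y → 0# ≤ y
  *-cancelˡ-0≤ {x} {y} p q with 0# ≤? y
  ... | yes r = r
  ... | no r  = ⊥-elim (r (≤-reflexive (sym (*-cancelˡ-0 (pos⇒≉0 p) (antisym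
          (0≤-⇒≤0 (0≤-resp (sym (-‿distribʳ-* x y)) (*-nonNegative (proj₁ p) (≤0⇒0≤- (proj₁ (≰⇒> r))))))
          q)))))

  0<x⁻¹ : ∀ {x} → 0# < x → 0# < x ⁻¹
  0<x⁻¹ {x} p = *-cancelˡ-0≤ p (0≤-resp (sym (⁻¹-inverseʳ (pos⇒≉0 p))) 0≤1) ,
    λ e → 0≉1 (trans (sym (zeroʳ x)) (trans (*-congˡ e) (⁻¹-inverseʳ (pos⇒≉0 p))))

  0≤fromℕ : ∀ n → 0# ≤ fromℕ n
  0≤fromℕ zero    = ≤-refl
  0≤fromℕ (suc n) = 0≤x+y 0≤1 (0≤fromℕ n)

  0<fromℕ-suc : ∀ n → 0# < fromℕ (suc n)
  0<fromℕ-suc n = 0<x+y 0<1 (0≤fromℕ n)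

  0<2 : 0# < 1# + 1#
  0<2 = 0<x+y 0<1 0≤1

  -- The discreteness of the integers. The crystallographic condition acts through this, by bounding
  -- Cartan integers from below.
  0<fromℤ⇒1≤ : ∀ z → 0# < fromℤ z → 1# ≤ fromℤ z
  0<fromℤ⇒1≤ (+ zero)  p = ⊥-elim (proj₂ p refl)
  0<fromℤ⇒1≤ (+ suc n) p = 0≤-⇒≤ (0≤-resp (sym (xyx⁻¹≈y 1# (fromℕ n))) (0≤fromℕ n))
  0<fromℤ⇒1≤ -[1+ n ]  p = ⊥-elim (<⇒≱ p (0≤-⇒≤0 (0≤-resp (sym (⁻¹-involutive _)) (0≤fromℕ (suc n)))))

  1<fromℤ⇒2≤ : ∀ z → 1# < fromℤ z → 1# + 1# ≤ fromℤ z
  1<fromℤ⇒2≤ z p = 0≤-⇒≤ (0≤-resp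
    (trans (+-congʳ (fromℤ-+ z -[1+ 0 ])) (solve 1 (λ x → (x :+ :- (:1 :+ :0)) :- :1 := x :- (:1 :+ :1)) refl (fromℤ z)))
    (≤⇒0≤- (0<fromℤ⇒1≤ (z ℤ.+ -[1+ 0 ]) (0<-resp
      (trans (solve 1 (λ x → x :- :1 := x :+ :- (:1 :+ :0)) refl (fromℤ z)) (sym (fromℤ-+ z -[1+ 0 ]))) (<⇒0<- p)))))

  -- The length is explicit: sum computes on it, so it cannot be inferred from a goal.
  module _ (n : ℕ) where
    Σ-cong : ∀ {f g : Fin n → Carrier} → (∀ i → f i ≈ g i) → sum f ≈ sum g
    Σ-cong = sum-cong-≋

    Σ-+ : ∀ (f g : Fin n → Carrier) → sum (λ i → f i + g i) ≈ sum f + sum g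
    Σ-+ = ∑-distrib-+

    Σ-swap : ∀ k (f : Fin n → Fin k → Carrier) → sum (λ i → sum (f i)) ≈ sum (λ j → sum (λ i → f i j))
    Σ-swap k = ∑-comm

    Σ-*ˡ : ∀ x (f : Fin n → Carrier) → x * sum f ≈ sum (λ i → x * f i)
    Σ-*ˡ = *-distribˡ-sum

    Σ-*ʳ : ∀ x (f : Fin n → Carrier) → sum f * x ≈ sum (λ i → f i * x)
    Σ-*ʳ = *-distribʳ-sum

    Σ-permute : ∀ (f : Fin n → Carrier) (π : Permutation′ n) → sum f ≈ sum (λ i → f (π ⟨$⟩ʳ i))
    Σ-permute = sum-permute

    Σ-zero : sum {n} (λ _ → 0#) ≈ 0#
    Σ-zero = sum-replicate-zero n

  Σ-nonNegative : ∀ {n} {f : Fin n → Carrier} → (∀ i → 0# ≤ f i) → 0# ≤ sum f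
  Σ-nonNegative {zero}  p = ≤-refl
  Σ-nonNegative {suc n} p = 0≤x+y (p zero) (Σ-nonNegative (p ∘ suc))

  term≤Σ : ∀ {n} {f : Fin n → Carrier} → (∀ i → 0# ≤ f i) → ∀ i → f i ≤ sum f
  term≤Σ {suc n} {f} p zero    = ≤-respˡ-≈ (+-identityʳ _) (+-mono-≤ ≤-refl (Σ-nonNegative (p ∘ suc)))
  term≤Σ {suc n} {f} p (suc i) = ≤-respˡ-≈ (+-identityˡ _) (+-mono-≤ (p zero) (term≤Σ (p ∘ suc) i))

  Σ≈0⇒term≈0 : ∀ {n} {f : Fin n → Carrier} → (∀ i → 0# ≤ f i) → sum f ≈ 0# → ∀ i → f i ≈ 0#
  Σ≈0⇒term≈0 p e i = antisym (≤-respʳ-≈ e (term≤Σ p i)) (p i)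

  Σ-mono-≤ : ∀ {n} {f g : Fin n → Carrier} → (∀ i → f i ≤ g i) → sum f ≤ sum g
  Σ-mono-≤ {zero}  p = ≤-refl
  Σ-mono-≤ {suc n} p = +-mono-≤ (p zero) (Σ-mono-≤ (p ∘ suc))

  Σ-const : ∀ n x → sum {n} (λ _ → x) ≈ fromℕ n * x
  Σ-const zero    x = sym (zeroˡ x)
  Σ-const (suc n) x = trans (+-congˡ (Σ-const n x))
    (solve 2 (λ x k → x :+ k :* x := (:1 :+ k) :* x) refl x (fromℕ n))

  -- The Kronecker delta, by recursion on both indices so that it reduces in step with `sum`.
  δ : ∀ {n} → Fin n → Fin n → Carrier
  δ zero    zero    = 1#
  δ zero    (suc j) = 0#
  δ (suc i) zero    = 0#
  δ (suc i) (suc j) = δ i j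

  δ-nonNegative : ∀ {n} (i j : Fin n) → 0# ≤ δ i j
  δ-nonNegative zero    zero    = 0≤1
  δ-nonNegative zero    (suc j) = ≤-refl
  δ-nonNegative (suc i) zero    = ≤-refl
  δ-nonNegative (suc i) (suc j) = δ-nonNegative i j

  Σ-δ : ∀ {n} (i : Fin n) (f : Fin n → Carrier) → sum (λ j → δ i j * f j) ≈ f i
  Σ-δ {suc n} zero f = begin
    1# * f zero + sum (λ j → 0# * f (suc j))  ≈⟨ +-cong (*-identityˡ _) (Σ-cong n (λ j → zeroˡ _)) ⟩
    f zero + sum {n} (λ _ → 0#)               ≈⟨ +-congˡ (Σ-zero n) ⟩
    f zero + 0#                               ≈⟨ +-identityʳ _ ⟩
    f zero                                    ∎
  Σ-δ {suc n} (suc i) f = trans (+-cong (zeroˡ _) (Σ-δ i (f ∘ suc))) (+-identityˡ _)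

  Σ-δ-1 : ∀ {n} (i : Fin n) → sum (δ i) ≈ 1#
  Σ-δ-1 {n} i = trans (Σ-cong n (λ j → sym (*-identityʳ (δ i j)))) (Σ-δ i (λ _ → 1#))

-- Inner products, hulls of finite families and Gram-Schmidt

module InnerProduct {c ℓ₁ ℓ₂ m ℓm} {ℝ : RealField c ℓ₁ ℓ₂} (𝔼 : InnerProductSpace ℝ m ℓm) where
  open OrderedField ℝ

  open RealField ℝ hiding (zero)
  open InnerProductSpace 𝔼
  open Geometry 𝔼
  open import Algebra.Properties.CommutativeMonoid.Sum +ᴹ-commutativeMonoid
    using () renaming (sum-cong-≋ to sumᴹ-cong-≋)
  open import Algebra.Properties.AbelianGroup +ᴹ-abelianGroup using (x∙y⁻¹≈ε⇒x≈y)
  open import Relation.Binary.Reasoning.Setoid setoid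

  private variable
    n k : ℕ

  sumᴹ-cong : ∀ n {v w : Fin n → Carrierᴹ} → (∀ i → v i ≈ᴹ w i) → Σᴹ v ≈ᴹ Σᴹ w
  sumᴹ-cong n = sumᴹ-cong-≋

  ⟪⟫-congˡ : ∀ {x y z} → x ≈ᴹ y → ⟪ x , z ⟫ ≈ ⟪ y , z ⟫
  ⟪⟫-congˡ e = ⟪⟫-cong e ≈ᴹ-refl

  ⟪⟫-congʳ : ∀ {x y z} → x ≈ᴹ y → ⟪ z , x ⟫ ≈ ⟪ z , y ⟫
  ⟪⟫-congʳ e = ⟪⟫-cong ≈ᴹ-refl e

  ⟪⟫-0ˡ : ∀ z → ⟪ 0ᴹ , z ⟫ ≈ 0#
  ⟪⟫-0ˡ z = trans (⟪⟫-congˡ (≈ᴹ-sym (*ₗ-zeroˡ 0ᴹ))) (trans (⟪⟫-*ˡ 0# 0ᴹ z) (zeroˡ _))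

  ⟪⟫-negˡ : ∀ x z → ⟪ -ᴹ x , z ⟫ ≈ - ⟪ x , z ⟫
  ⟪⟫-negˡ x z = begin
    p                    ≈⟨ solve 2 (λ n x → n := (n :+ x) :- x) refl p ⟪ x , z ⟫ ⟩
    (p + ⟪ x , z ⟫) - ⟪ x , z ⟫   ≈⟨ +-congʳ (⟪⟫-+ˡ _ _ _) ⟨
    ⟪ -ᴹ x +ᴹ x , z ⟫ - ⟪ x , z ⟫ ≈⟨ +-congʳ (trans (⟪⟫-congˡ (-ᴹ‿inverseˡ x)) (⟪⟫-0ˡ z)) ⟩
    0# - ⟪ x , z ⟫       ≈⟨ +-identityˡ _ ⟩
    - ⟪ x , z ⟫          ∎
    where p = ⟪ -ᴹ x , z ⟫

  -- Expansion of ⟪ e , z ⟫ along the syntax of e.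
  infixl 6 _⟨+⟩_ _⟨-⟩_
  infixr 7 _⟨*⟩_
  infixr 8 ⟨-⟩_

  _⟨+⟩_ : ∀ {x y z a b} → ⟪ x , z ⟫ ≈ a → ⟪ y , z ⟫ ≈ b → ⟪ x +ᴹ y , z ⟫ ≈ a + b
  p ⟨+⟩ q = trans (⟪⟫-+ˡ _ _ _) (+-cong p q)

  ⟨-⟩_ : ∀ {x z a} → ⟪ x , z ⟫ ≈ a → ⟪ -ᴹ x , z ⟫ ≈ - a
  ⟨-⟩ p = trans (⟪⟫-negˡ _ _) (-‿cong p)

  _⟨-⟩_ : ∀ {x y z a b} → ⟪ x , z ⟫ ≈ a → ⟪ y , z ⟫ ≈ b → ⟪ x -ᴹ y , z ⟫ ≈ a - b
  p ⟨-⟩ q = p ⟨+⟩ (⟨-⟩ q)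

  _⟨*⟩_ : ∀ s {x z a} → ⟪ x , z ⟫ ≈ a → ⟪ s *ₗ x , z ⟫ ≈ s * a
  s ⟨*⟩ p = trans (⟪⟫-*ˡ _ _ _) (*-congˡ p)

  ⟨_⟩ : ∀ {z} x → ⟪ x , z ⟫ ≈ ⟪ x , z ⟫
  ⟨ x ⟩ = refl

  flip : ∀ {x z a} → ⟪ x , z ⟫ ≈ a → ⟪ z , x ⟫ ≈ a
  flip p = trans (⟪⟫-sym _ _) p

  ⟪⟫-Σ : ∀ (v : Fin n → Carrierᴹ) z → ⟪ Σᴹ v , z ⟫ ≈ Σᴷ (λ i → ⟪ v i , z ⟫)
  ⟪⟫-Σ {zero}  v z = ⟪⟫-0ˡ z
  ⟪⟫-Σ {suc n} v z = ⟨ v zero ⟩ ⟨+⟩ ⟪⟫-Σ (v ∘ suc) z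

  ⟪⟫-combination : ∀ (t : Fin n → Carrier) v z →
                   ⟪ combination t v , z ⟫ ≈ Σᴷ (λ i → t i * ⟪ v i , z ⟫)
  ⟪⟫-combination {n} t v z = trans (⟪⟫-Σ (λ i → t i *ₗ v i) z) (Σ-cong n (λ i → ⟪⟫-*ˡ (t i) (v i) z))

  ⟪,⟫-combination : ∀ z (t : Fin n → Carrier) v →
                   ⟪ z , combination t v ⟫ ≈ Σᴷ (λ i → t i * ⟪ z , v i ⟫)
  ⟪,⟫-combination {n} z t v = trans (flip (⟪⟫-combination t v z))
    (Σ-cong n (λ i → *-congˡ (⟪⟫-sym (v i) z)))

  x-y≈0⇒x≈y : ∀ {x y} → x -ᴹ y ≈ᴹ 0ᴹ → x ≈ᴹ y
  x-y≈0⇒x≈y = x∙y⁻¹≈ε⇒x≈y _ _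

  -- Testing against `x -ᴹ y` suffices, by definiteness. Vector identities are proved this way
  -- throughout: paired with an arbitrary `z` they become scalar identities, within reach of the
  -- ring solver.
  ⟪⟫-ext : ∀ {x y} → (∀ z → ⟪ x , z ⟫ ≈ ⟪ y , z ⟫) → x ≈ᴹ y
  ⟪⟫-ext {x} {y} p = x-y≈0⇒x≈y (⟪⟫-definite (trans (p _ ⟨-⟩ refl) (-‿inverseʳ _)))

  _≟ᴹ_ : ∀ x y → Dec (x ≈ᴹ y)
  x ≟ᴹ y with ⟪ x -ᴹ y , x -ᴹ y ⟫ ≟ 0#
  ... | yes p = yes (x-y≈0⇒x≈y (⟪⟫-definite p))
  ... | no p  = no λ e → p (trans (⟪⟫-congˡ (≈ᴹ-trans (+ᴹ-congʳ e) (-ᴹ‿inverseʳ y))) (⟪⟫-0ˡ _))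

  0<⟪x,x⟫ : ∀ {x} → ¬ (x ≈ᴹ 0ᴹ) → 0# < ⟪ x , x ⟫
  0<⟪x,x⟫ p = pos (⟪⟫-nonNeg _) (p ∘ ⟪⟫-definite)

  combination-congʳ : ∀ (t : Fin n → Carrier) {v w} → (∀ i → v i ≈ᴹ w i) →
                      combination t v ≈ᴹ combination t w
  combination-congʳ {n} t p = sumᴹ-cong n (λ i → *ₗ-congˡ (p i))

  combination-δ : ∀ (i : Fin n) v → combination (δ i) v ≈ᴹ v i
  combination-δ i v = ⟪⟫-ext λ z → trans (⟪⟫-combination (δ i) v z) (Σ-δ i _)

  Σ-bind : ∀ (s : Fin k → Carrier) (t : Fin k → Fin n → Carrier) (p : Fin n → Carrier) →
           Σᴷ (λ i → s i * Σᴷ (λ j → t i j * p j)) ≈ Σᴷ (λ j → Σᴷ (λ i → s i * t i j) * p j)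
  Σ-bind {k} {n} s t p = begin
    Σᴷ (λ i → s i * Σᴷ (λ j → t i j * p j))     ≈⟨ Σ-cong k (λ i → Σ-*ˡ n (s i) _) ⟩
    Σᴷ (λ i → Σᴷ (λ j → s i * (t i j * p j)))   ≈⟨ Σ-swap k n _ ⟩
    Σᴷ (λ j → Σᴷ (λ i → s i * (t i j * p j)))   ≈⟨ Σ-cong n (λ j → trans (Σ-*ʳ k (p j) _) (Σ-cong k (λ i → *-assoc _ _ _))) ⟨
    Σᴷ (λ j → Σᴷ (λ i → s i * t i j) * p j)     ∎

  Σ-bind-1 : ∀ (s : Fin k → Carrier) (t : Fin k → Fin n → Carrier) →
             Σᴷ (λ j → Σᴷ (λ i → s i * t i j)) ≈ Σᴷ (λ i → s i * Σᴷ (t i))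
  Σ-bind-1 {k} {n} s t = sym (trans (Σ-cong k (λ i → Σ-*ˡ n (s i) _)) (Σ-swap k n _))

  combination-bind : ∀ (s : Fin k → Carrier) (t : Fin k → Fin n → Carrier) v →
                     combination s (λ i → combination (t i) v) ≈ᴹ combination (λ j → Σᴷ (λ i → s i * t i j)) v
  combination-bind {k} s t v = ⟪⟫-ext λ z → begin
    ⟪ combination s (λ i → combination (t i) v) , z ⟫     ≈⟨ ⟪⟫-combination s _ z ⟩
    Σᴷ (λ i → s i * ⟪ combination (t i) v , z ⟫)          ≈⟨ Σ-cong k (λ i → *-congˡ (⟪⟫-combination (t i) v z)) ⟩
    Σᴷ (λ i → s i * Σᴷ (λ j → t i j * ⟪ v j , z ⟫))       ≈⟨ Σ-bind s t (λ j → ⟪ v j , z ⟫) ⟩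
    Σᴷ (λ j → Σᴷ (λ i → s i * t i j) * ⟪ v j , z ⟫)       ≈⟨ ⟪⟫-combination _ v z ⟨
    ⟪ combination (λ j → Σᴷ (λ i → s i * t i j)) v , z ⟫  ∎

  -- Unlike convexHull, this fixes the points, so that nested combinations compose
  -- by multiplying the arrays of weights.
  Hull : (Fin n → Carrierᴹ) → Pred Carrierᴹ (c ⊔ ℓ₁ ⊔ ℓ₂ ⊔ ℓm)
  Hull v x = ∃[ t ] (∀ i → 0# ≤ t i) × Σᴷ t ≈ 1# × x ≈ᴹ combination t v

  Hull-resp : ∀ {v : Fin n → Carrierᴹ} {x y} → x ≈ᴹ y → Hull v x → Hull v y
  Hull-resp e (t , p , q , r) = t , p , q , ≈ᴹ-trans (≈ᴹ-sym e) r

  Hull-generator : ∀ (v : Fin n → Carrierᴹ) i → Hull v (v i)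
  Hull-generator v i = δ i , δ-nonNegative i , Σ-δ-1 i , ≈ᴹ-sym (combination-δ i v)

  -- Points of weight 0 are not required to lie in the hull.
  Hull-bind : ∀ {v : Fin n → Carrierᴹ} (s : Fin k → Carrier) x →
              (∀ i → 0# ≤ s i) → Σᴷ s ≈ 1# → (∀ i → s i ≈ 0# ⊎ Hull v (x i)) →
              Hull v (combination s x)
  Hull-bind {n = n} {k = k} {v = v} s x s≥0 Σs h =
    (λ j → Σᴷ (λ i → s i * row i j)) ,
    (λ j → Σ-nonNegative (λ i → *-nonNegative (s≥0 i) (row≥0 i j))) ,
    trans (Σ-bind-1 s row) (trans (Σ-cong k Σrow) Σs) ,
    ≈ᴹ-trans (sumᴹ-cong k xrow) (combination-bind s row v)
    where
    -- A point of weight 0 gets the zero row; the failure of that row to sum to 1 is hidden by the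
    -- factor `s i`.
    row : ∀ i → Fin n → Carrier
    row i with h i
    ... | inj₁ _ = λ _ → 0#
    ... | inj₂ (r , _) = r

    row≥0 : ∀ i j → 0# ≤ row i j
    row≥0 i j with h i
    ... | inj₁ _ = ≤-refl
    ... | inj₂ (r , r≥0 , _) = r≥0 j

    Σrow : ∀ i → s i * Σᴷ (row i) ≈ s i
    Σrow i with h i
    ... | inj₁ e = trans (*-congʳ e) (trans (zeroˡ _) (sym e))
    ... | inj₂ (r , _ , Σr , _) = trans (*-congˡ Σr) (*-identityʳ _)

    xrow : ∀ i → s i *ₗ x i ≈ᴹ s i *ₗ combination (row i) v
    xrow i with h i
    ... | inj₁ e = ≈ᴹ-trans (*ₗ-congʳ e) (≈ᴹ-trans (*ₗ-zeroˡ _)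
                     (≈ᴹ-sym (≈ᴹ-trans (*ₗ-congʳ e) (*ₗ-zeroˡ _))))
    ... | inj₂ (r , _ , _ , xr) = *ₗ-congˡ xr

  convexHull⇒Hull : ∀ {a} {S : Pred Carrierᴹ a} {v : Fin n → Carrierᴹ} → (∀ {y} → y ∈ S → Hull v y) →
                    ∀ {x} → x ∈ convexHull S → Hull v x
  convexHull⇒Hull h (_ , t , y , y∈S , t≥0 , Σt , e) =
    Hull-resp (≈ᴹ-sym e) (Hull-bind t y t≥0 Σt (λ i → inj₂ (h (y∈S i))))

  Hull⇒convexHull : ∀ {a} {S : Pred Carrierᴹ a} {v : Fin n → Carrierᴹ} → (∀ i → v i ∈ S) →
                    ∀ {x} → Hull v x → x ∈ convexHull S
  Hull⇒convexHull p (t , t≥0 , Σt , e) = _ , t , _ , p , t≥0 , Σt , e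

  ⟪⟫-Hull-≤ : ∀ {v : Fin n → Carrierᴹ} {u b} → (∀ i → ⟪ u , v i ⟫ ≤ b) → ∀ {x} → Hull v x → ⟪ u , x ⟫ ≤ b
  ⟪⟫-Hull-≤ {n} {v = v} {u} {b} p {x} (t , t≥0 , Σt , e) =
    ≤-respˡ-≈ (sym (trans (⟪⟫-congʳ e) (⟪,⟫-combination u t v)))
    (≤-respʳ-≈ (trans (sym (Σ-*ʳ n b t)) (trans (*-congʳ Σt) (*-identityˡ b)))
      (Σ-mono-≤ (λ i → *-monoˡ-≤ (t≥0 i) (p i))))

  -- The weighted mean of the gaps `b - ⟪ u , v i ⟫` is 0 and no gap is negative, so every gap of
  -- nonzero weight vanishes. This confines the points of a face to the generators lying on it.
  support : ∀ (t : Fin n → Carrier) v {u b x} → (∀ i → 0# ≤ t i) → Σᴷ t ≈ 1# → x ≈ᴹ combination t v →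
            (∀ i → ⟪ u , v i ⟫ ≤ b) → ⟪ u , x ⟫ ≈ b → ∀ i → t i ≈ 0# ⊎ ⟪ u , v i ⟫ ≈ b
  support {n} t v {u} {b} {x} t≥0 Σt e p q i with t i ≟ 0#
  ... | yes z = inj₁ z
  ... | no nz = inj₂ (begin
    ⟪ u , v i ⟫             ≈⟨ solve 2 (λ b y → y := b :- (b :- y)) refl b ⟪ u , v i ⟫ ⟩
    b - (b - ⟪ u , v i ⟫)   ≈⟨ +-congˡ (-‿cong (*-cancelˡ-0 nz (Σ≈0⇒term≈0 {f = λ j → t j * (b - ⟪ u , v j ⟫)}
                                 (λ j → *-nonNegative (t≥0 j) (≤⇒0≤- (p j))) gap i))) ⟩
    b - 0#                  ≈⟨ solve 1 (λ b → b :- :0 := b) refl b ⟩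
    b                       ∎)
    where
    gap : Σᴷ (λ j → t j * (b - ⟪ u , v j ⟫)) ≈ 0#
    gap = begin
      Σᴷ (λ j → t j * (b - ⟪ u , v j ⟫))
        ≈⟨ Σ-cong n (λ j → solve 3 (λ t b y → t :* (b :- y) := t :* b :+ (:- :1) :* (t :* y)) refl (t j) b ⟪ u , v j ⟫) ⟩
      Σᴷ (λ j → t j * b + - 1# * (t j * ⟪ u , v j ⟫))
        ≈⟨ Σ-+ n (λ j → t j * b) _ ⟩
      Σᴷ (λ j → t j * b) + Σᴷ (λ j → - 1# * (t j * ⟪ u , v j ⟫))
        ≈⟨ +-cong (Σ-*ʳ n b t) (Σ-*ˡ n (- 1#) (λ j → t j * ⟪ u , v j ⟫)) ⟨
      Σᴷ t * b + - 1# * Σᴷ (λ j → t j * ⟪ u , v j ⟫)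
        ≈⟨ +-cong (*-congʳ Σt) (*-congˡ (trans (sym (trans (⟪⟫-congʳ e) (⟪,⟫-combination u t v))) q)) ⟩
      1# * b + - 1# * b
        ≈⟨ solve 1 (λ b → :1 :* b :+ (:- :1) :* b := :0) refl b ⟩
      0# ∎

  some-weight≉0 : ∀ (t : Fin n → Carrier) → Σᴷ t ≈ 1# → ∃[ i ] ¬ (t i ≈ 0#)
  some-weight≉0 {zero}  t e = ⊥-elim (0≉1 e)
  some-weight≉0 {suc n} t e with t zero ≟ 0#
  ... | no p  = zero , p
  ... | yes p with i , q ← some-weight≉0 (t ∘ suc) (trans (trans (sym (+-identityˡ _)) (+-congʳ (sym p))) e) = suc i , q

  -- Gram–Schmidt: vectors f whose pairings give the coordinates, with respect to
  -- v, of the orthogonal projection to the span of v.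
  residual : (v f : Fin n → Carrierᴹ) → Carrierᴹ → Carrierᴹ
  residual v f z = z -ᴹ combination (λ j → ⟪ z , f j ⟫) v

  IsFrame : (v f : Fin n → Carrierᴹ) → Set (m ⊔ ℓ₁)
  IsFrame v f = ∀ z i → ⟪ residual v f z , v i ⟫ ≈ 0#

  ⊥-combination : ∀ {v : Fin n → Carrierᴹ} {z} → (∀ i → ⟪ z , v i ⟫ ≈ 0#) → ∀ t → ⟪ z , combination t v ⟫ ≈ 0#
  ⊥-combination {n = n} {v = v} {z} p t = trans (⟪,⟫-combination z t v)
    (trans (Σ-cong n (λ i → trans (*-congˡ (p i)) (zeroʳ _))) (Σ-zero n))

  -- Choosing `0ᴹ` when `e` vanishes keeps the identity true, so that `frame` also covers dependent
  -- families, such as differences from a mean.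
  dual-vector : ∀ e → ∃[ g ] ∀ z → ⟪ z , g ⟫ * ⟪ e , e ⟫ ≈ ⟪ z , e ⟫
  dual-vector e with ⟪ e , e ⟫ ≟ 0#
  ... | yes p = 0ᴹ , λ z → trans (*-congˡ p) (trans (zeroʳ _) (sym (trans (⟪⟫-congʳ (⟪⟫-definite p)) (flip (⟪⟫-0ˡ z)))))
  ... | no p  = ⟪ e , e ⟫ ⁻¹ *ₗ e , λ z → begin
    ⟪ z , ⟪ e , e ⟫ ⁻¹ *ₗ e ⟫ * ⟪ e , e ⟫   ≈⟨ *-congʳ (flip (_ ⟨*⟩ ⟪⟫-sym e z)) ⟩
    ⟪ e , e ⟫ ⁻¹ * ⟪ z , e ⟫ * ⟪ e , e ⟫    ≈⟨ solve 3 (λ q a x → q :* x :* a := (a :* q) :* x) refl _ _ _ ⟩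
    ⟪ e , e ⟫ * ⟪ e , e ⟫ ⁻¹ * ⟪ z , e ⟫    ≈⟨ *-congʳ (⁻¹-inverseʳ p) ⟩
    1# * ⟪ z , e ⟫                          ≈⟨ *-identityˡ _ ⟩
    ⟪ z , e ⟫                               ∎

  frame : ∀ (v : Fin n → Carrierᴹ) → ∃ (IsFrame v)
  frame {zero}  v = (λ ()) , λ z ()
  frame {suc n} v = f′ , isFrame′
    where
    w = v zero
    v₁ = v ∘ suc
    f = proj₁ (frame v₁)
    isFrame = proj₂ (frame v₁)
    R = residual v₁ f
    e = R w
    g = proj₁ (dual-vector e)

    -- `e` is the part of `w` orthogonal to `v₁`, so `g` reads off the coefficient of `w`. The
    -- remaining coordinates are corrected by what that multiple of `w` already contributes along
    -- `v₁`.
    f′ : Fin (suc n) → Carrierᴹ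
    f′ zero    = g
    f′ (suc j) = f j -ᴹ ⟪ w , f j ⟫ *ₗ g

    residual′ : ∀ z → residual v f′ z ≈ᴹ R z -ᴹ ⟪ z , g ⟫ *ₗ e
    residual′ z = ⟪⟫-ext λ y → let
        S = Σᴷ (λ j → ⟪ z , f j ⟫ * ⟪ v₁ j , y ⟫)
        T = Σᴷ (λ j → ⟪ w , f j ⟫ * ⟪ v₁ j , y ⟫)
      in begin
      ⟪ residual v f′ z , y ⟫
        ≈⟨ ⟨ z ⟩ ⟨-⟩ ⟪⟫-combination (λ j → ⟪ z , f′ j ⟫) v y ⟩
      ⟪ z , y ⟫ - (⟪ z , g ⟫ * ⟪ w , y ⟫ + Σᴷ (λ j → ⟪ z , f′ (suc j) ⟫ * ⟪ v₁ j , y ⟫))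
        ≈⟨ +-congˡ (-‿cong (+-congˡ (trans (Σ-cong n (λ j → trans
             (*-congʳ (flip (⟪⟫-sym (f j) z ⟨-⟩ ⟪ w , f j ⟫ ⟨*⟩ ⟪⟫-sym g z)))
             (solve 4 (λ a b c d → (a :- b :* c) :* d := a :* d :+ (:- c) :* (b :* d)) refl ⟪ z , f j ⟫ ⟪ w , f j ⟫ ⟪ z , g ⟫ ⟪ v₁ j , y ⟫)))
             (trans (Σ-+ n (λ j → ⟪ z , f j ⟫ * ⟪ v₁ j , y ⟫) _)
               (+-congˡ (sym (Σ-*ˡ n (- ⟪ z , g ⟫) (λ j → ⟪ w , f j ⟫ * ⟪ v₁ j , y ⟫)))))))) ⟩
      ⟪ z , y ⟫ - (⟪ z , g ⟫ * ⟪ w , y ⟫ + (S + - ⟪ z , g ⟫ * T))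
        ≈⟨ solve 5 (λ z g w s t → z :- (g :* w :+ (s :+ (:- g) :* t)) := (z :- s) :- g :* (w :- t)) refl ⟪ z , y ⟫ ⟪ z , g ⟫ ⟪ w , y ⟫ S T ⟩
      (⟪ z , y ⟫ - S) - ⟪ z , g ⟫ * (⟪ w , y ⟫ - T)
        ≈⟨ (⟨ z ⟩ ⟨-⟩ ⟪⟫-combination _ v₁ y) ⟨-⟩ ⟪ z , g ⟫ ⟨*⟩ (⟨ w ⟩ ⟨-⟩ ⟪⟫-combination _ v₁ y) ⟨
      ⟪ R z -ᴹ ⟪ z , g ⟫ *ₗ e , y ⟫ ∎

    ⊥e : ∀ z → ⟪ residual v f′ z , e ⟫ ≈ 0#
    ⊥e z = begin
      ⟪ residual v f′ z , e ⟫
        ≈⟨ ⟪⟫-congˡ (residual′ z) ⟩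
      ⟪ R z -ᴹ ⟪ z , g ⟫ *ₗ e , e ⟫
        ≈⟨ (⟨ z ⟩ ⟨-⟩ flip (⊥-combination (isFrame w) _)) ⟨-⟩ ⟪ z , g ⟫ ⟨*⟩ ⟨ e ⟩ ⟩
      (⟪ z , e ⟫ - 0#) - ⟪ z , g ⟫ * ⟪ e , e ⟫
        ≈⟨ +-congˡ (-‿cong (proj₂ (dual-vector e) z)) ⟩
      (⟪ z , e ⟫ - 0#) - ⟪ z , e ⟫
        ≈⟨ solve 1 (λ x → (x :- :0) :- x := :0) refl ⟪ z , e ⟫ ⟩
      0# ∎

    ⊥v₁ : ∀ z i → ⟪ residual v f′ z , v₁ i ⟫ ≈ 0#
    ⊥v₁ z i = begin
      ⟪ residual v f′ z , v₁ i ⟫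
        ≈⟨ ⟪⟫-congˡ (residual′ z) ⟩
      ⟪ R z -ᴹ ⟪ z , g ⟫ *ₗ e , v₁ i ⟫
        ≈⟨ isFrame z i ⟨-⟩ ⟪ z , g ⟫ ⟨*⟩ isFrame w i ⟩
      0# - ⟪ z , g ⟫ * 0#
        ≈⟨ solve 1 (λ x → :0 :- x :* :0 := :0) refl ⟪ z , g ⟫ ⟩
      0# ∎

    isFrame′ : IsFrame v f′
    isFrame′ z (suc i) = ⊥v₁ z i
    isFrame′ z zero = begin
      ⟪ r , w ⟫          ≈⟨ ⟪⟫-congʳ (⟪⟫-ext λ y → trans (solve 2 (λ a b → a := (a :- b) :+ b) refl _ _) (sym ((⟨ w ⟩ ⟨-⟩ refl) ⟨+⟩ refl))) ⟩
      ⟪ r , e +ᴹ combination (λ j → ⟪ w , f j ⟫) v₁ ⟫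
        ≈⟨ flip (flip (⊥e z) ⟨+⟩ flip (⊥-combination (⊥v₁ z) (λ j → ⟪ w , f j ⟫))) ⟩
      0# + 0#            ≈⟨ +-identityˡ 0# ⟩
      0#                 ∎
      where r = residual v f′ z

  -- The residual of `x` lies in the span of `v` and is orthogonal to that span, hence to itself.
  frame-coordinates : ∀ {v f : Fin n → Carrierᴹ} → IsFrame v f → ∀ {x} t → x ≈ᴹ combination t v →
                      x ≈ᴹ combination (λ j → ⟪ x , f j ⟫) v
  frame-coordinates {v = v} {f} isFrame {x} t e = x-y≈0⇒x≈y (⟪⟫-definite (begin
    ⟪ ρ , ρ ⟫    ≈⟨ flip (flip (trans (⟪⟫-congʳ e) (⊥-combination (isFrame x) t)) ⟨-⟩ flip (⊥-combination (isFrame x) _)) ⟩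
    0# - 0#      ≈⟨ -‿inverseʳ 0# ⟩
    0#           ∎))
    where ρ = residual v f x

-- Relative interiors

module RelativeInterior {c ℓ₁ ℓ₂ m ℓm} {ℝ : RealField c ℓ₁ ℓ₂} (𝔼 : InnerProductSpace ℝ m ℓm) where
  open OrderedField ℝ
  open InnerProduct 𝔼

  open RealField ℝ hiding (zero)
  open InnerProductSpace 𝔼
  open Geometry 𝔼
  open import Relation.Binary.Reasoning.Setoid setoid

  -- Scaled AM–GM, with the factor 2 kept on the left to avoid halving.
  2⟪⟫≤ : ∀ {ε M x f} → 0# < ε → ⟪ x , x ⟫ ≤ ε * ε → ⟪ f , f ⟫ ≤ M → (1# + 1#) * ⟪ x , f ⟫ ≤ ε * (1# + M)
  2⟪⟫≤ {ε} {M} {x} {f} 0<ε x≤ f≤ = 0≤-⇒≤ (*-cancelˡ-0≤ 0<ε (0≤-resp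
    (begin
      ⟪ d , d ⟫ + ((ε * ε - ⟪ x , x ⟫) + ε * ε * (M - ⟪ f , f ⟫))
        ≈⟨ +-congʳ (⟨ x ⟩ʳ ⟨-⟩ ε ⟨*⟩ ⟨ f ⟩ʳ) ⟩
      (⟪ x , x ⟫ - ε * ⟪ x , f ⟫ - ε * (⟪ f , x ⟫ - ε * ⟪ f , f ⟫)) + ((ε * ε - ⟪ x , x ⟫) + ε * ε * (M - ⟪ f , f ⟫))
        ≈⟨ +-congʳ (+-congˡ (-‿cong (*-congˡ (+-congʳ (⟪⟫-sym f x))))) ⟩
      (⟪ x , x ⟫ - ε * ⟪ x , f ⟫ - ε * (⟪ x , f ⟫ - ε * ⟪ f , f ⟫)) + ((ε * ε - ⟪ x , x ⟫) + ε * ε * (M - ⟪ f , f ⟫))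
        ≈⟨ solve 5 (λ ε M a b c → (a :- ε :* b :- ε :* (b :- ε :* c)) :+ ((ε :* ε :- a) :+ ε :* ε :* (M :- c))
                    := ε :* (ε :* (:1 :+ M) :- (:1 :+ :1) :* b)) refl ε M ⟪ x , x ⟫ ⟪ x , f ⟫ ⟪ f , f ⟫ ⟩
      ε * (ε * (1# + M) - (1# + 1#) * ⟪ x , f ⟫) ∎)
    (0≤x+y (⟪⟫-nonNeg d) (0≤x+y (≤⇒0≤- x≤) (*-nonNegative (0≤x² ε) (≤⇒0≤- f≤))))))
    where
    d = x -ᴹ ε *ₗ f
    ⟨_⟩ʳ : ∀ y → ⟪ y , d ⟫ ≈ ⟪ y , x ⟫ - ε * ⟪ y , f ⟫
    ⟨ y ⟩ʳ = flip (⟪⟫-sym x y ⟨-⟩ ε ⟨*⟩ ⟪⟫-sym f y)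

  module _ {a} {F : Pred Carrierᴹ a} {n : ℕ} (v : Fin (suc n) → Carrierᴹ)
           (Hull⊆F : ∀ {x} → Hull v x → x ∈ F) (F⊆Hull : ∀ {x} → x ∈ F → Hull v x)
           {β : Carrierᴹ} (β-avg : β ≈ᴹ fromℕ (suc n) ⁻¹ *ₗ Σᴹ v) where

    private
      N = fromℕ (suc n)
      q = N ⁻¹

      Nq≈1 : N * q ≈ 1#
      Nq≈1 = ⁻¹-inverseʳ (pos⇒≉0 (0<fromℕ-suc n))

      0<q : 0# < q
      0<q = 0<x⁻¹ (0<fromℕ-suc n)

      ⟪β,_⟫ : ∀ z → ⟪ β , z ⟫ ≈ q * Σᴷ (λ j → ⟪ v j , z ⟫)
      ⟪β, z ⟫ = trans (⟪⟫-congˡ β-avg) (q ⟨*⟩ ⟪⟫-Σ v z)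

      w : Fin (suc n) → Carrierᴹ
      w j = v j -ᴹ β

      f = proj₁ (frame w)

      M = Σᴷ (λ j → ⟪ f j , f j ⟫)

      0<1+M : 0# < 1# + M
      0<1+M = 0<x+y 0<1 (Σ-nonNegative {f = λ j → ⟪ f j , f j ⟫} (λ j → ⟪⟫-nonNeg (f j)))

      -- Chosen so that `2⟪⟫≤` bounds every coordinate of a displacement shorter than `ε` by q/2 in
      -- absolute value; `M` dominates the squared lengths of all the `f j` at once.
      ε = q * (1# + M) ⁻¹

      0<ε : 0# < ε
      0<ε = 0<x*y 0<q (0<x⁻¹ 0<1+M)

      ε[1+M]≈q : ε * (1# + M) ≈ q
      ε[1+M]≈q = trans (*-assoc _ _ _) (trans (*-congˡ (⁻¹-inverseˡ (pos⇒≉0 0<1+M))) (*-identityʳ q))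

      ⟪combination_w,_⟫ : ∀ s z → ⟪ combination s w , z ⟫ ≈ Σᴷ (λ j → s j * ⟪ v j , z ⟫) - Σᴷ s * ⟪ β , z ⟫
      ⟪combination s w, z ⟫ = begin
        ⟪ combination s w , z ⟫
          ≈⟨ ⟪⟫-combination s w z ⟩
        Σᴷ (λ j → s j * ⟪ w j , z ⟫)
          ≈⟨ Σ-cong (suc n) (λ j → trans (*-congˡ (⟨ v j ⟩ ⟨-⟩ refl))
               (solve 3 (λ s x b → s :* (x :- b) := s :* x :+ s :* (:- b)) refl (s j) ⟪ v j , z ⟫ ⟪ β , z ⟫)) ⟩
        Σᴷ (λ j → s j * ⟪ v j , z ⟫ + s j * - ⟪ β , z ⟫)
          ≈⟨ trans (Σ-+ (suc n) (λ j → s j * ⟪ v j , z ⟫) (λ j → s j * - ⟪ β , z ⟫)) (+-congˡ (sym (Σ-*ʳ (suc n) (- ⟪ β , z ⟫) s))) ⟩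
        Σᴷ (λ j → s j * ⟪ v j , z ⟫) + Σᴷ s * - ⟪ β , z ⟫
          ≈⟨ solve 3 (λ a s b → a :+ s :* (:- b) := a :- s :* b) refl _ (Σᴷ s) ⟪ β , z ⟫ ⟩
        Σᴷ (λ j → s j * ⟪ v j , z ⟫) - Σᴷ s * ⟪ β , z ⟫ ∎

      -- Lying in the affine hull gives weights `s` of arbitrary size. The Gram-Schmidt coordinates
      -- `a′` of `y -ᴹ β` represent the same vector but are controlled by its length, and they are
      -- the ones turned back into weights on `v`.
      ball : ∀ y → y ∈ affineHull F → ⟪ y -ᴹ β , y -ᴹ β ⟫ < ε * ε → y ∈ F
      ball y (k , t , p , p∈F , Σt , y≈) (d<ε² , _) = Hull⊆F (coef , coef≥0 , Σcoef , y≈coef)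
        where
        r : Fin k → Fin (suc n) → Carrier
        r i = proj₁ (F⊆Hull (p∈F i))

        s : Fin (suc n) → Carrier
        s j = Σᴷ (λ i → t i * r i j)

        Σs : Σᴷ s ≈ 1#
        Σs = trans (Σ-bind-1 t r) (trans (Σ-cong k (λ i → trans (*-congˡ (proj₁ (proj₂ (proj₂ (F⊆Hull (p∈F i)))))) (*-identityʳ _))) Σt)

        y≈s : y ≈ᴹ combination s v
        y≈s = ≈ᴹ-trans y≈ (≈ᴹ-trans (combination-congʳ t (λ i → proj₂ (proj₂ (proj₂ (F⊆Hull (p∈F i))))))
                (combination-bind t r v))

        y-β≈s : y -ᴹ β ≈ᴹ combination s w
        y-β≈s = ⟪⟫-ext λ z → begin
          ⟪ y -ᴹ β , z ⟫
            ≈⟨ trans (⟪⟫-congˡ y≈s) (⟪⟫-combination s v z) ⟨-⟩ refl ⟩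
          Σᴷ (λ j → s j * ⟪ v j , z ⟫) - ⟪ β , z ⟫
            ≈⟨ +-congˡ (-‿cong (trans (*-congʳ Σs) (*-identityˡ _))) ⟨
          Σᴷ (λ j → s j * ⟪ v j , z ⟫) - Σᴷ s * ⟪ β , z ⟫
            ≈⟨ ⟪combination s w, z ⟫ ⟨
          ⟪ combination s w , z ⟫ ∎

        a′ : Fin (suc n) → Carrier
        a′ j = ⟪ y -ᴹ β , f j ⟫

        y-β≈a : y -ᴹ β ≈ᴹ combination a′ w
        y-β≈a = frame-coordinates {f = f} (proj₂ (frame w)) s y-β≈s

        -- `y` equals (1 - Σ a′) β + Σ a′ j v j, and as `β` is the mean of the `v j`, the first
        -- summand spreads as one weight `b` over all of them.
        b = q * (1# - Σᴷ a′)

        coef : Fin (suc n) → Carrier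
        coef j = b + a′ j

        Σcoef : Σᴷ coef ≈ 1#
        Σcoef = begin
          Σᴷ coef                              ≈⟨ Σ-+ (suc n) (λ _ → b) a′ ⟩
          Σᴷ {suc n} (λ _ → b) + Σᴷ a′         ≈⟨ +-congʳ (Σ-const (suc n) b) ⟩
          N * (q * (1# - Σᴷ a′)) + Σᴷ a′       ≈⟨ solve 3 (λ N q a → N :* (q :* (:1 :- a)) :+ a := N :* q :* (:1 :- a) :+ a) refl N q (Σᴷ a′) ⟩
          N * q * (1# - Σᴷ a′) + Σᴷ a′         ≈⟨ +-congʳ (*-congʳ Nq≈1) ⟩
          1# * (1# - Σᴷ a′) + Σᴷ a′            ≈⟨ solve 1 (λ a → :1 :* (:1 :- a) :+ a := :1) refl (Σᴷ a′) ⟩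
          1#                                   ∎

        y≈coef : y ≈ᴹ combination coef v
        y≈coef = ⟪⟫-ext λ z → let S = Σᴷ (λ j → ⟪ v j , z ⟫) ; A = Σᴷ (λ j → a′ j * ⟪ v j , z ⟫) in begin
          ⟪ y , z ⟫
            ≈⟨ solve 2 (λ y b → y := (y :- b) :+ b) refl ⟪ y , z ⟫ ⟪ β , z ⟫ ⟩
          (⟪ y , z ⟫ - ⟪ β , z ⟫) + ⟪ β , z ⟫
            ≈⟨ +-congʳ (⟨ y ⟩ ⟨-⟩ refl) ⟨
          ⟪ y -ᴹ β , z ⟫ + ⟪ β , z ⟫
            ≈⟨ +-congʳ (trans (⟪⟫-congˡ y-β≈a) ⟪combination a′ w, z ⟫) ⟩
          (A - Σᴷ a′ * ⟪ β , z ⟫) + ⟪ β , z ⟫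
            ≈⟨ solve 3 (λ A a b → (A :- a :* b) :+ b := (:1 :- a) :* b :+ A) refl A (Σᴷ a′) ⟪ β , z ⟫ ⟩
          (1# - Σᴷ a′) * ⟪ β , z ⟫ + A
            ≈⟨ +-congʳ (trans (*-congˡ ⟪β, z ⟫) (solve 3 (λ a q S → a :* (q :* S) := q :* a :* S) refl _ _ S)) ⟩
          b * S + A
            ≈⟨ +-congʳ (Σ-*ˡ (suc n) b (λ j → ⟪ v j , z ⟫)) ⟩
          Σᴷ (λ j → b * ⟪ v j , z ⟫) + A
            ≈⟨ Σ-+ (suc n) (λ j → b * ⟪ v j , z ⟫) (λ j → a′ j * ⟪ v j , z ⟫) ⟨
          Σᴷ (λ j → b * ⟪ v j , z ⟫ + a′ j * ⟪ v j , z ⟫)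
            ≈⟨ Σ-cong (suc n) (λ j → distribʳ ⟪ v j , z ⟫ b (a′ j)) ⟨
          Σᴷ (λ j → coef j * ⟪ v j , z ⟫)
            ≈⟨ ⟪⟫-combination coef v z ⟨
          ⟪ combination coef v , z ⟫ ∎

        f≤M : ∀ j → ⟪ f j , f j ⟫ ≤ M
        f≤M = term≤Σ {f = λ j → ⟪ f j , f j ⟫} (λ j → ⟪⟫-nonNeg (f j))

        2a≤q : ∀ j → (1# + 1#) * a′ j ≤ q
        2a≤q j = ≤-respʳ-≈ ε[1+M]≈q (2⟪⟫≤ 0<ε d<ε² (f≤M j))

        -2a≤q : ∀ j → (1# + 1#) * - a′ j ≤ q
        -2a≤q j = ≤-respʳ-≈ ε[1+M]≈q (≤-respˡ-≈ (*-congˡ (⟨-⟩ refl))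
          (2⟪⟫≤ 0<ε (≤-respˡ-≈ (sym (trans (⟨-⟩ flip (⟨-⟩ refl)) (solve 1 (λ x → :- (:- x) := x) refl _))) d<ε²) (f≤M j)))

        2Σa≤1 : (1# + 1#) * Σᴷ a′ ≤ 1#
        2Σa≤1 = ≤-respˡ-≈ (sym (Σ-*ˡ (suc n) (1# + 1#) a′))
          (≤-respʳ-≈ (trans (Σ-const (suc n) q) Nq≈1) (Σ-mono-≤ {g = λ _ → q} 2a≤q))

        -- Each `a′ j` is at least -q/2, and `b` is at least q/2 because Σ a′ is at most 1/2.
        coef≥0 : ∀ j → 0# ≤ coef j
        coef≥0 j = *-cancelˡ-0≤ 0<2 (0≤-resp
          (solve 3 (λ q s a → q :* (:1 :- (:1 :+ :1) :* s) :+ (q :- (:1 :+ :1) :* (:- a))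
                      := (:1 :+ :1) :* (q :* (:1 :- s) :+ a)) refl q (Σᴷ a′) (a′ j))
          (0≤x+y (*-nonNegative (proj₁ 0<q) (≤⇒0≤- 2Σa≤1)) (≤⇒0≤- (-2a≤q j))))

    average∈relativeInterior : β ∈ relativeInterior F
    average∈relativeInterior =
      Hull⊆F ((λ _ → q) , (λ _ → proj₁ 0<q) , trans (Σ-const (suc n) q) Nq≈1 ,
        ⟪⟫-ext λ z → trans ⟪β, z ⟫ (trans (Σ-*ˡ (suc n) q (λ j → ⟪ v j , z ⟫)) (sym (⟪⟫-combination (λ _ → q) v z)))) ,
      ε , 0<ε , ball

  -- A relatively interior point x can be moved slightly beyond x, away from y.
  relativeInterior-zero : ∀ {b} {F : Pred Carrierᴹ b} {x a} → x ∈ relativeInterior F → ⟪ x , a ⟫ ≤ 0# →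
                          (∀ {y} → y ∈ F → 0# ≤ ⟪ y , a ⟫) → ∀ {y} → y ∈ F → ⟪ y , a ⟫ ≈ 0#
  relativeInterior-zero {F = F} {x} {a} (x∈F , ε , 0<ε , ball) xa≤0 F≥0 {y} y∈F =
    antisym (0≤-⇒≤0 (*-cancelˡ-0≤ 0<η (0≤-resp
      (solve 3 (λ η X Y → ((X :+ η :* (X :- Y)) :+ (:1 :+ η) :* (:- X)) := η :* (:- Y)) refl η ⟪ x , a ⟫ ⟪ y , a ⟫)
      (0≤x+y (0≤-resp ⟪z,a⟫ (F≥0 z∈F)) (*-nonNegative (0≤x+y 0≤1 (proj₁ 0<η)) (≤0⇒0≤- xa≤0))))))
      (F≥0 y∈F)
    where
    d = x -ᴹ y
    D = ⟪ d , d ⟫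
    0<1+D = 0<x+y 0<1 (⟪⟫-nonNeg d)
    -- The squared displacement is η² D, while ε² = η² (1 + D)² is strictly larger. Dividing by 1 +
    -- D avoids both a square root and the case D = 0.
    η = ε * (1# + D) ⁻¹
    0<η = 0<x*y 0<ε (0<x⁻¹ 0<1+D)
    z = x +ᴹ η *ₗ d

    ⟪z,a⟫ : ⟪ z , a ⟫ ≈ ⟪ x , a ⟫ + η * (⟪ x , a ⟫ - ⟪ y , a ⟫)
    ⟪z,a⟫ = ⟨ x ⟩ ⟨+⟩ η ⟨*⟩ (⟨ x ⟩ ⟨-⟩ ⟨ y ⟩)

    ε≈ : ε ≈ η * (1# + D)
    ε≈ = sym (trans (*-assoc _ _ _) (trans (*-congˡ (⁻¹-inverseˡ (pos⇒≉0 0<1+D))) (*-identityʳ ε)))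

    z-x≈ : z -ᴹ x ≈ᴹ η *ₗ d
    z-x≈ = ⟪⟫-ext λ u → trans ((⟨ x ⟩ ⟨+⟩ ⟨ η *ₗ d ⟩) ⟨-⟩ ⟨ x ⟩) (solve 2 (λ x e → (x :+ e) :- x := e) refl _ _)

    gap : ε * ε ≈ η * η * D + η * η * (1# + D + D * D)
    gap = trans (*-cong ε≈ ε≈) (solve 2 (λ η D → (η :* (:1 :+ D)) :* (η :* (:1 :+ D)) :=
            η :* η :* D :+ η :* η :* (:1 :+ D :+ D :* D)) refl η D)

    0<gap : 0# < η * η * (1# + D + D * D)
    0<gap = 0<x*y (0<x*y 0<η 0<η) (0<x+y 0<1+D (0≤x² D))

    close : ⟪ z -ᴹ x , z -ᴹ x ⟫ < ε * ε
    close = <-respˡ (sym (trans (⟪⟫-cong z-x≈ z-x≈) (trans (η ⟨*⟩ flip (η ⟨*⟩ refl)) (sym (*-assoc _ _ _)))))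
      (<-respʳ (sym gap)
        ((0≤-⇒≤ (0≤-resp (solve 2 (λ x y → x := (y :+ x) :- y) refl _ _) (proj₁ 0<gap))) ,
         λ e → proj₂ 0<gap (begin
           0#                    ≈⟨ -‿inverseʳ _ ⟨
           η * η * D - η * η * D ≈⟨ +-congʳ e ⟩
           (η * η * D + η * η * (1# + D + D * D)) - η * η * D ≈⟨ solve 2 (λ x y → (y :+ x) :- y := x) refl _ _ ⟩
           η * η * (1# + D + D * D) ∎)))

    points : Fin 2 → Carrierᴹ
    points zero    = x
    points (suc _) = y

    weights : Fin 2 → Carrier
    weights zero    = 1# + η
    weights (suc _) = - η

    points∈F : ∀ i → points i ∈ F
    points∈F zero    = x∈F
    points∈F (suc _) = y∈F

    z∈F : z ∈ F
    z∈F = ball z (2 , weights , points , points∈F ,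
      solve 1 (λ η → (:1 :+ η) :+ (:- η :+ :0) := :1) refl η ,
      ⟪⟫-ext λ u → trans (⟨ x ⟩ ⟨+⟩ η ⟨*⟩ (⟨ x ⟩ ⟨-⟩ ⟨ y ⟩)) (trans
        (solve 3 (λ η X Y → X :+ η :* (X :- Y) := (:1 :+ η) :* X :+ ((:- η) :* Y :+ :0)) refl η ⟪ x , u ⟫ ⟪ y , u ⟫)
        (sym (⟪⟫-combination weights points u)))) close

-- Orthogonal maps and reflections

module Reflection {c ℓ₁ ℓ₂ m ℓm} {ℝ : RealField c ℓ₁ ℓ₂} (𝔼 : InnerProductSpace ℝ m ℓm) where
  open OrderedField ℝ
  open InnerProduct 𝔼

  open RealField ℝ hiding (zero)
  open InnerProductSpace 𝔼
  open Geometry 𝔼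
  open import Relation.Binary.Reasoning.Setoid setoid

  -- Linearity and congruence follow from the existence of an adjoint.
  record IsOrthogonal (w w⁻¹ : Carrierᴹ → Carrierᴹ) : Set (m ⊔ ℓm ⊔ ℓ₁) where
    field
      adjoint  : ∀ x y → ⟪ w x , y ⟫ ≈ ⟪ x , w⁻¹ y ⟫
      inverseˡ : ∀ x → w⁻¹ (w x) ≈ᴹ x
      inverseʳ : ∀ x → w (w⁻¹ x) ≈ᴹ x

    map-cong : ∀ {x y} → x ≈ᴹ y → w x ≈ᴹ w y
    map-cong e = ⟪⟫-ext λ z → trans (adjoint _ z) (trans (⟪⟫-congˡ e) (sym (adjoint _ z)))

    isometry : ∀ x y → ⟪ w x , w y ⟫ ≈ ⟪ x , y ⟫
    isometry x y = trans (adjoint x (w y)) (⟪⟫-congʳ (inverseˡ y))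

    map-combination : ∀ {n} (t : Fin n → Carrier) v → w (combination t v) ≈ᴹ combination t (w ∘ v)
    map-combination {n} t v = ⟪⟫-ext λ z → trans (adjoint _ z) (trans (⟪⟫-combination t v _)
      (trans (Σ-cong n (λ i → *-congˡ (sym (adjoint (v i) z)))) (sym (⟪⟫-combination t (w ∘ v) z))))

    map-sub : ∀ x y → w (x -ᴹ y) ≈ᴹ w x -ᴹ w y
    map-sub x y = ⟪⟫-ext λ z → trans (adjoint _ z) (trans (sym (adjoint x z) ⟨-⟩ sym (adjoint y z))
      (sym (⟨ w x ⟩ ⟨-⟩ ⟨ w y ⟩)))

    map-neg : ∀ x → w (-ᴹ x) ≈ᴹ -ᴹ w x
    map-neg x = ⟪⟫-ext λ z → trans (adjoint _ z) (trans (⟨-⟩ sym (adjoint x z)) (sym (⟨-⟩ refl)))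

    map-scale : ∀ a x → w (a *ₗ x) ≈ᴹ a *ₗ w x
    map-scale a x = ⟪⟫-ext λ z → trans (adjoint _ z) (trans (a ⟨*⟩ sym (adjoint x z)) (sym (a ⟨*⟩ refl)))

  open IsOrthogonal

  id-orthogonal : IsOrthogonal id id
  id-orthogonal = record
    { adjoint = λ _ _ → refl ; inverseˡ = λ _ → ≈ᴹ-refl ; inverseʳ = λ _ → ≈ᴹ-refl }

  ∘-orthogonal : ∀ {w w⁻¹ u u⁻¹} → IsOrthogonal w w⁻¹ → IsOrthogonal u u⁻¹ → IsOrthogonal (w ∘ u) (u⁻¹ ∘ w⁻¹)
  ∘-orthogonal {w} {w⁻¹} {u} {u⁻¹} W U = record
    { adjoint  = λ x y → trans (adjoint W (u x) y) (adjoint U x (w⁻¹ y))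
    ; inverseˡ = λ x → ≈ᴹ-trans (U⁻¹-cong (inverseˡ W (u x))) (inverseˡ U x)
    ; inverseʳ = λ x → ≈ᴹ-trans (map-cong W (inverseʳ U (w⁻¹ x))) (inverseʳ W x)
    }
    where
    U⁻¹-cong : ∀ {x y} → x ≈ᴹ y → u⁻¹ x ≈ᴹ u⁻¹ y
    U⁻¹-cong e = ⟪⟫-ext λ z → trans (⟪⟫-sym _ z) (trans (sym (adjoint U z _))
      (trans (⟪⟫-congʳ e) (trans (adjoint U z _) (⟪⟫-sym z _))))

  inverse-orthogonal : ∀ {w w⁻¹} → IsOrthogonal w w⁻¹ → IsOrthogonal w⁻¹ w
  inverse-orthogonal W = record
    { adjoint  = λ x y → trans (⟪⟫-sym _ y) (trans (sym (adjoint W y x)) (⟪⟫-sym _ x))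
    ; inverseˡ = inverseʳ W
    ; inverseʳ = inverseˡ W
    }

  cartan-cong : ∀ {x y α β} → ⟪ x , α ⟫ ≈ ⟪ y , β ⟫ → ⟪ α , α ⟫ ≈ ⟪ β , β ⟫ → cartan x α ≈ cartan y β
  cartan-cong p q = *-cong (*-congˡ p) (⁻¹-cong q)

  ⟪reflection⟫ : ∀ α x z → ⟪ reflection α x , z ⟫ ≈ ⟪ x , z ⟫ - cartan x α * ⟪ α , z ⟫
  ⟪reflection⟫ α x z = ⟨ x ⟩ ⟨-⟩ _ ⟨*⟩ ⟨ α ⟩

  reflection-congˡ : ∀ {α β} → α ≈ᴹ β → ∀ x → reflection α x ≈ᴹ reflection β x
  reflection-congˡ {α} {β} e x = ⟪⟫-ext λ z → trans (⟪reflection⟫ α x z) (trans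
    (+-congˡ (-‿cong (*-cong (cartan-cong {x} {x} {α} {β} (⟪⟫-congʳ e) (⟪⟫-cong e e)) (⟪⟫-congˡ e)))) (sym (⟪reflection⟫ β x z)))

  reflection-neg : ∀ α x → reflection (-ᴹ α) x ≈ᴹ reflection α x
  reflection-neg α x = ⟪⟫-ext λ z → begin
    ⟪ reflection (-ᴹ α) x , z ⟫
      ≈⟨ ⟪reflection⟫ (-ᴹ α) x z ⟩
    ⟪ x , z ⟫ - (1# + 1#) * ⟪ x , -ᴹ α ⟫ * ⟪ -ᴹ α , -ᴹ α ⟫ ⁻¹ * ⟪ -ᴹ α , z ⟫
      ≈⟨ +-congˡ (-‿cong (*-cong (*-cong (*-congˡ (flip (⟨-⟩ ⟪⟫-sym α x)))
           (⁻¹-cong (trans (⟨-⟩ flip (⟨-⟩ refl)) (solve 1 (λ x → :- (:- x) := x) refl _)))) (⟨-⟩ refl))) ⟩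
    ⟪ x , z ⟫ - (1# + 1#) * - ⟪ x , α ⟫ * ⟪ α , α ⟫ ⁻¹ * - ⟪ α , z ⟫
      ≈⟨ solve 4 (λ x a q b → x :- (:1 :+ :1) :* (:- a) :* q :* (:- b) := x :- (:1 :+ :1) :* a :* q :* b) refl _ _ _ _ ⟩
    ⟪ x , z ⟫ - cartan x α * ⟪ α , z ⟫
      ≈⟨ ⟪reflection⟫ α x z ⟨
    ⟪ reflection α x , z ⟫ ∎

  reflection-fixes : ∀ {α x} → ⟪ x , α ⟫ ≈ 0# → reflection α x ≈ᴹ x
  reflection-fixes {α} {x} e = ⟪⟫-ext λ z → trans (⟪reflection⟫ α x z) (trans
    (+-congˡ (-‿cong (*-congʳ (*-congʳ (*-congˡ e)))))
    (solve 3 (λ x q a → x :- (:1 :+ :1) :* :0 :* q :* a := x) refl _ _ _))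

  reflection-adjoint : ∀ α x y → ⟪ reflection α x , y ⟫ ≈ ⟪ x , reflection α y ⟫
  reflection-adjoint α x y = trans (⟪reflection⟫ α x y) (trans
    (trans (+-congˡ (-‿cong (*-congˡ (⟪⟫-sym α y))))
      (solve 4 (λ x a q b → x :- (:1 :+ :1) :* a :* q :* b := x :- (:1 :+ :1) :* b :* q :* a) refl _ _ _ _))
    (sym (flip (⟪⟫-sym y x ⟨-⟩ _ ⟨*⟩ ⟪⟫-sym α x))))

  module _ {α} (α≉0 : ¬ (α ≈ᴹ 0ᴹ)) where
    private
      A⁻¹A≈1 : ⟪ α , α ⟫ ⁻¹ * ⟪ α , α ⟫ ≈ 1#
      A⁻¹A≈1 = ⁻¹-inverseˡ (α≉0 ∘ ⟪⟫-definite)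

    cartan*A : ∀ x → cartan x α * ⟪ α , α ⟫ ≈ (1# + 1#) * ⟪ x , α ⟫
    cartan*A x = trans (*-assoc _ _ _) (trans (*-congˡ A⁻¹A≈1) (*-identityʳ _))

    cartan-self : cartan α α ≈ 1# + 1#
    cartan-self = trans (*-assoc _ _ _) (trans (*-congˡ (trans (*-comm _ _) A⁻¹A≈1)) (*-identityʳ _))

    cartan-reflection : ∀ x → cartan (reflection α x) α ≈ - cartan x α
    cartan-reflection x = begin
      (1# + 1#) * ⟪ reflection α x , α ⟫ * ⟪ α , α ⟫ ⁻¹
        ≈⟨ *-congʳ (*-congˡ (trans (⟪reflection⟫ α x α) (+-congˡ (-‿cong (cartan*A x))))) ⟩
      (1# + 1#) * (⟪ x , α ⟫ - (1# + 1#) * ⟪ x , α ⟫) * ⟪ α , α ⟫ ⁻¹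
        ≈⟨ solve 2 (λ x q → (:1 :+ :1) :* (x :- (:1 :+ :1) :* x) :* q := :- ((:1 :+ :1) :* x :* q)) refl ⟪ x , α ⟫ (⟪ α , α ⟫ ⁻¹) ⟩
      - cartan x α ∎

    reflection-involutive : ∀ x → reflection α (reflection α x) ≈ᴹ x
    reflection-involutive x = ⟪⟫-ext λ z → begin
      ⟪ reflection α (reflection α x) , z ⟫
        ≈⟨ ⟪reflection⟫ α (reflection α x) z ⟩
      ⟪ reflection α x , z ⟫ - cartan (reflection α x) α * ⟪ α , z ⟫
        ≈⟨ +-cong (⟪reflection⟫ α x z) (-‿cong (*-congʳ (cartan-reflection x))) ⟩
      (⟪ x , z ⟫ - cartan x α * ⟪ α , z ⟫) - - cartan x α * ⟪ α , z ⟫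
        ≈⟨ solve 3 (λ x k a → (x :- k :* a) :- (:- k) :* a := x) refl ⟪ x , z ⟫ (cartan x α) ⟪ α , z ⟫ ⟩
      ⟪ x , z ⟫ ∎

    reflection-orthogonal : IsOrthogonal (reflection α) (reflection α)
    reflection-orthogonal = record
      { adjoint  = reflection-adjoint α
      ; inverseˡ = reflection-involutive
      ; inverseʳ = reflection-involutive
      }

    reflection-self : reflection α α ≈ᴹ -ᴹ α
    reflection-self = ⟪⟫-ext λ z → trans (⟪reflection⟫ α α z) (trans (+-congˡ (-‿cong (*-congʳ cartan-self)))
      (trans (solve 1 (λ a → a :- (:1 :+ :1) :* a := :- a) refl ⟪ α , z ⟫) (sym (⟨-⟩ refl))))

    0<cartan : ∀ {x} → 0# < ⟪ x , α ⟫ → 0# < cartan x α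
    0<cartan p = 0<x*y (0<x*y 0<2 p) (0<x⁻¹ (0<⟪x,x⟫ α≉0))

  reflection-conjugate : ∀ {w w⁻¹} → IsOrthogonal w w⁻¹ → ∀ α x →
                         w (reflection α x) ≈ᴹ reflection (w α) (w x)
  reflection-conjugate {w} W α x = ⟪⟫-ext λ z → begin
    ⟪ w (reflection α x) , z ⟫
      ≈⟨ ⟪⟫-congˡ (map-sub W x _) ⟩
    ⟪ w x -ᴹ w (cartan x α *ₗ α) , z ⟫
      ≈⟨ ⟨ w x ⟩ ⟨-⟩ trans (⟪⟫-congˡ (map-scale W _ α)) (⟪⟫-*ˡ _ _ _) ⟩
    ⟪ w x , z ⟫ - cartan x α * ⟪ w α , z ⟫
      ≈⟨ +-congˡ (-‿cong (*-congʳ (cartan-cong {w x} {x} {w α} {α} (isometry W x α) (isometry W α α)))) ⟨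
    ⟪ w x , z ⟫ - cartan (w x) (w α) * ⟪ w α , z ⟫
      ≈⟨ ⟪reflection⟫ (w α) (w x) z ⟨
    ⟪ reflection (w α) (w x) , z ⟫ ∎

-- The Weyl group: simple reflections, words, exchange and dominance

module WeylGroup {c ℓ₁ ℓ₂ m ℓm} {ℝ : RealField c ℓ₁ ℓ₂} (𝔼 : InnerProductSpace ℝ m ℓm)
  {N r : ℕ} (Φ : Fin N → InnerProductSpace.Carrierᴹ 𝔼) (Π : Fin r → InnerProductSpace.Carrierᴹ 𝔼)
  (isRootSystem : Geometry.IsRootSystem 𝔼 Φ) (isSimpleSystem : Geometry.IsSimpleSystem 𝔼 Φ Π) where
  open OrderedField ℝ
  open InnerProduct 𝔼
  open Reflection 𝔼

  open RealField ℝ hiding (zero)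
  open InnerProductSpace 𝔼
  open Geometry 𝔼
  open IsOrthogonal
  open IsRootSystem isRootSystem
  open IsSimpleSystem isSimpleSystem
  open import Relation.Binary.Reasoning.Setoid setoid

  -- A strict order on a finite type is well-founded, even when the keys are real. The keys will be
  -- heights and negated squared lengths of roots.
  key-wellFounded : ∀ {n} (f : Fin n → Carrier) → WellFounded (λ i j → f i < f j)
  key-wellFounded f = spo-wellFounded (record
    { isEquivalence = ≡.isEquivalence
    ; irrefl        = λ { ≡.refl p → proj₂ p refl }
    ; trans         = <-trans
    ; <-resp-≈      = (λ { ≡.refl p → p }) , (λ { ≡.refl p → p })
    })

  Range-resp : ∀ {n} {v : Fin n → Carrierᴹ} {x y} → x ≈ᴹ y → x ∈ Range v → y ∈ Range v
  Range-resp e (i , p) = i , ≈ᴹ-trans (≈ᴹ-sym e) p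

  -- Injectivity carries `s ∘ s = id` over to the indices, so the induced index map is its own
  -- inverse.
  family-permutation : ∀ {n} (v : Fin n → Carrierᴹ) → Injective _≡_ _≈ᴹ_ v →
                       ∀ {s} → IsOrthogonal s s → (∀ i → s (v i) ∈ Range v) →
                       ∃[ π ] ∀ i → s (v i) ≈ᴹ v (π ⟨$⟩ʳ i)
  family-permutation v inj S h =
    permutation σ σ involutive involutive , λ i → proj₂ (h i)
    where
    σ = proj₁ ∘ h
    involutive : ∀ i → σ (σ i) ≡ i
    involutive i = inj (≈ᴹ-trans (≈ᴹ-sym (proj₂ (h (σ i))))
      (≈ᴹ-trans (map-cong S (≈ᴹ-sym (proj₂ (h i)))) (inverseˡ S (v i))))

  -- `Φ` may list a root several times, but counting roots up to a permutation requires an injective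
  -- listing.
  without-repetition : ∀ {n} (v : Fin n → Carrierᴹ) → ∃[ k ] ∃[ u ]
    Injective {A = Fin k} _≡_ _≈ᴹ_ u × (∀ i → v i ∈ Range u) × (∀ i → u i ∈ Range v)
  without-repetition {zero}  v = 0 , (λ ()) , (λ {}) , (λ ()) , (λ ())
  without-repetition {suc n} v with without-repetition (v ∘ suc)
  ... | k , u , inj , v⊆u , u⊆v with any? (λ i → v zero ≟ᴹ u i)
  ...   | yes p = k , u , inj , (λ { zero → p ; (suc i) → v⊆u i }) , λ i → suc (proj₁ (u⊆v i)) , proj₂ (u⊆v i)
  ...   | no p  = suc k , u′ , inj′ ,
                  (λ { zero → zero , ≈ᴹ-refl ; (suc i) → suc (proj₁ (v⊆u i)) , proj₂ (v⊆u i) }) ,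
                  (λ { zero → zero , ≈ᴹ-refl ; (suc i) → suc (proj₁ (u⊆v i)) , proj₂ (u⊆v i) })
    where
    u′ : Fin (suc k) → Carrierᴹ
    u′ zero    = v zero
    u′ (suc i) = u i

    inj′ : Injective _≡_ _≈ᴹ_ u′
    inj′ {zero}  {zero}  e = ≡.refl
    inj′ {zero}  {suc j} e = ⊥-elim (p (j , e))
    inj′ {suc i} {zero}  e = ⊥-elim (p (i , ≈ᴹ-sym e))
    inj′ {suc i} {suc j} e = ≡.cong suc (inj e)

  -- Roots and simple reflections

  Root : Pred Carrierᴹ ℓm
  Root = Range Φ

  root≉0 : ∀ {x} → x ∈ Root → ¬ (x ≈ᴹ 0ᴹ)
  root≉0 (i , p) e = nonzero i (≈ᴹ-trans (≈ᴹ-sym p) e)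

  Π≉0 : ∀ i → ¬ (Π i ≈ᴹ 0ᴹ)
  Π≉0 i = root≉0 (simpleRoots i)

  reflection-Root : ∀ {α x} → α ∈ Root → x ∈ Root → reflection α x ∈ Root
  reflection-Root {α} {x} α∈@(i , p) (j , q) = Range-resp
    (≈ᴹ-sym (≈ᴹ-trans (reflection-congˡ p x) (map-cong (reflection-orthogonal (nonzero i)) q)))
    (reflectionClosed i j)

  neg-Root : ∀ {x} → x ∈ Root → -ᴹ x ∈ Root
  neg-Root x∈ = Range-resp (reflection-self (root≉0 x∈)) (reflection-Root x∈ x∈)

  s : Fin r → Carrierᴹ → Carrierᴹ
  s i = reflection (Π i)

  s-orthogonal : ∀ i → IsOrthogonal (s i) (s i)
  s-orthogonal i = reflection-orthogonal (Π≉0 i)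

  act : List (Fin r) → Carrierᴹ → Carrierᴹ
  act []      = id
  act (i ∷ l) = s i ∘ act l

  act-++ : ∀ l l′ x → act (l ++ l′) x ≡ act l (act l′ x)
  act-++ []      l′ x = ≡.refl
  act-++ (i ∷ l) l′ x = ≡.cong (s i) (act-++ l l′ x)

  act-∷ʳ : ∀ l i x → act (l ∷ʳ i) x ≡ act l (s i x)
  act-∷ʳ l i = act-++ l (i ∷ [])

  act-reverse : ∀ i l x → act (reverse (i ∷ l)) x ≡ act (reverse l) (s i x)
  act-reverse i l x = ≡.trans (≡.cong (λ k → act k x) (unfold-reverse i l)) (act-∷ʳ (reverse l) i x)

  act-orthogonal : ∀ l → IsOrthogonal (act l) (act (reverse l))
  act-orthogonal []      = id-orthogonal
  act-orthogonal (i ∷ l) = record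
    { adjoint  = λ x y → ≡.subst (λ z → ⟪ s i (act l x) , y ⟫ ≈ ⟪ x , z ⟫) (≡.sym (act-reverse i l y)) (adjoint W x y)
    ; inverseˡ = λ x → ≡.subst (_≈ᴹ x) (≡.sym (act-reverse i l _)) (inverseˡ W x)
    ; inverseʳ = λ x → ≡.subst (λ z → s i (act l z) ≈ᴹ x) (≡.sym (act-reverse i l x)) (inverseʳ W x)
    }
    where W = ∘-orthogonal (s-orthogonal i) (act-orthogonal l)

  act-Root : ∀ l {x} → x ∈ Root → act l x ∈ Root
  act-Root []      p = p
  act-Root (i ∷ l) p = reflection-Root (simpleRoots i) (act-Root l p)

  -- Positive roots, through the dual basis ω of Π

  -- The Gram-Schmidt construction is sealed: all that follows about `ω` derives from `ω-frame`.
  abstract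
    ω : Fin r → Carrierᴹ
    ω = proj₁ (frame Π)

    ω-frame : IsFrame Π ω
    ω-frame = proj₂ (frame Π)

  coordinates : ∀ x → x ≈ᴹ combination (λ j → ⟪ x , ω j ⟫) Π
  coordinates x = frame-coordinates {f = ω} ω-frame (λ j → Σᴷ (λ i → proj₁ (spanning x) i * t i j)) (≈ᴹ-trans (proj₂ (spanning x))
    (≈ᴹ-trans (combination-congʳ (proj₁ (spanning x)) (λ i → proj₁ (proj₂ (sameSign i)))) (combination-bind (proj₁ (spanning x)) t Π)))
    where
    t : Fin N → Fin r → Carrier
    t i = proj₁ (sameSign i)

  δ-sym : ∀ {n} (i j : Fin n) → δ i j ≡ δ j i
  δ-sym zero    zero    = ≡.refl
  δ-sym zero    (suc j) = ≡.refl
  δ-sym (suc i) zero    = ≡.refl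
  δ-sym (suc i) (suc j) = δ-sym i j

  -- The frame coordinates of `Π i` and the trivial ones `δ i` express the same vector in `Π`, so
  -- linear independence identifies them.
  ⟪Π,ω⟫ : ∀ i j → ⟪ Π i , ω j ⟫ ≈ δ i j
  ⟪Π,ω⟫ i j = begin
    ⟪ Π i , ω j ⟫                       ≈⟨ solve 2 (λ a b → a := (a :- b) :+ b) refl ⟪ Π i , ω j ⟫ (δ i j) ⟩
    (⟪ Π i , ω j ⟫ - δ i j) + δ i j     ≈⟨ +-congʳ (independent (λ k → ⟪ Π i , ω k ⟫ - δ i k) (⟪⟫-ext difference) j) ⟩
    0# + δ i j                          ≈⟨ +-identityˡ _ ⟩
    δ i j                               ∎
    where
    difference : ∀ z → ⟪ combination (λ k → ⟪ Π i , ω k ⟫ - δ i k) Π , z ⟫ ≈ ⟪ 0ᴹ , z ⟫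
    difference z = begin
      ⟪ combination (λ k → ⟪ Π i , ω k ⟫ - δ i k) Π , z ⟫
        ≈⟨ ⟪⟫-combination _ Π z ⟩
      Σᴷ (λ k → (⟪ Π i , ω k ⟫ - δ i k) * ⟪ Π k , z ⟫)
        ≈⟨ Σ-cong r (λ k → solve 3 (λ a b c → (a :- b) :* c := a :* c :+ (:- :1) :* (b :* c)) refl ⟪ Π i , ω k ⟫ (δ i k) ⟪ Π k , z ⟫) ⟩
      Σᴷ (λ k → ⟪ Π i , ω k ⟫ * ⟪ Π k , z ⟫ + - 1# * (δ i k * ⟪ Π k , z ⟫))
        ≈⟨ Σ-+ r (λ k → ⟪ Π i , ω k ⟫ * ⟪ Π k , z ⟫) (λ k → - 1# * (δ i k * ⟪ Π k , z ⟫)) ⟩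
      Σᴷ (λ k → ⟪ Π i , ω k ⟫ * ⟪ Π k , z ⟫) + Σᴷ (λ k → - 1# * (δ i k * ⟪ Π k , z ⟫))
        ≈⟨ +-cong (sym (trans (⟪⟫-congˡ (coordinates (Π i))) (⟪⟫-combination _ Π z)))
                  (trans (sym (Σ-*ˡ r (- 1#) (λ k → δ i k * ⟪ Π k , z ⟫))) (*-congˡ (Σ-δ i (λ k → ⟪ Π k , z ⟫)))) ⟩
      ⟪ Π i , z ⟫ + - 1# * ⟪ Π i , z ⟫
        ≈⟨ solve 1 (λ a → a :+ (:- :1) :* a := :0) refl ⟪ Π i , z ⟫ ⟩
      0#
        ≈⟨ ⟪⟫-0ˡ z ⟨
      ⟪ 0ᴹ , z ⟫ ∎

  δ-diag : ∀ {n} (i : Fin n) → δ i i ≡ 1#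
  δ-diag zero    = ≡.refl
  δ-diag (suc i) = δ-diag i

  δ-off : ∀ {n} {i j : Fin n} → ¬ (j ≡ i) → δ i j ≡ 0#
  δ-off {i = zero}  {zero}  p = ⊥-elim (p ≡.refl)
  δ-off {i = zero}  {suc j} p = ≡.refl
  δ-off {i = suc i} {zero}  p = ≡.refl
  δ-off {i = suc i} {suc j} p = δ-off (p ∘ ≡.cong suc)

  ⟪combination,ω⟫ : ∀ t j → ⟪ combination t Π , ω j ⟫ ≈ t j
  ⟪combination,ω⟫ t j = trans (⟪⟫-combination t Π (ω j)) (trans
    (Σ-cong r (λ k → trans (*-comm _ _) (*-congʳ (trans (⟪Π,ω⟫ k j) (reflexive (δ-sym k j))))))
    (Σ-δ j t))

  coordinates-ext : ∀ {x y} → (∀ j → ⟪ x , ω j ⟫ ≈ ⟪ y , ω j ⟫) → x ≈ᴹ y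
  coordinates-ext {x} {y} p = ≈ᴹ-trans (coordinates x)
    (≈ᴹ-trans (sumᴹ-cong r (λ j → *ₗ-congʳ (p j))) (≈ᴹ-sym (coordinates y)))

  NonNegative NonPositive : Pred Carrierᴹ ℓ₂
  NonNegative x = ∀ j → 0# ≤ ⟪ x , ω j ⟫
  NonPositive x = ∀ j → ⟪ x , ω j ⟫ ≤ 0#

  NonNegative-resp : ∀ {x y} → x ≈ᴹ y → NonNegative x → NonNegative y
  NonNegative-resp e p j = 0≤-resp (⟪⟫-congˡ e) (p j)

  NonPositive-resp : ∀ {x y} → x ≈ᴹ y → NonPositive x → NonPositive y
  NonPositive-resp e p j = ≤-respˡ-≈ (⟪⟫-congˡ e) (p j)

  neg-NonPositive : ∀ {x} → NonPositive x → NonNegative (-ᴹ x)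
  neg-NonPositive p j = 0≤-resp (sym (⟨-⟩ refl)) (≤0⇒0≤- (p j))

  neg-NonNegative : ∀ {x} → NonNegative x → NonPositive (-ᴹ x)
  neg-NonNegative p j = 0≤-⇒≤0 (0≤-resp (trans (solve 1 (λ x → x := :- (:- x)) refl _) (sym (-‿cong (⟨-⟩ refl)))) (p j))

  Π-NonNegative : ∀ i → NonNegative (Π i)
  Π-NonNegative i j = 0≤-resp (sym (⟪Π,ω⟫ i j)) (δ-nonNegative i j)

  root-sign : ∀ {x} → x ∈ Root → NonNegative x ⊎ NonPositive x
  root-sign (k , e) with sameSign k
  ... | t , e′ , inj₁ p = inj₁ λ j → 0≤-resp (sym (trans (⟪⟫-congˡ (≈ᴹ-trans e e′)) (⟪combination,ω⟫ t j))) (p j)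
  ... | t , e′ , inj₂ p = inj₂ λ j → ≤-respˡ-≈ (sym (trans (⟪⟫-congˡ (≈ᴹ-trans e e′)) (⟪combination,ω⟫ t j))) (p j)

  one-sign : ∀ {x} → x ∈ Root → NonNegative x → ¬ NonPositive x
  one-sign x∈ p q = root≉0 x∈ (coordinates-ext (λ j → trans (antisym (q j) (p j)) (sym (⟪⟫-0ˡ (ω j)))))

  ⟪s,ω⟫ : ∀ i {j} x → ¬ (j ≡ i) → ⟪ s i x , ω j ⟫ ≈ ⟪ x , ω j ⟫
  ⟪s,ω⟫ i {j} x j≢i = trans (⟪reflection⟫ (Π i) x (ω j)) (trans
    (+-congˡ (-‿cong (*-congˡ (trans (⟪Π,ω⟫ i j) (reflexive (δ-off j≢i))))))
    (solve 2 (λ x c → x :- c :* :0 := x) refl _ _))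

  -- All coordinates off `i` vanish, so `x` is a multiple of `Π i`; reducedness leaves the factors 1
  -- and -1, and positivity excludes -1.
  simple-multiple : ∀ i {x} → x ∈ Root → NonNegative x → (∀ j → j ≡ i ⊎ ⟪ x , ω j ⟫ ≈ 0#) → x ≈ᴹ Π i
  simple-multiple i {x} x∈ x≥0 q = proportional (reduced k a (Range-resp x≈aΦ x∈))
    where
    a = ⟪ x , ω i ⟫
    k = proj₁ (simpleRoots i)

    diagonal : ⟪ x , ω i ⟫ ≈ ⟪ a *ₗ Π i , ω i ⟫
    diagonal = sym (trans (a ⟨*⟩ trans (⟪Π,ω⟫ i i) (reflexive (δ-diag i))) (*-identityʳ a))

    off-diagonal : ∀ j → ⟪ x , ω j ⟫ ≈ 0# → Dec (j ≡ i) → ⟪ x , ω j ⟫ ≈ ⟪ a *ₗ Π i , ω j ⟫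
    off-diagonal j e (yes ≡.refl) = diagonal
    off-diagonal j e (no j≢i)     = trans e (sym (trans (a ⟨*⟩ trans (⟪Π,ω⟫ i j) (reflexive (δ-off j≢i))) (zeroʳ a)))

    coordinate : ∀ j → j ≡ i ⊎ ⟪ x , ω j ⟫ ≈ 0# → ⟪ x , ω j ⟫ ≈ ⟪ a *ₗ Π i , ω j ⟫
    coordinate j (inj₁ ≡.refl) = diagonal
    coordinate j (inj₂ e)      = off-diagonal j e (j ≟ꟳ i)

    x≈aα : x ≈ᴹ a *ₗ Π i
    x≈aα = coordinates-ext (λ j → coordinate j (q j))

    x≈aΦ : x ≈ᴹ a *ₗ Φ k
    x≈aΦ = ≈ᴹ-trans x≈aα (*ₗ-congˡ (proj₂ (simpleRoots i)))

    proportional : a ≈ 1# ⊎ a ≈ - 1# → x ≈ᴹ Π i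
    proportional (inj₁ e) = ≈ᴹ-trans x≈aα (≈ᴹ-trans (*ₗ-congʳ e) (*ₗ-identityˡ (Π i)))
    proportional (inj₂ e) = ⊥-elim (<⇒≱ 0<1 (0≤-⇒≤0 (0≤-resp e (x≥0 i))))

  -- `s i` changes the `i`-th coordinate only. A positive root other than `Π i` has another positive
  -- coordinate, which survives, and a root has all its coordinates of one sign.
  s-NonNegative : ∀ i {x} → x ∈ Root → NonNegative x → ¬ (x ≈ᴹ Π i) → NonNegative (s i x)
  s-NonNegative i {x} x∈ x≥0 x≉α = conclude (root-sign (reflection-Root (simpleRoots i) x∈))
    where
    zero? : ∀ j → Dec (j ≡ i ⊎ ⟪ x , ω j ⟫ ≈ 0#)
    zero? j = (j ≟ꟳ i) ⊎-dec (⟪ x , ω j ⟫ ≟ 0#)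

    outside : NonPositive (s i x) → ∃[ j ] ¬ (j ≡ i ⊎ ⟪ x , ω j ⟫ ≈ 0#) → NonNegative (s i x)
    outside sx≤0 (j , p) = ⊥-elim (p (inj₂ (antisym (≤-respˡ-≈ (⟪s,ω⟫ i x (p ∘ inj₁)) (sx≤0 j)) (x≥0 j))))

    conclude : NonNegative (s i x) ⊎ NonPositive (s i x) → NonNegative (s i x)
    conclude (inj₁ sx≥0) = sx≥0
    conclude (inj₂ sx≤0) = outside sx≤0 (¬∀⟶∃¬ r _ zero? (x≉α ∘ simple-multiple i x∈ x≥0))

  -- Otherwise ⟪ x , x ⟫, expanded in the simple roots with nonnegative coordinates, would be at
  -- most 0.
  positive-simple-pairing : ∀ {x} → x ∈ Root → NonNegative x → ∃[ i ] 0# < ⟪ x , Π i ⟫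
  positive-simple-pairing {x} x∈ x≥0 with any? (λ i → 0# <? ⟪ x , Π i ⟫)
  ... | yes p = p
  ... | no p  = ⊥-elim (<⇒≱ (0<⟪x,x⟫ (root≉0 x∈)) (≤-respˡ-≈
    (sym (trans (⟪⟫-congʳ (coordinates x)) (⟪,⟫-combination x _ Π)))
    (≤-respʳ-≈ (Σ-zero r) (Σ-mono-≤ {g = λ _ → 0#} (λ j → ≤-respʳ-≈ (zeroʳ ⟪ x , ω j ⟫)
      (*-monoˡ-≤ (x≥0 j) (≮⇒≥ (λ q → p (j , q)))))))))

  -- The sum of the fundamental coweights: it pairs to 1 with every simple root, so that `⟪ x , ρ ⟫`
  -- is the height of `x`.
  ρ : Carrierᴹ
  ρ = Σᴹ ω

  0<⟪Π,ρ⟫ : ∀ i → 0# < ⟪ Π i , ρ ⟫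
  0<⟪Π,ρ⟫ i = 0<-resp (sym (trans (⟪⟫-sym _ _) (trans (⟪⟫-Σ ω (Π i))
    (trans (Σ-cong r (λ j → trans (⟪⟫-sym _ _) (⟪Π,ω⟫ i j))) (Σ-δ-1 i))))) 0<1

  -- Every Weyl group element is a word in the simple reflections

  IsWord : (Carrierᴹ → Carrierᴹ) → Set _
  IsWord w = ∃[ l ] ∀ x → w x ≈ᴹ act l x

  lower-height : ∀ i {x} → 0# < ⟪ x , Π i ⟫ → ⟪ s i x , ρ ⟫ < ⟪ x , ρ ⟫
  lower-height i {x} 0<c = <-respˡ (sym (⟪reflection⟫ (Π i) x ρ))
    (0≤-⇒≤ (0≤-resp cancel (proj₁ 0<d)) , λ q → proj₂ 0<d (trans (sym (-‿inverseʳ _)) (trans (+-congˡ (-‿cong (sym q))) (sym cancel))))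
    where
    0<d = 0<x*y (0<cartan (Π≉0 i) 0<c) (0<⟪Π,ρ⟫ i)
    cancel : cartan x (Π i) * ⟪ Π i , ρ ⟫ ≈ ⟪ x , ρ ⟫ - (⟪ x , ρ ⟫ - cartan x (Π i) * ⟪ Π i , ρ ⟫)
    cancel = solve 2 (λ d x → d := x :- (x :- d)) refl _ _

  -- The reflection in `α` is the conjugate by `s i` of the reflection in `s i α`.
  conjugate-word : ∀ i {α} → IsWord (reflection (s i α)) → IsWord (reflection α)
  conjugate-word i {α} (l , h) = (i ∷ l) ∷ʳ i , λ x → ≈ᴹ-trans (≈ᴹ-sym (conjugate x))
    (map-cong (s-orthogonal i) (≡.subst (reflection (s i α) (s i x) ≈ᴹ_) (≡.sym (act-∷ʳ l i x)) (h (s i x))))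
    where
    conjugate : ∀ x → s i (reflection (s i α) (s i x)) ≈ᴹ reflection α x
    conjugate x = ≈ᴹ-trans (map-cong (s-orthogonal i) (≈ᴹ-sym (reflection-conjugate (s-orthogonal i) α x)))
      (reflection-involutive (Π≉0 i) _)

  word-resp : ∀ {α β} → α ≈ᴹ β → IsWord (reflection β) → IsWord (reflection α)
  word-resp e (l , h) = l , λ x → ≈ᴹ-trans (reflection-congˡ e x) (h x)

  -- Induction on the height: a positive root that is not simple pairs positively with some `Π i`,
  -- and `s i` lowers its height while keeping it positive.
  positive-reflection-word : ∀ j → Acc (λ i j → ⟪ Φ i , ρ ⟫ < ⟪ Φ j , ρ ⟫) j → NonNegative (Φ j) →
                             IsWord (reflection (Φ j))
  positive-reflection-word j (acc rec) Φⱼ≥0 = step (positive-simple-pairing Φⱼ∈ Φⱼ≥0)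
    where
    Φⱼ∈ : Φ j ∈ Root
    Φⱼ∈ = j , ≈ᴹ-refl

    descend : ∀ i → 0# < ⟪ Φ j , Π i ⟫ → ¬ (Φ j ≈ᴹ Π i) → s i (Φ j) ∈ Root → IsWord (reflection (Φ j))
    descend i 0<c ne (k , e) = conjugate-word i (word-resp e
      (positive-reflection-word k (rec (<-respˡ (⟪⟫-congˡ e) (lower-height i 0<c)))
        (NonNegative-resp e (s-NonNegative i Φⱼ∈ Φⱼ≥0 ne))))

    cases : ∀ i → 0# < ⟪ Φ j , Π i ⟫ → Dec (Φ j ≈ᴹ Π i) → IsWord (reflection (Φ j))
    cases i 0<c (yes e) = i ∷ [] , reflection-congˡ e
    cases i 0<c (no ne) = descend i 0<c ne (reflection-Root (simpleRoots i) Φⱼ∈)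

    step : ∃[ i ] 0# < ⟪ Φ j , Π i ⟫ → IsWord (reflection (Φ j))
    step (i , 0<c) = cases i 0<c (Φ j ≟ᴹ Π i)

  reflection-word : ∀ {α} → α ∈ Root → IsWord (reflection α)
  reflection-word {α} α∈ = cases (root-sign α∈)
    where
    positive : ∀ {α} → α ∈ Root → NonNegative α → IsWord (reflection α)
    positive (j , e) p = word-resp e
      (positive-reflection-word j (key-wellFounded (λ j → ⟪ Φ j , ρ ⟫) j) (NonNegative-resp e p))

    negated : IsWord (reflection (-ᴹ α)) → IsWord (reflection α)
    negated (l , h) = l , λ x → ≈ᴹ-trans (≈ᴹ-sym (reflection-neg α x)) (h x)

    cases : NonNegative α ⊎ NonPositive α → IsWord (reflection α)
    cases (inj₁ p) = positive α∈ p
    cases (inj₂ p) = negated (positive (neg-Root α∈) (neg-NonPositive p))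

  -- Provides the length on which the later induction runs. The word need not be reduced.
  weyl-word : ∀ {w} → w ∈ weylGroup Φ → IsWord w
  weyl-word (generator α∈) = reflection-word α∈
  weyl-word identity = [] , λ _ → ≈ᴹ-refl
  weyl-word (compose {w} {w′} p q) = combine (weyl-word p) (weyl-word q)
    where
    combine : IsWord w → IsWord w′ → IsWord (w ∘ w′)
    combine (l , h) (l′ , h′) = l ++ l′ , λ x → ≈ᴹ-trans (h _)
      (≈ᴹ-trans (map-cong (act-orthogonal l) (h′ x)) (≡.subst (act l (act l′ x) ≈ᴹ_) (≡.sym (act-++ l l′ x)) ≈ᴹ-refl))
  weyl-word (inverse {w} {w′} p ww′ w′w) = invert (weyl-word p)
    where
    invert : IsWord w → IsWord w′
    invert (l , h) = reverse l , λ x → ≈ᴹ-trans (≈ᴹ-sym (inverseˡ (act-orthogonal l) (w′ x)))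
      (map-cong (inverse-orthogonal (act-orthogonal l)) (≈ᴹ-trans (≈ᴹ-sym (h (w′ x))) (ww′ x)))
  weyl-word (pointwise {w} {w′} p e) = replace (weyl-word p)
    where
    replace : IsWord w → IsWord w′
    replace (l , h) = l , λ x → ≈ᴹ-trans (e x) (h x)

  act∈ReflectionGroup : ∀ {a} {S : Pred Carrierᴹ a} l → (∀ i → Π i ∈ S) → act l ∈ ReflectionGroup S
  act∈ReflectionGroup []      p = identity
  act∈ReflectionGroup (i ∷ l) p = compose (generator (p i)) (act∈ReflectionGroup l p)

  -- The exchange condition, and dominant representatives of orbits

  -- Reading the word from the right, `Π i` turns negative at some letter `j`. Just before that it
  -- must be `Π j`, the only positive root that `s j` makes negative, and that letter can be
  -- deleted. Thus `l′` is one letter shorter than `l`, hence two shorter than `l ∷ʳ i`.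
  exchange : ∀ l i → NonPositive (act l (Π i)) →
             ∃[ l′ ] length l ≡ suc (length l′) × (∀ x → act l (s i x) ≈ᴹ act l′ x)
  exchange []      i p = ⊥-elim (one-sign (simpleRoots i) (Π-NonNegative i) p)
  exchange (j ∷ l) i p = cases (root-sign y∈)
    where
    y = act l (Π i)
    y∈ = act-Root l (simpleRoots i)

    Exchanged : List (Fin r) → Set _
    Exchanged l = ∃[ l′ ] length l ≡ suc (length l′) × (∀ x → act l (s i x) ≈ᴹ act l′ x)

    deeper : Exchanged l → Exchanged (j ∷ l)
    deeper (l′ , e , h) = j ∷ l′ , ≡.cong suc e , λ x → map-cong (s-orthogonal j) (h x)

    here : NonNegative y → Dec (y ≈ᴹ Π j) → Exchanged (j ∷ l)
    here q (no ne) = ⊥-elim (one-sign (reflection-Root (simpleRoots j) y∈) (s-NonNegative j y∈ q ne) p)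
    -- With `y ≈ᴹ Π j`, moving `s i` leftwards past `act l` turns it into `s j`, which cancels the
    -- head.
    here q (yes e) = l , ≡.refl , λ x → ≈ᴹ-trans
      (map-cong (s-orthogonal j) (≈ᴹ-trans (reflection-conjugate (act-orthogonal l) (Π i) x)
        (reflection-congˡ e (act l x))))
      (reflection-involutive (Π≉0 j) (act l x))

    cases : NonNegative y ⊎ NonPositive y → Exchanged (j ∷ l)
    cases (inj₁ q) = here q (y ≟ᴹ Π j)
    cases (inj₂ q) = deeper (exchange l i q)

  indicator : ∀ {a} {A : Set a} → Dec A → ℕ
  indicator (yes _) = 1
  indicator (no _)  = 0

  indicator-mono : ∀ {a b} {A : Set a} {B : Set b} → (A → B) → (p : Dec A) (q : Dec B) → indicator p ℕ.≤ indicator q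
  indicator-mono f (yes a) (yes b) = ℕ.≤-refl
  indicator-mono f (yes a) (no ¬b) = ⊥-elim (¬b (f a))
  indicator-mono f (no ¬a) q       = ℕ.z≤n

  indicator-< : ∀ {a b} {A : Set a} {B : Set b} → ¬ A → B → (p : Dec A) (q : Dec B) → indicator p ℕ.< indicator q
  indicator-< ¬a b (yes a) q       = ⊥-elim (¬a a)
  indicator-< ¬a b (no _)  (yes _) = ℕ.≤-refl
  indicator-< ¬a b (no _)  (no ¬b) = ⊥-elim (¬b b)

  Σℕ-mono-≤ : ∀ {n} {f g : Fin n → ℕ} → (∀ i → f i ℕ.≤ g i) → Σℕ.sum f ℕ.≤ Σℕ.sum g
  Σℕ-mono-≤ {zero}  p = ℕ.z≤n
  Σℕ-mono-≤ {suc n} p = ℕ.+-mono-≤ (p zero) (Σℕ-mono-≤ (p ∘ suc))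

  Σℕ-mono-< : ∀ {n} {f g : Fin n → ℕ} → (∀ i → f i ℕ.≤ g i) → ∀ i → f i ℕ.< g i → Σℕ.sum f ℕ.< Σℕ.sum g
  Σℕ-mono-< p zero    q = ℕ.+-mono-<-≤ q (Σℕ-mono-≤ (p ∘ suc))
  Σℕ-mono-< p (suc i) q = ℕ.+-mono-≤-< (p zero) (Σℕ-mono-< (p ∘ suc) i q)

  private
    K : ℕ
    K = proj₁ (without-repetition Φ)

    D : Fin K → Carrierᴹ
    D = proj₁ (proj₂ (without-repetition Φ))

    D-injective : Injective _≡_ _≈ᴹ_ D
    D-injective = proj₁ (proj₂ (proj₂ (without-repetition Φ)))

    Root⊆D : ∀ {x} → x ∈ Root → x ∈ Range D
    Root⊆D (j , e) with k , e′ ← proj₁ (proj₂ (proj₂ (proj₂ (without-repetition Φ)))) j = k , ≈ᴹ-trans e e′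

    D-Root : ∀ k → D k ∈ Root
    D-Root = proj₂ (proj₂ (proj₂ (proj₂ (without-repetition Φ))))

    σ : ∀ i → ∃[ π ] ∀ k → s i (D k) ≈ᴹ D (π ⟨$⟩ʳ k)
    σ i = family-permutation D D-injective (s-orthogonal i) (λ k → Root⊆D (reflection-Root (simpleRoots i) (D-Root k)))

  Defect : Carrierᴹ → Carrierᴹ → Set _
  Defect x α = NonNegative α × ⟪ x , α ⟫ < 0#

  defect? : ∀ x α → Dec (Defect x α)
  defect? x α = all? (λ j → 0# ≤? ⟪ α , ω j ⟫) ×-dec (⟪ x , α ⟫ <? 0#)

  -- Counts the root hyperplanes strictly separating `x` from the interior of the chamber. As a
  -- natural number it bounds the descent into the chamber without any knowledge of the orbit of
  -- `x`.
  defect : Carrierᴹ → ℕ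
  defect x = Σℕ.sum (λ k → indicator (defect? x (D k)))

  -- After reindexing by the permutation that `s i` induces on the roots, each defect of `s i x`
  -- comes from a defect of `x`. The root `Π i` makes the inequality strict: it is a defect of `x`,
  -- but is matched with its negative.
  defect-decreases : ∀ i {x} → ⟪ x , Π i ⟫ < 0# → defect (s i x) ℕ.< defect x
  defect-decreases i {x} xα<0 = ≡.subst (ℕ._< defect x)
    (≡.sym (Σℕ.sum-permute (λ k → indicator (defect? (s i x) (D k))) π))
    (Σℕ-mono-< (λ k → indicator-mono (transfer k) _ _) (proj₁ α∈D)
      (indicator-< (not-in (proj₁ α∈D) (proj₂ α∈D))
        (NonNegative-resp (proj₂ α∈D) (Π-NonNegative i) , <-respˡ (⟪⟫-congʳ (proj₂ α∈D)) xα<0) _ _))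
    where
    π = proj₁ (σ i)
    sD = proj₂ (σ i)
    α∈D = Root⊆D (simpleRoots i)

    transfer : ∀ k → Defect (s i x) (D (π ⟨$⟩ʳ k)) → Defect x (D k)
    transfer k (p , q) =
      NonNegative-resp (≈ᴹ-trans (map-cong (s-orthogonal i) (≈ᴹ-sym (sD k))) (inverseˡ (s-orthogonal i) (D k)))
        (s-NonNegative i (D-Root _) p ne) ,
      <-respˡ (trans (⟪⟫-congʳ (≈ᴹ-sym (sD k))) (isometry (s-orthogonal i) x (D k))) q
      where
      -- `s i x` pairs positively with `Π i`, so the one positive root that `s i` makes negative is
      -- no defect of `s i x`.
      ne : ¬ (D (π ⟨$⟩ʳ k) ≈ᴹ Π i)
      ne e = <⇒≱ xα<0 (0≤-resp (solve 1 (λ a → :- (:- a) := a) refl ⟪ x , Π i ⟫)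
        (≤0⇒0≤- (≤-respˡ-≈ (trans (⟪⟫-congʳ e) (trans (adjoint (s-orthogonal i) x (Π i))
          (trans (⟪⟫-congʳ (reflection-self (Π≉0 i))) (flip (⟨-⟩ ⟪⟫-sym (Π i) x))))) (proj₁ q))))

    not-in : ∀ k → Π i ≈ᴹ D k → ¬ Defect (s i x) (D (π ⟨$⟩ʳ k))
    not-in k e (p , _) = one-sign (D-Root _) p (NonPositive-resp
      (≈ᴹ-trans (≈ᴹ-sym (reflection-self (Π≉0 i))) (≈ᴹ-trans (map-cong (s-orthogonal i) e) (sD k)))
      (neg-NonNegative (Π-NonNegative i)))

  dominant-representative : ∀ x → ∃[ l ] act l x ∈ chamber Π
  dominant-representative x = go x (<-wellFounded (defect x))
    where
    prepend : ∀ x i → ∃[ l ] act l (s i x) ∈ chamber Π → ∃[ l ] act l x ∈ chamber Π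
    prepend x i (l , h) = l ∷ʳ i , ≡.subst (_∈ chamber Π) (≡.sym (act-∷ʳ l i x)) h

    go : ∀ x → Acc ℕ._<_ (defect x) → ∃[ l ] act l x ∈ chamber Π
    step : ∀ x → Acc ℕ._<_ (defect x) → Dec (∃[ i ] ⟪ x , Π i ⟫ < 0#) → ∃[ l ] act l x ∈ chamber Π
    go x a = step x a (any? (λ i → ⟪ x , Π i ⟫ <? 0#))
    step x (acc rec) (yes (i , p)) = prepend x i (go (s i x) (rec (defect-decreases i p)))
    step x _         (no p)        = [] , λ i → ≮⇒≥ (λ q → p (i , q))

-- Faces of the root polytope

module PolytopeFaces {c ℓ₁ ℓ₂ m ℓm} {ℝ : RealField c ℓ₁ ℓ₂} (𝔼 : InnerProductSpace ℝ m ℓm)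
  {N r : ℕ} (Φ : Fin N → InnerProductSpace.Carrierᴹ 𝔼) (Π : Fin r → InnerProductSpace.Carrierᴹ 𝔼)
  (isRootSystem : Geometry.IsRootSystem 𝔼 Φ) (isSimpleSystem : Geometry.IsSimpleSystem 𝔼 Φ Π) where
  open OrderedField ℝ
  open InnerProduct 𝔼
  open RelativeInterior 𝔼
  open Reflection 𝔼
  open WeylGroup 𝔼 Φ Π isRootSystem isSimpleSystem

  open RealField ℝ hiding (zero)
  open InnerProductSpace 𝔼
  open Geometry 𝔼
  open IsOrthogonal
  open IsRootSystem isRootSystem
  open IsSimpleSystem isSimpleSystem
  open import Relation.Binary.Reasoning.Setoid setoid

  private
    P : Subset
    P = rootPolytope Φ

  P⇒Hull : ∀ {x} → x ∈ P → Hull Φ x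
  P⇒Hull = convexHull⇒Hull {S = Root} (λ { (i , e) → Hull-resp (≈ᴹ-sym e) (Hull-generator Φ i) })

  Hull⇒P : ∀ {x} → Hull Φ x → x ∈ P
  Hull⇒P = Hull⇒convexHull {S = Root} (λ i → i , ≈ᴹ-refl)

  Root⊆P : ∀ {x} → x ∈ Root → x ∈ P
  Root⊆P (i , e) = Hull⇒P (Hull-resp (≈ᴹ-sym e) (Hull-generator Φ i))

  P-map : ∀ {w w⁻¹} → IsOrthogonal w w⁻¹ → (∀ {x} → x ∈ Root → w x ∈ Root) → ∀ {x} → x ∈ P → w x ∈ P
  P-map {w} W w-Root x∈P = image-hull (P⇒Hull x∈P)
    where
    image-hull : ∀ {x} → Hull Φ x → w x ∈ P
    image-hull (t , t≥0 , Σt , e) = N , t , w ∘ Φ , (λ i → w-Root (i , ≈ᴹ-refl)) , t≥0 , Σt ,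
      ≈ᴹ-trans (map-cong W e) (map-combination W t Φ)

  act-P : ∀ l {x} → x ∈ P → act l x ∈ P
  act-P l = P-map (act-orthogonal l) (act-Root l)

  relativeInterior-map : ∀ {a b} {F : Pred Carrierᴹ a} {G : Pred Carrierᴹ b} {w w⁻¹} → IsOrthogonal w w⁻¹ →
    (∀ {x y} → x ≈ᴹ y → x ∈ G → y ∈ G) → (∀ {x} → x ∈ F → w x ∈ G) → (∀ {y} → y ∈ G → w⁻¹ y ∈ F) →
    ∀ {x} → x ∈ relativeInterior F → w x ∈ relativeInterior G
  relativeInterior-map {F = F} {G} {w} {w⁻¹} W G-resp F⇒G G⇒F {x} (x∈F , ε , 0<ε , ball) = F⇒G x∈F , ε , 0<ε , ball′
    where
    W⁻¹ = inverse-orthogonal W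

    pull : ∀ {y} → y ∈ affineHull G → w⁻¹ y ∈ affineHull F
    pull (n , t , v , v∈ , Σt , e) = n , t , w⁻¹ ∘ v , (λ i → G⇒F (v∈ i)) , Σt ,
      ≈ᴹ-trans (map-cong W⁻¹ e) (map-combination W⁻¹ t v)

    ball′ : ∀ y → y ∈ affineHull G → ⟪ y -ᴹ w x , y -ᴹ w x ⟫ < ε * ε → y ∈ G
    ball′ y y∈ d< = G-resp (inverseʳ W y) (F⇒G (ball (w⁻¹ y) (pull y∈)
      (<-respˡ (trans (sym (isometry W⁻¹ _ _)) (⟪⟫-cong moved moved)) d<)))
      where
      moved : w⁻¹ (y -ᴹ w x) ≈ᴹ w⁻¹ y -ᴹ x
      moved = ≈ᴹ-trans (map-sub W⁻¹ y (w x)) (+ᴹ-cong ≈ᴹ-refl (-ᴹ‿cong (inverseˡ W x)))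

  -- The argument of type `Fin n` records that the family is nonempty.
  average-relativeInterior : ∀ {a} {F : Pred Carrierᴹ a} {n} (v : Fin n → Carrierᴹ) → Fin n →
    (∀ {x} → Hull v x → x ∈ F) → (∀ {x} → x ∈ F → Hull v x) →
    ∀ {β} → β ≈ᴹ fromℕ n ⁻¹ *ₗ Σᴹ v → β ∈ relativeInterior F
  average-relativeInterior {n = suc n} v _ ⊆F F⊆ e = average∈relativeInterior v ⊆F F⊆ e

  module Face (F : Subset) (isFace : IsFaceOf P F) where
    u = proj₁ isFace
    k = proj₁ (proj₂ isFace)

    u≤k : ∀ {x} → x ∈ P → ⟪ u , x ⟫ ≤ k
    u≤k = proj₁ (proj₂ (proj₂ isFace))

    F⊆P : ∀ {x} → x ∈ F → x ∈ P
    F⊆P x∈ = proj₁ (proj₁ (proj₂ (proj₂ (proj₂ isFace))) x∈)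

    F⇒u≈k : ∀ {x} → x ∈ F → ⟪ u , x ⟫ ≈ k
    F⇒u≈k x∈ = proj₂ (proj₁ (proj₂ (proj₂ (proj₂ isFace))) x∈)

    F⇐ : ∀ {x} → x ∈ P → ⟪ u , x ⟫ ≈ k → x ∈ F
    F⇐ x∈ e = proj₂ (proj₂ (proj₂ (proj₂ isFace))) (x∈ , e)

    -- A `Subset` need not respect `≈ᴹ`; a face does, being cut out of the polytope by an equation.
    F-resp : ∀ {x y} → x ≈ᴹ y → x ∈ F → y ∈ F
    F-resp e x∈ = F⇐ (Hull⇒P (Hull-resp e (P⇒Hull (F⊆P x∈)))) (trans (⟪⟫-congʳ (≈ᴹ-sym e)) (F⇒u≈k x∈))

    Hull⊆F : ∀ {n} {v : Fin n → Carrierᴹ} → (∀ i → v i ∈ F) → ∀ {x} → Hull v x → x ∈ F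
    Hull⊆F {n} {v} v∈ {x} (t , t≥0 , Σt , e) = F⇐
      (Hull⇒P (Hull-resp (≈ᴹ-sym e) (Hull-bind t v t≥0 Σt (λ i → inj₂ (P⇒Hull (F⊆P (v∈ i)))))))
      (begin
        ⟪ u , x ⟫                          ≈⟨ ⟪⟫-congʳ e ⟩
        ⟪ u , combination t v ⟫            ≈⟨ ⟪,⟫-combination u t v ⟩
        Σᴷ (λ i → t i * ⟪ u , v i ⟫)       ≈⟨ Σ-cong n (λ i → *-congˡ (F⇒u≈k (v∈ i))) ⟩
        Σᴷ (λ i → t i * k)                 ≈⟨ Σ-*ʳ n k t ⟨
        Σᴷ t * k                           ≈⟨ trans (*-congʳ Σt) (*-identityˡ k) ⟩
        k                                  ∎)

    -- By `support`, a point of F is a combination of roots in which those off F have weight 0. So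
    -- only the roots on F have to be placed in the hull.
    F⊆Hull : ∀ {n} {v : Fin n → Carrierᴹ} → (∀ i → Φ i ∈ F → Hull v (Φ i)) → ∀ {x} → x ∈ F → Hull v x
    F⊆Hull {v = v} h {x} x∈ = combine (P⇒Hull (F⊆P x∈))
      where
      combine : Hull Φ x → Hull v x
      combine (t , t≥0 , Σt , e) = Hull-resp (≈ᴹ-sym e) (Hull-bind t Φ t≥0 Σt (λ i →
        [ inj₁ , inj₂ ∘ h i ∘ F⇐ (Root⊆P (i , ≈ᴹ-refl)) ]′
          (support t Φ t≥0 Σt e (λ j → u≤k (Root⊆P (j , ≈ᴹ-refl))) (F⇒u≈k x∈) i)))

    root-in-F : ∀ {x} → x ∈ F → ∃[ i ] Φ i ∈ F
    root-in-F {x} x∈ = find (P⇒Hull (F⊆P x∈))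
      where
      find : Hull Φ x → ∃[ i ] Φ i ∈ F
      find (t , t≥0 , Σt , e) = i , [ ⊥-elim ∘ proj₂ (some-weight≉0 t Σt) , F⇐ (Root⊆P (i , ≈ᴹ-refl)) ]′
        (support t Φ t≥0 Σt e (λ j → u≤k (Root⊆P (j , ≈ᴹ-refl))) (F⇒u≈k x∈) i)
        where i = proj₁ (some-weight≉0 t Σt)

    -- F is an arbitrary predicate, but for a root membership amounts to the scalar equation
    -- `⟪ u , Φ i ⟫ ≈ k`. With `root-in-F` this decides whether F is empty.
    root-on-F? : ∀ i → Dec (Φ i ∈ F)
    root-on-F? i = decide (⟪ u , Φ i ⟫ ≟ k)
      where
      decide : Dec (⟪ u , Φ i ⟫ ≈ k) → Dec (Φ i ∈ F)
      decide (yes e) = yes (F⇐ (Root⊆P (i , ≈ᴹ-refl)) e)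
      decide (no ne) = no (ne ∘ F⇒u≈k)

    nonempty? : Dec (∃[ i ] Φ i ∈ F)
    nonempty? = any? root-on-F?

    -- Serves the orbit statement, where no enumeration of the vertices is given. The family
    -- averaged runs over all indices of `Φ`, with roots off F replaced by the known root `Φ i₀` on
    -- F.
    ∃relativeInterior : ∃[ i ] Φ i ∈ F → ∃[ b ] b ∈ relativeInterior F
    ∃relativeInterior (i₀ , i₀∈) = fromℕ N ⁻¹ *ₗ Σᴹ v ,
      average-relativeInterior v i₀ (Hull⊆F (λ i → select∈ i (root-on-F? i)))
        (F⊆Hull (λ i i∈ → Hull-resp (select≈ i∈ (root-on-F? i)) (Hull-generator v i))) ≈ᴹ-refl
      where
      select : ∀ i → Dec (Φ i ∈ F) → Carrierᴹ
      select i (yes _) = Φ i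
      select i (no _)  = Φ i₀

      select∈ : ∀ i d → select i d ∈ F
      select∈ i (yes p) = p
      select∈ i (no _)  = i₀∈

      select≈ : ∀ {i} → Φ i ∈ F → ∀ d → select i d ≈ᴹ Φ i
      select≈ p (yes _) = ≈ᴹ-refl
      select≈ p (no ¬p) = ⊥-elim (¬p p)

      v : Fin N → Carrierᴹ
      v i = select i (root-on-F? i)

    Preserved : Fin r → Set _
    Preserved i = ∀ {x} → x ∈ F → s i x ∈ F

    vanishing⇒preserved : ∀ {i} → (∀ {x} → x ∈ F → ⟪ x , Π i ⟫ ≈ 0#) → Preserved i
    vanishing⇒preserved z x∈ = F-resp (≈ᴹ-sym (reflection-fixes (z x∈))) x∈

    -- The sign of ⟪ u , α ⟫ decides: s α x cannot exceed the bound attained at x.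
    trichotomy : ∀ i → Preserved i ⊎ (∀ {x} → x ∈ F → 0# ≤ ⟪ x , Π i ⟫) ⊎ (∀ {x} → x ∈ F → ⟪ x , Π i ⟫ ≤ 0#)
    trichotomy i = cases (⟪ u , α ⟫ ≟ 0#) (0# ≤? ⟪ u , α ⟫)
      where
      α = Π i

      ⟪u,s⟫ : ∀ x → ⟪ u , s i x ⟫ ≈ ⟪ u , x ⟫ - cartan x α * ⟪ u , α ⟫
      ⟪u,s⟫ x = flip (⟪⟫-sym x u ⟨-⟩ _ ⟨*⟩ ⟪⟫-sym α u)

      0≤product : ∀ {x} → x ∈ F → 0# ≤ ⟪ x , α ⟫ * ⟪ u , α ⟫
      0≤product {x} x∈ = *-cancelˡ-0≤ (0<x*y 0<2 (0<x⁻¹ (0<⟪x,x⟫ (Π≉0 i)))) (0≤-resp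
        (begin
          k - ⟪ u , s i x ⟫
            ≈⟨ +-cong (sym (F⇒u≈k x∈)) (-‿cong (⟪u,s⟫ x)) ⟩
          ⟪ u , x ⟫ - (⟪ u , x ⟫ - (1# + 1#) * ⟪ x , α ⟫ * ⟪ α , α ⟫ ⁻¹ * ⟪ u , α ⟫)
            ≈⟨ solve 4 (λ y x q a → y :- (y :- (:1 :+ :1) :* x :* q :* a) := (:1 :+ :1) :* q :* (x :* a)) refl _ _ _ _ ⟩
          (1# + 1#) * ⟪ α , α ⟫ ⁻¹ * (⟪ x , α ⟫ * ⟪ u , α ⟫) ∎)
        (≤⇒0≤- (u≤k (act-P (i ∷ []) (F⊆P x∈)))))

      cases : Dec (⟪ u , α ⟫ ≈ 0#) → Dec (0# ≤ ⟪ u , α ⟫) →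
              Preserved i ⊎ (∀ {x} → x ∈ F → 0# ≤ ⟪ x , α ⟫) ⊎ (∀ {x} → x ∈ F → ⟪ x , α ⟫ ≤ 0#)
      cases (yes e) _ = inj₁ λ {x} x∈ → F⇐ (act-P (i ∷ []) (F⊆P x∈)) (trans (⟪u,s⟫ x)
        (trans (+-congˡ (-‿cong (trans (*-congˡ e) (zeroʳ _))))
          (trans (solve 1 (λ a → a :- :0 := a) refl ⟪ u , x ⟫) (F⇒u≈k x∈))))
      cases (no ne) (yes p) = inj₂ (inj₁ λ x∈ → *-cancelˡ-0≤ (pos p ne) (0≤-resp (*-comm _ _) (0≤product x∈)))
      cases (no ne) (no p)  = inj₂ (inj₂ λ x∈ → 0≤-⇒≤0 (*-cancelˡ-0≤
        (≤0⇒0≤- (proj₁ (≰⇒> p)) , λ e → ne (trans (solve 1 (λ a → a := :- (:- a)) refl _) (trans (-‿cong (sym e)) (solve 0 (:- :0 := :0) refl))))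
        (0≤-resp (solve 2 (λ x a → x :* a := (:- a) :* (:- x)) refl _ _) (0≤product x∈))))

    preserved : ∀ i {x y} → x ∈ relativeInterior F → y ∈ relativeInterior F →
                0# ≤ ⟪ x , Π i ⟫ → ⟪ y , Π i ⟫ ≤ 0# → Preserved i
    preserved i {x} {y} x∈ y∈ x≥0 y≤0 = cases (trichotomy i)
      where
      cases : Preserved i ⊎ (∀ {x} → x ∈ F → 0# ≤ ⟪ x , Π i ⟫) ⊎ (∀ {x} → x ∈ F → ⟪ x , Π i ⟫ ≤ 0#) → Preserved i
      cases (inj₁ p)        = p
      cases (inj₂ (inj₁ p)) = vanishing⇒preserved (relativeInterior-zero y∈ y≤0 p)
      -- The mirror image of the previous case: `-ᴹ Π i` replaces `Π i`, and `x` replaces `y`.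
      cases (inj₂ (inj₂ p)) = vanishing⇒preserved λ z∈ →
        trans (solve 1 (λ a → a := :- (:- a)) refl _) (trans (-‿cong (trans (sym (flip (⟨-⟩ ⟪⟫-sym (Π i) _)))
          (relativeInterior-zero x∈ (0≤-⇒≤0 (0≤-resp (trans (solve 1 (λ a → a := :- (:- a)) refl _) (-‿cong (sym (flip (⟨-⟩ ⟪⟫-sym (Π i) x))))) x≥0))
            (λ y∈ → 0≤-resp (sym (flip (⟨-⟩ ⟪⟫-sym (Π i) _))) (≤0⇒0≤- (p y∈))) z∈)))
          (solve 0 (:- :0 := :0) refl))

    preserved⇒image : ∀ {i} → Preserved i → image (s i) F ≐ F
    preserved⇒image {i} p =
      (λ { (x , x∈ , e) → F-resp (≈ᴹ-sym e) (p x∈) }) ,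
      (λ {x} x∈ → s i x , p x∈ , ≈ᴹ-sym (reflection-involutive (Π≉0 i) x))

  image-isFace : ∀ l F → IsFaceOf P F → IsFaceOf P (image (act l) F)
  image-isFace l F isFace = act l u , k ,
    (λ {x} x∈ → ≤-respˡ-≈ (sym (adjoint W u x)) (u≤k (act-P (reverse l) x∈))) ,
    (λ { (x , x∈ , e) → Hull⇒P (Hull-resp (≈ᴹ-sym e) (P⇒Hull (act-P l (F⊆P x∈)))) ,
                        trans (⟪⟫-congʳ e) (trans (isometry W u x) (F⇒u≈k x∈)) }) ,
    (λ { {y} (y∈ , e) → act (reverse l) y , F⇐ (act-P (reverse l) y∈) (trans (sym (adjoint W u y)) e) ,
                        ≈ᴹ-sym (inverseʳ W y) })
    where
    open Face F isFace
    W = act-orthogonal l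

-- Vertices of faces, and faces as hulls of their vertices

module PolytopeVertices {c ℓ₁ ℓ₂ m ℓm} {ℝ : RealField c ℓ₁ ℓ₂} (𝔼 : InnerProductSpace ℝ m ℓm)
  {N r : ℕ} (Φ : Fin N → InnerProductSpace.Carrierᴹ 𝔼) (Π : Fin r → InnerProductSpace.Carrierᴹ 𝔼)
  (isRootSystem : Geometry.IsRootSystem 𝔼 Φ) (isSimpleSystem : Geometry.IsSimpleSystem 𝔼 Φ Π) where
  open OrderedField ℝ
  open InnerProduct 𝔼
  open RelativeInterior 𝔼
  open Reflection 𝔼
  open WeylGroup 𝔼 Φ Π isRootSystem isSimpleSystem
  open PolytopeFaces 𝔼 Φ Π isRootSystem isSimpleSystem

  open RealField ℝ hiding (zero)
  open InnerProductSpace 𝔼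
  open Geometry 𝔼
  open IsOrthogonal
  open IsRootSystem isRootSystem
  open IsSimpleSystem isSimpleSystem
  open import Relation.Binary.Reasoning.Setoid setoid

  private
    P : Subset
    P = rootPolytope Φ

  norm² : Carrierᴹ → Carrier
  norm² x = ⟪ x , x ⟫

  cartan-integral : ∀ {β α} → β ∈ Root → α ∈ Root → ∃[ z ] cartan β α ≈ fromℤ z
  cartan-integral {β} {α} (i , e) (j , e′) = proj₁ (crystallographic i j) ,
    trans (cartan-cong {β} {Φ i} {α} {Φ j} (⟪⟫-cong e e′) (⟪⟫-cong e′ e′)) (proj₂ (crystallographic i j))

  -- By symmetry of the form the two Cartan integers are inversely proportional to the squared
  -- lengths. The one divided by the longer length is a positive integer, so the other exceeds 1.
  2≤cartan : ∀ {γ δ} → γ ∈ Root → δ ∈ Root → norm² γ < norm² δ → 0# < ⟪ δ , γ ⟫ → 1# + 1# ≤ cartan δ γ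
  2≤cartan {γ} {δ} γ∈ δ∈ γ<δ 0<δγ = ≤-respʳ-≈ (sym (proj₂ (cartan-integral δ∈ γ∈)))
    (1<fromℤ⇒2≤ (proj₁ (cartan-integral δ∈ γ∈)) (<-respʳ (proj₂ (cartan-integral δ∈ γ∈)) 1<c))
    where
    c′ = cartan δ γ
    d = cartan γ δ

    1≤d : 1# ≤ d
    1≤d = ≤-respʳ-≈ (sym (proj₂ (cartan-integral γ∈ δ∈))) (0<fromℤ⇒1≤ (proj₁ (cartan-integral γ∈ δ∈))
      (0<-resp (proj₂ (cartan-integral γ∈ δ∈)) (0<cartan (root≉0 δ∈) (0<-resp (⟪⟫-sym δ γ) 0<δγ))))

    c*A≈d*B : c′ * norm² γ ≈ d * norm² δ
    c*A≈d*B = trans (cartan*A (root≉0 γ∈) δ) (trans (*-congˡ (⟪⟫-sym δ γ)) (sym (cartan*A (root≉0 δ∈) γ)))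

    -- c A = d B ≥ B > A.
    0<excess : 0# < (norm² δ - norm² γ) + (d - 1#) * norm² δ
    0<excess = 0<x+y (<⇒0<- γ<δ) (*-nonNegative (≤⇒0≤- 1≤d) (⟪⟫-nonNeg δ))

    excess : (norm² δ - norm² γ) + (d - 1#) * norm² δ ≈ norm² γ * (c′ - 1#)
    excess = begin
      (norm² δ - norm² γ) + (d - 1#) * norm² δ ≈⟨ solve 3 (λ b a d → (b :- a) :+ (d :- :1) :* b := d :* b :- a) refl (norm² δ) (norm² γ) d ⟩
      d * norm² δ - norm² γ                    ≈⟨ +-congʳ c*A≈d*B ⟨
      c′ * norm² γ - norm² γ                   ≈⟨ solve 2 (λ a c → c :* a :- a := a :* (c :- :1)) refl (norm² γ) c′ ⟩
      norm² γ * (c′ - 1#)                      ∎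

    1<c : 1# < c′
    1<c = 0≤-⇒≤ (*-cancelˡ-0≤ (0<⟪x,x⟫ (root≉0 γ∈)) (proj₁ (0<-resp excess 0<excess))) ,
      λ e → proj₂ (0<-resp excess 0<excess) (sym (trans (*-congˡ (trans (+-congʳ (sym e)) (-‿inverseʳ 1#))) (zeroʳ _)))

  Hull-singleton : ∀ {γ x} → Hull {1} (λ _ → γ) x → x ≈ᴹ γ
  Hull-singleton {γ} (t , _ , Σt , e) = ≈ᴹ-trans e (⟪⟫-ext λ z → trans (⟪⟫-combination t (λ _ → γ) z)
    (trans (solve 2 (λ t x → t :* x :+ :0 := (t :+ :0) :* x) refl (t zero) ⟪ γ , z ⟫) (trans (*-congʳ Σt) (*-identityˡ _))))

  Hull-point : ∀ {γ x} → x ≈ᴹ γ → Hull {1} (λ _ → γ) x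
  Hull-point {γ} e = Hull-resp {v = λ _ → γ} (≈ᴹ-sym e) (Hull-generator (λ _ → γ) zero)

  module Vertices (F : Subset) (isFace : IsFaceOf P F) where
    open Face F isFace

    vertex⇒∈ : ∀ {x} → IsVertexOf F x → x ∈ F
    vertex⇒∈ (_ , _ , _ , ⊆ , _) = proj₁ (⊆ ≈ᴹ-refl)

    vertex-map : ∀ {w} → IsOrthogonal w w → (∀ {x} → x ∈ F → w x ∈ F) → ∀ {x} → IsVertexOf F x → IsVertexOf F (w x)
    vertex-map {w} W p {x} (u′ , k′ , valid , ⊆ , ⊇) = w u′ , k′ ,
      (λ {y} y∈ → ≤-respˡ-≈ (sym (adjoint W u′ y)) (valid (p y∈))) ,
      (λ {y} e → to (⊆ (≈ᴹ-trans (map-cong W e) (inverseˡ W x)))) ,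
      (λ {y} q → ≈ᴹ-trans (≈ᴹ-sym (inverseˡ W y)) (map-cong W (⊇ (p (proj₁ q) , trans (sym (adjoint W u′ y)) (proj₂ q)))))
      where
      to : ∀ {y} → w y ∈ F × ⟪ u′ , w y ⟫ ≈ k′ → y ∈ F × ⟪ w u′ , y ⟫ ≈ k′
      to {y} (wy∈ , e) = F-resp (inverseˡ W y) (p wy∈) , trans (adjoint W u′ y) e

    OrthogonalToLonger : Carrierᴹ → Set _
    OrthogonalToLonger γ = ∀ j → norm² γ < norm² (Φ j) → ⟪ γ , Φ j ⟫ ≈ 0#

    module _ {γ} (γ∈ : γ ∈ Root) (γ⊥ : OrthogonalToLonger γ) where
      private
        A = norm² γ

        -- The squared distance is A - 2g plus the squared length of `Φ j`, which is at most A. It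
        -- yields both the bound `⟪ γ , Φ j ⟫ ≤ A` and, in case of equality, `Φ j ≈ᴹ γ`.
        2[A-g]≥ : ∀ j → norm² (Φ j) ≤ A → norm² (γ -ᴹ Φ j) ≤ (1# + 1#) * (A - ⟪ γ , Φ j ⟫)
        2[A-g]≥ j B≤A = 0≤-⇒≤ (0≤-resp (sym (begin
          (1# + 1#) * (A - g) - norm² (γ -ᴹ Φ j)
            ≈⟨ +-congˡ (-‿cong (flip (⟪⟫-sym γ _ ⟨-⟩ ⟪⟫-sym (Φ j) _))) ⟩
          (1# + 1#) * (A - g) - (⟪ γ -ᴹ Φ j , γ ⟫ - ⟪ γ -ᴹ Φ j , Φ j ⟫)
            ≈⟨ +-congˡ (-‿cong (+-cong (⟨ γ ⟩ ⟨-⟩ ⟪⟫-sym (Φ j) γ) (-‿cong (⟨ γ ⟩ ⟨-⟩ ⟨ Φ j ⟩)))) ⟩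
          (1# + 1#) * (A - g) - ((A - g) - (g - norm² (Φ j)))
            ≈⟨ solve 3 (λ a g b → (:1 :+ :1) :* (a :- g) :- ((a :- g) :- (g :- b)) := a :- b) refl A g (norm² (Φ j)) ⟩
          A - norm² (Φ j) ∎)) (≤⇒0≤- B≤A))
          where g = ⟪ γ , Φ j ⟫

        bound : ∀ j → Dec (A < norm² (Φ j)) → ⟪ γ , Φ j ⟫ ≤ A
        bound j (yes p) = ≤-respˡ-≈ (sym (γ⊥ j p)) (⟪⟫-nonNeg γ)
        bound j (no p)  = 0≤-⇒≤ (*-cancelˡ-0≤ 0<2 (≤-trans (⟪⟫-nonNeg _) (2[A-g]≥ j (≮⇒≥ p))))

        ⟪γ,Φ⟫≤ : ∀ j → ⟪ γ , Φ j ⟫ ≤ A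
        ⟪γ,Φ⟫≤ j = bound j (A <? norm² (Φ j))

        equality : ∀ j → ⟪ γ , Φ j ⟫ ≈ A → Dec (A < norm² (Φ j)) → Φ j ≈ᴹ γ
        equality j e (yes p) = ⊥-elim (root≉0 γ∈ (⟪⟫-definite (trans (sym e) (γ⊥ j p))))
        equality j e (no p)  = ≈ᴹ-sym (x-y≈0⇒x≈y (⟪⟫-definite (antisym
          (≤-respʳ-≈ (trans (*-congˡ (trans (+-congˡ (-‿cong e)) (-‿inverseʳ A))) (zeroʳ _)) (2[A-g]≥ j (≮⇒≥ p)))
          (⟪⟫-nonNeg _))))

      -- The functional `γ` attains its maximum over the whole polytope at `γ` alone, so it exposes
      -- `γ` on every face through it.
      exposed : γ ∈ F → IsVertexOf F γ
      exposed γ∈F = γ , A , (λ x∈ → ⟪⟫-Hull-≤ ⟪γ,Φ⟫≤ (P⇒Hull (F⊆P x∈))) ,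
        (λ e → F-resp (≈ᴹ-sym e) γ∈F , ⟪⟫-congʳ e) ,
        (λ { (x∈ , e) → only e (P⇒Hull (F⊆P x∈)) })
        where
        only : ∀ {x} → ⟪ γ , x ⟫ ≈ A → Hull Φ x → x ≈ᴹ γ
        only e (t , t≥0 , Σt , e′) = ≈ᴹ-trans e′ (Hull-singleton {γ} (Hull-bind {v = λ _ → γ} t Φ t≥0 Σt (λ j →
          [ inj₁ , (λ q → inj₂ (Hull-point (equality j q (A <? norm² (Φ j))))) ]′
            (support t Φ t≥0 Σt e′ ⟪γ,Φ⟫≤ e j))))

    -- With δ′ = - s_γ δ one has δ + δ′ = c γ, c = cartan δ γ ≥ 2, so that γ lies
    -- in the hull of δ, δ′ and 0. If 0 does not lie on F then c = 2.
    module _ {γ δ} (γ∈ : γ ∈ Root) (γ∈F : γ ∈ F) (δ∈ : δ ∈ Root) (γ<δ : norm² γ < norm² δ) (0<δγ : 0# < ⟪ δ , γ ⟫)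
             {n} {v : Fin n → Carrierᴹ} (IH : ∀ {ε} → ε ∈ Root → ε ∈ F → norm² γ < norm² ε → Hull v ε) where
      private
        c′ q t h : Carrier
        c′ = cartan δ γ
        q  = c′ ⁻¹
        t  = (1# + 1#) ⁻¹
        h  = t * (q * (c′ - (1# + 1#)))

        δ′ : Carrierᴹ
        δ′ = -ᴹ reflection γ δ

        2≤c : 1# + 1# ≤ c′
        2≤c = 2≤cartan γ∈ δ∈ γ<δ 0<δγ

        0<c : 0# < c′
        0<c = 0<cartan (root≉0 γ∈) 0<δγ

        cq≈1 : c′ * q ≈ 1#
        cq≈1 = ⁻¹-inverseʳ (pos⇒≉0 0<c)

        t2≈1 : t * (1# + 1#) ≈ 1#
        t2≈1 = ⁻¹-inverseˡ (pos⇒≉0 0<2)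

        0≤h : 0# ≤ h
        0≤h = *-nonNegative (proj₁ (0<x⁻¹ 0<2)) (*-nonNegative (proj₁ (0<x⁻¹ 0<c)) (≤⇒0≤- 2≤c))

        δ′∈ : δ′ ∈ Root
        δ′∈ = neg-Root (reflection-Root γ∈ δ∈)

        ⟪δ′⟫ : ∀ z → ⟪ δ′ , z ⟫ ≈ c′ * ⟪ γ , z ⟫ - ⟪ δ , z ⟫
        ⟪δ′⟫ z = trans (⟨-⟩ ⟪reflection⟫ γ δ z) (solve 3 (λ d c g → :- (d :- c :* g) := c :* g :- d) refl _ _ _)

        -- `-ᴹ γ` is a root as well, and `u` takes the value -k there, so -k is at most k.
        0≤k : 0# ≤ k
        0≤k = *-cancelˡ-0≤ 0<2 (0≤-resp (trans (+-congˡ (-‿cong (trans (flip (⟨-⟩ ⟪⟫-sym γ u)) (-‿cong (F⇒u≈k γ∈F)))))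
                (solve 1 (λ k → k :- (:- k) := (:1 :+ :1) :* k) refl k))
                (≤⇒0≤- (u≤k (Root⊆P (neg-Root γ∈)))))

        -- As δ + δ′ = c γ and `u` is k at `γ`, these nonnegative numbers add up to 0. So all
        -- vanish: `δ` and `δ′`, not assumed to lie on F, are forced onto it, and either c = 2 or k
        -- = 0.
        gaps : Fin 3 → Carrier
        gaps zero             = k - ⟪ u , δ ⟫
        gaps (suc zero)       = k - ⟪ u , δ′ ⟫
        gaps (suc (suc zero)) = (c′ - (1# + 1#)) * k

        gaps≥0 : ∀ i → 0# ≤ gaps i
        gaps≥0 zero             = ≤⇒0≤- (u≤k (Root⊆P δ∈))
        gaps≥0 (suc zero)       = ≤⇒0≤- (u≤k (Root⊆P δ′∈))
        gaps≥0 (suc (suc zero)) = *-nonNegative (≤⇒0≤- 2≤c) 0≤k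

        Σgaps : Σᴷ gaps ≈ 0#
        Σgaps = begin
          Σᴷ gaps
            ≈⟨ +-congˡ (+-congʳ (+-congˡ (-‿cong (trans (⟪⟫-sym u δ′) (trans (⟪δ′⟫ u)
                 (+-cong (*-congˡ (trans (⟪⟫-sym γ u) (F⇒u≈k γ∈F))) (-‿cong (⟪⟫-sym δ u)))))))) ⟩
          (k - ⟪ u , δ ⟫) + ((k - (c′ * k - ⟪ u , δ ⟫)) + ((c′ - (1# + 1#)) * k + 0#))
            ≈⟨ solve 3 (λ k d c → (k :- d) :+ ((k :- (c :* k :- d)) :+ ((c :- (:1 :+ :1)) :* k :+ :0)) := :0) refl k ⟪ u , δ ⟫ c′ ⟩
          0# ∎

        gaps≈0 : ∀ i → gaps i ≈ 0#
        gaps≈0 = Σ≈0⇒term≈0 gaps≥0 Σgaps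

        gap⇒≈ : ∀ {a} → k - a ≈ 0# → a ≈ k
        gap⇒≈ {a} e = trans (solve 2 (λ k a → a := k :- (k :- a)) refl k a) (trans (+-congˡ (-‿cong e)) (solve 1 (λ k → k :- :0 := k) refl k))

        δ∈F : δ ∈ F
        δ∈F = F⇐ (Root⊆P δ∈) (gap⇒≈ (gaps≈0 zero))

        δ′∈F : δ′ ∈ F
        δ′∈F = F⇐ (Root⊆P δ′∈) (gap⇒≈ (gaps≈0 (suc zero)))

        norm-neg : ∀ x → norm² (-ᴹ x) ≈ norm² x
        norm-neg x = trans (⟨-⟩ flip (⟨-⟩ refl)) (solve 1 (λ x → :- (:- x) := x) refl _)

        points : Fin 3 → Carrierᴹ
        points zero             = δ
        points (suc zero)       = δ′
        points (suc (suc zero)) = -ᴹ δ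

        -- γ = (δ + δ′)/c uses up mass 2/c only. The remaining 1 - 2/c = 2h belongs on the origin,
        -- realised as the midpoint of `δ` and `-ᴹ δ` because the induction hypothesis speaks of
        -- roots.
        weights : Fin 3 → Carrier
        weights zero             = q + h
        weights (suc zero)       = q
        weights (suc (suc zero)) = h

        weights≥0 : ∀ i → 0# ≤ weights i
        weights≥0 zero             = 0≤x+y (proj₁ (0<x⁻¹ 0<c)) 0≤h
        weights≥0 (suc zero)       = proj₁ (0<x⁻¹ 0<c)
        weights≥0 (suc (suc zero)) = 0≤h

        Σweights : Σᴷ weights ≈ 1#
        Σweights = begin
          (q + h) + (q + (h + 0#))
            ≈⟨ solve 2 (λ q h → (q :+ h) :+ (q :+ (h :+ :0)) := q :* (:1 :+ :1) :+ h :* (:1 :+ :1)) refl q h ⟩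
          q * (1# + 1#) + h * (1# + 1#)
            ≈⟨ +-congˡ (solve 3 (λ t b z → t :* b :* z := (t :* z) :* b) refl t (q * (c′ - (1# + 1#))) (1# + 1#)) ⟩
          q * (1# + 1#) + t * (1# + 1#) * (q * (c′ - (1# + 1#)))
            ≈⟨ +-congˡ (trans (*-congʳ t2≈1) (*-identityˡ _)) ⟩
          q * (1# + 1#) + q * (c′ - (1# + 1#))
            ≈⟨ solve 3 (λ q c z → q :* z :+ q :* (c :- z) := c :* q) refl q c′ (1# + 1#) ⟩
          c′ * q
            ≈⟨ cq≈1 ⟩
          1# ∎

        γ≈ : combination weights points ≈ᴹ γ
        γ≈ = ⟪⟫-ext λ z → begin
          ⟪ combination weights points , z ⟫
            ≈⟨ ⟪⟫-combination weights points z ⟩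
          (q + h) * ⟪ δ , z ⟫ + (q * ⟪ δ′ , z ⟫ + (h * ⟪ -ᴹ δ , z ⟫ + 0#))
            ≈⟨ +-congˡ (+-cong (*-congˡ (⟪δ′⟫ z)) (+-congʳ (*-congˡ (⟨-⟩ ⟨ δ ⟩)))) ⟩
          (q + h) * ⟪ δ , z ⟫ + (q * (c′ * ⟪ γ , z ⟫ - ⟪ δ , z ⟫) + (h * - ⟪ δ , z ⟫ + 0#))
            ≈⟨ solve 5 (λ q h d c g → (q :+ h) :* d :+ (q :* (c :* g :- d) :+ (h :* (:- d) :+ :0)) := c :* q :* g) refl q h ⟪ δ , z ⟫ c′ ⟪ γ , z ⟫ ⟩
          c′ * q * ⟪ γ , z ⟫
            ≈⟨ trans (*-congʳ cq≈1) (*-identityˡ _) ⟩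
          ⟪ γ , z ⟫ ∎

        members : Dec (c′ - (1# + 1#) ≈ 0#) → ∀ i → weights i ≈ 0# ⊎ Hull v (points i)
        members _ zero       = inj₂ (IH δ∈ δ∈F γ<δ)
        members _ (suc zero) = inj₂ (IH δ′∈ δ′∈F (<-respʳ
          (sym (trans (norm-neg _) (isometry (reflection-orthogonal (root≉0 γ∈)) δ δ))) γ<δ))
        members (yes e) (suc (suc zero)) = inj₁ (trans (*-congˡ (trans (*-congˡ e) (zeroʳ q))) (zeroʳ t))
        -- If c differs from 2, the third gap forces k = 0, so that `-ᴹ δ` lies on F along with `δ`.
        members (no ne) (suc (suc zero)) = inj₂ (IH (neg-Root δ∈)
          (F⇐ (Root⊆P (neg-Root δ∈)) (trans (flip (⟨-⟩ ⟪⟫-sym δ u)) (trans (-‿cong (trans (F⇒u≈k δ∈F) k≈0)) (trans (solve 0 (:- :0 := :0) refl) (sym k≈0)))))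
          (<-respʳ (sym (norm-neg δ)) γ<δ))
          where
          k≈0 : k ≈ 0#
          k≈0 = *-cancelˡ-0 ne (gaps≈0 (suc (suc zero)))

      shorter-root-in-hull : Hull v γ
      shorter-root-in-hull = Hull-resp γ≈ (Hull-bind weights points weights≥0 Σweights (members (_ ≟ 0#)))

    module _ {n} {v : Fin n → Carrierᴹ} (V⊆v : ∀ {x} → IsVertexOf F x → x ∈ Range v) where
      private
        Φ∈ : ∀ i → Φ i ∈ Root
        Φ∈ i = i , ≈ᴹ-refl

        Obstructed : Fin N → Fin N → Set _
        Obstructed i j = norm² (Φ i) < norm² (Φ j) × ¬ (⟪ Φ i , Φ j ⟫ ≈ 0#)

        -- The induction passes from longer roots to shorter ones; negating the squared length makes
        -- it a descent.
        root⇒Hull : ∀ i → Acc (λ i j → - norm² (Φ i) < - norm² (Φ j)) i → Φ i ∈ F → Hull v (Φ i)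
        root⇒Hull i (acc rec) i∈F = cases (any? (λ j → (norm² (Φ i) <? norm² (Φ j)) ×-dec ¬? (⟪ Φ i , Φ j ⟫ ≟ 0#)))
          where
          IH : ∀ {ε} → ε ∈ Root → ε ∈ F → norm² (Φ i) < norm² ε → Hull v ε
          IH (j , e) ε∈F p = Hull-resp (≈ᴹ-sym e) (root⇒Hull j (rec (negate (<-respʳ (⟪⟫-cong e e) p))) (F-resp e ε∈F))
            where
            negate : ∀ {a b} → a < b → - b < - a
            negate {a} {b} p = 0≤-⇒≤ (0≤-resp (solve 2 (λ a b → b :- a := :- a :- (:- b)) refl a b) (≤⇒0≤- (proj₁ p))) ,
              λ e → proj₂ p (trans (solve 1 (λ a → a := :- (:- a)) refl a) (trans (-‿cong (sym e)) (solve 1 (λ a → :- (:- a) := a) refl b)))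

          -- `Φ j` and its negative have the same length, so the sign can be chosen to make the
          -- pairing with `Φ i` positive.
          longer : ∀ j → Obstructed i j → Dec (0# ≤ ⟪ Φ j , Φ i ⟫) → Hull v (Φ i)
          longer j (p , ne) (yes q) = shorter-root-in-hull (Φ∈ i) i∈F (Φ∈ j) p (pos q (ne ∘ trans (⟪⟫-sym _ _))) IH
          longer j (p , ne) (no q)  = shorter-root-in-hull (Φ∈ i) i∈F (neg-Root (Φ∈ j))
            (<-respʳ (sym (trans (⟨-⟩ flip (⟨-⟩ refl)) (solve 1 (λ x → :- (:- x) := x) refl _))) p)
            (0<-resp (sym (⟨-⟩ refl)) (≤0⇒0≤- (proj₁ (≰⇒> q)) ,
              λ e → ne (trans (⟪⟫-sym _ _) (trans (solve 1 (λ a → a := :- (:- a)) refl _) (trans (-‿cong (sym e)) (solve 0 (:- :0 := :0) refl)))))) IH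

          vertex : ∀ {x} → x ∈ Range v → Hull v x
          vertex (j , e) = Hull-resp (≈ᴹ-sym e) (Hull-generator v j)

          unobstructed : ¬ (∃[ j ] Obstructed i j) → OrthogonalToLonger (Φ i)
          unobstructed ¬p j q = decide (⟪ Φ i , Φ j ⟫ ≟ 0#)
            where
            decide : Dec (⟪ Φ i , Φ j ⟫ ≈ 0#) → ⟪ Φ i , Φ j ⟫ ≈ 0#
            decide (yes e) = e
            decide (no ne) = ⊥-elim (¬p (j , q , ne))

          cases : Dec (∃[ j ] Obstructed i j) → Hull v (Φ i)
          cases (yes (j , p)) = longer j p (0# ≤? ⟪ Φ j , Φ i ⟫)
          cases (no ¬p)       = vertex (V⊆v (exposed (Φ∈ i) (unobstructed ¬p) i∈F))

      F⊆Hull-vertices : ∀ {x} → x ∈ F → Hull v x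
      F⊆Hull-vertices = F⊆Hull (λ i → root⇒Hull i (key-wellFounded (λ j → - norm² (Φ j)) i))

-- Standard faces, their stabilizers and orbits

module StandardFaces {c ℓ₁ ℓ₂ m ℓm} {ℝ : RealField c ℓ₁ ℓ₂} (𝔼 : InnerProductSpace ℝ m ℓm)
  {N r : ℕ} (Φ : Fin N → InnerProductSpace.Carrierᴹ 𝔼) (Π : Fin r → InnerProductSpace.Carrierᴹ 𝔼)
  (isRootSystem : Geometry.IsRootSystem 𝔼 Φ) (isSimpleSystem : Geometry.IsSimpleSystem 𝔼 Φ Π) where
  open OrderedField ℝ
  open InnerProduct 𝔼
  open RelativeInterior 𝔼
  open Reflection 𝔼
  open WeylGroup 𝔼 Φ Π isRootSystem isSimpleSystem
  open PolytopeFaces 𝔼 Φ Π isRootSystem isSimpleSystem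
  open PolytopeVertices 𝔼 Φ Π isRootSystem isSimpleSystem

  open RealField ℝ hiding (zero)
  open InnerProductSpace 𝔼
  open Geometry 𝔼
  open IsOrthogonal
  open IsRootSystem isRootSystem
  open IsSimpleSystem isSimpleSystem
  open import Relation.Binary.Reasoning.Setoid setoid

  private
    P : Subset
    P = rootPolytope Φ

  Meets : Subset → Set _
  Meets F = relativeInterior F ≬ chamber Π

  -- If the inverse of act (i ∷ l) makes Π i negative then s i preserves G
  -- and can be dropped; otherwise, by the exchange condition, the word was not reduced.
  module _ (F : Subset) (isFace : IsFaceOf P F) (F-meets : Meets F) where
    open Face F isFace using () renaming (F-resp to F-resp′)

    dominant-unique : ∀ {a} {S : Pred Carrierᴹ a} n (l : List (Fin r)) → length l ℕ.≤ n →
      (∀ i → image (s i) F ≐ F → Π i ∈ S) →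
      (G : Subset) → IsFaceOf P G → Meets G → G ≐ image (act l) F →
      G ≐ F × act l ∈ ReflectionGroup S
    dominant-unique n [] _ gen G G-face G-meets (⊆ , ⊇) =
      ((λ x∈ → from (⊆ x∈)) , λ {x} x∈ → ⊇ (x , x∈ , ≈ᴹ-refl)) , identity
      where
      from : ∀ {y} → y ∈ image id F → y ∈ F
      from (x , x∈ , e) = F-resp′ (≈ᴹ-sym e) x∈
    -- The recursion is on a bound for the length, since the exchange condition returns a word that
    -- is not a subterm of the given one.
    dominant-unique {S = S} (suc n) (i ∷ l) (ℕ.s≤s |l|≤n) gen G G-face (x , x∈ , x∈C) (G⊆ , ⊇G) =
      cases (root-sign (act-Root (reverse (i ∷ l)) (simpleRoots i)))
      where
      open Face G G-face
      W = act-orthogonal (i ∷ l)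

      y = proj₁ F-meets
      y∈ = proj₁ (proj₂ F-meets)
      y∈C = proj₂ (proj₂ F-meets)

      forth : ∀ {x} → x ∈ F → act (i ∷ l) x ∈ G
      forth {x} x∈ = ⊇G (x , x∈ , ≈ᴹ-refl)

      back : ∀ {x} → x ∈ G → act (reverse (i ∷ l)) x ∈ F
      back {z} z∈ = from (G⊆ z∈)
        where
        from : z ∈ image (act (i ∷ l)) F → act (reverse (i ∷ l)) z ∈ F
        from (x , x∈ , e) = F-resp′ (≈ᴹ-sym (≈ᴹ-trans (map-cong (inverse-orthogonal W) e) (inverseˡ W x))) x∈

      wy∈ : act (i ∷ l) y ∈ relativeInterior G
      wy∈ = relativeInterior-map W F-resp forth back y∈

      descent : NonPositive (act (reverse (i ∷ l)) (Π i)) → G ≐ F × act (i ∷ l) ∈ ReflectionGroup S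
      descent neg = G≐F , compose (generator (gen i (≐-image (preserved⇒image pres)))) (proj₂ rest)
        where
        -- Moving the word across the form pairs the dominant `y` with a nonpositive combination of
        -- simple roots.
        pairing : ⟪ act (i ∷ l) y , Π i ⟫ ≤ 0#
        pairing = ≤-respˡ-≈ (sym (trans (adjoint W y (Π i)) (trans (⟪⟫-congʳ (coordinates (act (reverse (i ∷ l)) (Π i))))
          (⟪,⟫-combination y (λ j → ⟪ act (reverse (i ∷ l)) (Π i) , ω j ⟫) Π))))
          (≤-respʳ-≈ (Σ-zero r) (Σ-mono-≤ {g = λ _ → 0#} (λ j → ≤-respʳ-≈ (zeroʳ ⟪ y , Π j ⟫)
            (≤-respˡ-≈ (*-comm _ _) (*-monoˡ-≤ (y∈C j) (neg j))))))

        pres : Preserved i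
        pres = preserved i x∈ wy∈ (x∈C i) pairing

        G≐image : G ≐ image (act l) F
        G≐image = (λ {z} z∈ → to (G⊆ (pres z∈))) , λ { (z , z∈ , e) → F-resp
          (≈ᴹ-trans (inverseˡ (s-orthogonal i) (act l z)) (≈ᴹ-sym e)) (pres (forth z∈)) }
          where
          to : ∀ {z} → s i z ∈ image (act (i ∷ l)) F → z ∈ image (act l) F
          to {z} (x , x∈ , e) = x , x∈ , ≈ᴹ-trans (≈ᴹ-sym (inverseˡ (s-orthogonal i) z))
            (≈ᴹ-trans (map-cong (s-orthogonal i) e) (inverseˡ (s-orthogonal i) (act l x)))

        rest : G ≐ F × act l ∈ ReflectionGroup S
        rest = dominant-unique n l |l|≤n gen G G-face (x , x∈ , x∈C) G≐image

        G≐F : G ≐ F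
        G≐F = proj₁ rest

        -- The argument shows that `s i` preserves G, while `gen` speaks of F; the recursive call
        -- has just identified the two.
        ≐-image : image (s i) G ≐ G → image (s i) F ≐ F
        ≐-image (⊆ , ⊇) =
          (λ { (z , z∈ , e) → proj₁ G≐F (⊆ (z , proj₂ G≐F z∈ , e)) }) ,
          (λ z∈ → to (⊇ (proj₂ G≐F z∈)))
          where
          to : ∀ {z} → z ∈ image (s i) G → z ∈ image (s i) F
          to (x , x∈ , e) = x , proj₁ G≐F x∈ , e

      shorten : NonNegative (act (reverse (i ∷ l)) (Π i)) → G ≐ F × act (i ∷ l) ∈ ReflectionGroup S
      -- The inverse of the word is `act (reverse l) ∘ s i`, so `act (reverse l)` sends `Π i` to the
      -- negative of a nonnegative vector. Exchange then rewrites that inverse as `act l′`, and the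
      -- element itself as `act (reverse l′)`.
      shorten nonneg = finish (exchange (reverse l) i (NonPositive-resp
        (≈ᴹ-trans (≈ᴹ-sym (map-neg R _)) (map-cong R (≈ᴹ-trans (≈ᴹ-sym (map-neg (s-orthogonal i) (Π i)))
          (≈ᴹ-trans (map-cong (s-orthogonal i) (≈ᴹ-sym (reflection-self (Π≉0 i)))) (inverseˡ (s-orthogonal i) (Π i))))))
        (neg-NonNegative (≡.subst NonNegative (act-reverse i l (Π i)) nonneg))))
        where
        R = inverse-orthogonal (act-orthogonal l)

        finish : ∃[ l′ ] length (reverse l) ≡ suc (length l′) × (∀ x → act (reverse l) (s i x) ≈ᴹ act l′ x) →
                 G ≐ F × act (i ∷ l) ∈ ReflectionGroup S
        finish (l′ , e , h) = proj₁ shorter , pointwise (proj₂ shorter) same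
          where
          same⁻¹ : ∀ x → act (reverse (i ∷ l)) x ≈ᴹ act l′ x
          same⁻¹ x = ≡.subst (_≈ᴹ act l′ x) (≡.sym (act-reverse i l x)) (h x)

          L = act-orthogonal l′

          same : ∀ x → act (i ∷ l) x ≈ᴹ act (reverse l′) x
          same x = ⟪⟫-ext λ z → trans (adjoint W x z) (trans (⟪⟫-congʳ (same⁻¹ z))
            (adjoint-of L x z))
            where
            adjoint-of : ∀ {w w⁻¹} → IsOrthogonal w w⁻¹ → ∀ x z → ⟪ x , w z ⟫ ≈ ⟪ w⁻¹ x , z ⟫
            adjoint-of O x z = sym (adjoint (inverse-orthogonal O) x z)

          bound : length (reverse l′) ℕ.≤ n
          bound = ≡.subst (ℕ._≤ n) (≡.sym (length-reverse l′)) (ℕ.≤-trans (ℕ.n≤1+n _)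
            (≡.subst (ℕ._≤ n) (≡.trans (≡.sym (length-reverse l)) e) |l|≤n))

          shorter : G ≐ F × act (reverse l′) ∈ ReflectionGroup S
          shorter = dominant-unique n (reverse l′) bound gen G G-face (x , x∈ , x∈C)
            ((λ z∈ → to (G⊆ z∈)) , λ { (z , z∈ , e) → F-resp (≈ᴹ-trans (same z) (≈ᴹ-sym e)) (forth z∈) })
            where
            to : ∀ {z} → z ∈ image (act (i ∷ l)) F → z ∈ image (act (reverse l′)) F
            to (x , x∈ , e) = x , x∈ , ≈ᴹ-trans e (same x)

      cases : NonNegative (act (reverse (i ∷ l)) (Π i)) ⊎ NonPositive (act (reverse (i ∷ l)) (Π i)) →
              G ≐ F × act (i ∷ l) ∈ ReflectionGroup S
      cases (inj₁ p) = shorten p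
      cases (inj₂ p) = descent p

  generated⊆weylGroup : ∀ {a} {S : Pred Carrierᴹ a} → (∀ {α} → α ∈ S → α ∈ Root) → ∀ {w} → w ∈ ReflectionGroup S → w ∈ weylGroup Φ
  generated⊆weylGroup p (generator α∈)   = generator (p α∈)
  generated⊆weylGroup p identity         = identity
  generated⊆weylGroup p (compose q q′)   = compose (generated⊆weylGroup p q) (generated⊆weylGroup p q′)
  generated⊆weylGroup p (inverse q e e′) = inverse (generated⊆weylGroup p q) e e′
  generated⊆weylGroup p (pointwise q e)  = pointwise (generated⊆weylGroup p q) e

  simple∈weylGroup : ∀ l → act l ∈ weylGroup Φ
  simple∈weylGroup l = act∈ReflectionGroup l simpleRoots

  module _ (F : Subset) (isFace : IsFaceOf P F) where
    open Face F isFace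
    open Vertices F isFace

    module Barycenter {β} (isBarycenter : β ∈ IsBarycenter F) where
      n = proj₁ isBarycenter

      v : Fin n → Carrierᴹ
      v = proj₁ (proj₂ isBarycenter)

      private
        v-injective : Injective _≡_ _≈ᴹ_ v
        v-injective = proj₁ (proj₂ (proj₂ isBarycenter))

        V⊆v : ∀ {x} → IsVertexOf F x → x ∈ Range v
        V⊆v = proj₁ (proj₁ (proj₂ (proj₂ (proj₂ isBarycenter))))

        v-vertex : ∀ i → IsVertexOf F (v i)
        v-vertex i = proj₂ (proj₁ (proj₂ (proj₂ (proj₂ isBarycenter)))) (i , ≈ᴹ-refl)

        v∈F : ∀ i → v i ∈ F
        v∈F i = vertex⇒∈ (v-vertex i)

        β≈ : β ≈ᴹ fromℕ n ⁻¹ *ₗ Σᴹ v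
        β≈ = proj₂ (proj₂ (proj₂ (proj₂ isBarycenter)))

      ⟪β⟫ : ∀ z → ⟪ β , z ⟫ ≈ fromℕ n ⁻¹ * Σᴷ (λ i → ⟪ v i , z ⟫)
      ⟪β⟫ z = trans (⟪⟫-congˡ β≈) (_ ⟨*⟩ ⟪⟫-Σ v z)

      barycenter∈relativeInterior : ∃[ i ] Φ i ∈ F → β ∈ relativeInterior F
      barycenter∈relativeInterior (i , i∈) =
        average-relativeInterior v (index n (F⊆Hull-vertices V⊆v i∈)) (Hull⊆F v∈F) (F⊆Hull-vertices V⊆v) β≈
        where
        index : ∀ n {v : Fin n → Carrierᴹ} {x} → Hull v x → Fin n
        index n (t , _ , Σt , _) = proj₁ (some-weight≉0 t Σt)

      perpendicular : ∀ {z} → Σᴷ (λ i → ⟪ v i , z ⟫) ≈ 0# → ⟪ β , z ⟫ ≈ 0#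
      perpendicular {z} e = trans (⟪β⟫ z) (trans (*-congˡ e) (zeroʳ _))

      -- Without vertices the sum is empty, so `β` is orthogonal to everything whatever the inverse
      -- of 0 is. The empty face then fits both claims: it is standard with dominant `β`, and all of
      -- `Π` lies in `β ⊥`.
      empty⇒perpendicular : ¬ (∃[ i ] Φ i ∈ F) → ∀ z → ⟪ β , z ⟫ ≈ 0#
      empty⇒perpendicular ¬p z = perpendicular (trans (Σ-cong n (λ i → ⊥-elim (¬p (root-in-F (v∈F i))))) (Σ-zero n))

      -- `s i` permutes the vertices of F and flips the sign of their pairings with `Π i`, so the
      -- sum of these pairings equals its own negative.
      preserved⇒perpendicular : ∀ i → Preserved i → ⟪ β , Π i ⟫ ≈ 0#
      preserved⇒perpendicular i p = perpendicular (double S≈-S)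
        where
        S = Σᴷ (λ j → ⟪ v j , Π i ⟫)
        π = family-permutation v v-injective (s-orthogonal i) (λ j → V⊆v (vertex-map (s-orthogonal i) p (v-vertex j)))

        S≈-S : S ≈ - 1# * S
        S≈-S = begin
          S
            ≈⟨ Σ-permute n (λ j → ⟪ v j , Π i ⟫) (proj₁ π) ⟩
          Σᴷ (λ j → ⟪ v (proj₁ π ⟨$⟩ʳ j) , Π i ⟫)
            ≈⟨ Σ-cong n (λ j → trans (⟪⟫-congˡ (≈ᴹ-sym (proj₂ π j))) (trans (adjoint (s-orthogonal i) (v j) (Π i))
                 (trans (⟪⟫-congʳ (reflection-self (Π≉0 i))) (trans (flip (⟨-⟩ ⟪⟫-sym (Π i) (v j)))
                   (solve 1 (λ a → :- a := (:- :1) :* a) refl ⟪ v j , Π i ⟫))))) ⟩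
          Σᴷ (λ j → - 1# * ⟪ v j , Π i ⟫)
            ≈⟨ Σ-*ˡ n (- 1#) (λ j → ⟪ v j , Π i ⟫) ⟨
          - 1# * S ∎

        double : ∀ {a} → a ≈ - 1# * a → a ≈ 0#
        double {a} e = *-cancelˡ-0 (pos⇒≉0 0<2) (trans (solve 1 (λ a → (:1 :+ :1) :* a := a :+ a) refl a)
          (trans (+-congˡ e) (solve 1 (λ a → a :+ (:- :1) :* a := :0) refl a)))

      meets⇒dominant : Meets F → β ∈ chamber Π
      meets⇒dominant (x , x∈ , x∈C) i = cases (trichotomy i)
        where
        cases : Preserved i ⊎ (∀ {x} → x ∈ F → 0# ≤ ⟪ x , Π i ⟫) ⊎ (∀ {x} → x ∈ F → ⟪ x , Π i ⟫ ≤ 0#) → 0# ≤ ⟪ β , Π i ⟫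
        cases (inj₁ p) = ≤-reflexive (sym (preserved⇒perpendicular i p))
        cases (inj₂ (inj₁ p)) = p (proj₁ (barycenter∈relativeInterior (root-in-F (proj₁ x∈))))
        -- Dominance gives the opposite sign at `x`, so the single point `x` plays both roles in
        -- `preserved`.
        cases (inj₂ (inj₂ p)) = ≤-reflexive (sym (preserved⇒perpendicular i
          (preserved i x∈ x∈ (x∈C i) (p (proj₁ x∈)))))

      standard⇒dominant : F ∈ IsStandardFace Φ Π → β ∈ chamber Π
      standard⇒dominant (_ , inj₁ meets) = meets⇒dominant meets
      standard⇒dominant (_ , inj₂ empty) i =
        ≤-reflexive (sym (empty⇒perpendicular (λ { (j , j∈) → empty _ j∈ }) (Π i)))

      dominant⇒standard : β ∈ chamber Π → F ∈ IsStandardFace Φ Π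
      dominant⇒standard β∈C = isFace , cases nonempty?
        where
        cases : Dec (∃[ i ] Φ i ∈ F) → Meets F ⊎ Empty F
        cases (yes p) = inj₁ (β , barycenter∈relativeInterior p , β∈C)
        cases (no ¬p) = inj₂ (λ x x∈ → ¬p (root-in-F x∈))

      private
        S : Pred Carrierᴹ _
        S = Range Π ∩ (β ⊥)

      stabilizer⊆ : F ∈ IsStandardFace Φ Π → ∀ {w} → w ∈ stabilizer Φ F → w ∈ ReflectionGroup S
      stabilizer⊆ (_ , std) {w} (w∈ , ⊆ , ⊇) = pointwise (cases std) (proj₂ word)
        where
        word = weyl-word w∈
        l = proj₁ word

        simple∈S : ∀ i → ⟪ β , Π i ⟫ ≈ 0# → Π i ∈ S
        simple∈S i e = (i , ≈ᴹ-refl) , trans (⟪⟫-sym (Π i) β) e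

        gen : ∀ i → image (s i) F ≐ F → Π i ∈ S
        gen i (⊆ , _) = simple∈S i (preserved⇒perpendicular i (λ {x} x∈ → ⊆ (x , x∈ , ≈ᴹ-refl)))

        cases : Meets F ⊎ Empty F → act l ∈ ReflectionGroup S
        -- Taking G = F, the induction factors the word into simple reflections preserving F, and
        -- `gen` places their roots in `β ⊥`.
        cases (inj₁ meets) = proj₂ (dominant-unique F isFace meets (length l) l ℕ.≤-refl gen F isFace meets
          ((λ x∈ → to (⊇ x∈)) , λ { (x , x∈ , e) → ⊆ (x , x∈ , ≈ᴹ-trans e (≈ᴹ-sym (proj₂ word x))) }))
          where
          to : ∀ {y} → y ∈ image w F → y ∈ image (act l) F
          to (x , x∈ , e) = x , x∈ , ≈ᴹ-trans e (proj₂ word x)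
        cases (inj₂ empty) = act∈ReflectionGroup l (λ i → simple∈S i
          (empty⇒perpendicular (λ { (j , j∈) → empty _ j∈ }) (Π i)))

      S⊆Root : ∀ {α} → α ∈ S → α ∈ Root
      S⊆Root ((i , e) , _) = Range-resp (≈ᴹ-sym e) (simpleRoots i)

      -- Group elements are bare functions with no congruence built in; they inherit it from the
      -- words that represent them.
      weyl-cong : ∀ {w} → w ∈ weylGroup Φ → ∀ {x y} → x ≈ᴹ y → w x ≈ᴹ w y
      weyl-cong w∈ e = ≈ᴹ-trans (proj₂ word _) (≈ᴹ-trans (map-cong (act-orthogonal (proj₁ word)) e) (≈ᴹ-sym (proj₂ word _)))
        where word = weyl-word w∈

      -- On a nonempty face `β` is relatively interior, and its pairing 0 with `Π i` satisfies both
      -- sign conditions of `preserved`.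
      perpendicular⇒preserved : F ∈ IsStandardFace Φ Π → ∀ i → ⟪ β , Π i ⟫ ≈ 0# → Preserved i
      perpendicular⇒preserved (_ , inj₂ empty) i e x∈ = ⊥-elim (empty _ x∈)
      perpendicular⇒preserved (_ , inj₁ (x , x∈ , _)) i e =
        preserved i β∈ β∈ (≤-reflexive (sym e)) (≤-reflexive e)
        where β∈ = barycenter∈relativeInterior (root-in-F (proj₁ x∈))

      stabilizer⊇ : F ∈ IsStandardFace Φ Π → ∀ {w} → w ∈ ReflectionGroup S → image w F ≐ F
      stabilizer⊇ std (generator {α} ((i , e) , α⊥β)) =
        (λ { (x , x∈ , e′) → F-resp (≈ᴹ-sym (≈ᴹ-trans e′ (reflection-congˡ e x))) (p x∈) }) ,
        (λ {x} x∈ → s i x , p x∈ , ≈ᴹ-sym (≈ᴹ-trans (reflection-congˡ e (s i x)) (inverseˡ (s-orthogonal i) x)))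
        where
        p : Preserved i
        p = perpendicular⇒preserved std i (trans (⟪⟫-sym β (Π i)) (trans (⟪⟫-congˡ (≈ᴹ-sym e)) α⊥β))
      stabilizer⊇ std identity = (λ { (x , x∈ , e) → F-resp (≈ᴹ-sym e) x∈ }) , λ {x} x∈ → x , x∈ , ≈ᴹ-refl
      stabilizer⊇ std (compose {w} {w′} p q) =
        (λ { (x , x∈ , e) → proj₁ W (w′ x , proj₁ W′ (x , x∈ , ≈ᴹ-refl) , e) }) ,
        (λ x∈ → outer (proj₂ W x∈))
        where
        W  = stabilizer⊇ std p
        W′ = stabilizer⊇ std q
        inner : ∀ {x y} → x ≈ᴹ w y → y ∈ image w′ F → x ∈ image (w ∘ w′) F
        inner e (z , z∈ , e′) = z , z∈ , ≈ᴹ-trans e (weyl-cong (generated⊆weylGroup S⊆Root p) e′)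
        outer : ∀ {x} → x ∈ image w F → x ∈ image (w ∘ w′) F
        outer (y , y∈ , e) = inner e (proj₂ W′ y∈)
      stabilizer⊇ std (inverse {w} {w′} p ww′ w′w) =
        (λ { (x , x∈ , e) → to e (proj₂ W x∈) }) ,
        (λ {x} x∈ → w x , proj₁ W (x , x∈ , ≈ᴹ-refl) , ≈ᴹ-sym (w′w x))
        where
        W = stabilizer⊇ std p
        to : ∀ {x y} → y ≈ᴹ w′ x → x ∈ image w F → y ∈ F
        to {x} e (z , z∈ , e′) = F-resp (≈ᴹ-sym (≈ᴹ-trans e
          (≈ᴹ-trans (weyl-cong (inverse (generated⊆weylGroup S⊆Root p) ww′ w′w) e′) (w′w z)))) z∈
      stabilizer⊇ std (pointwise {w} {w′} p e) =
        (λ { (x , x∈ , e′) → proj₁ W (x , x∈ , ≈ᴹ-trans e′ (e x)) }) ,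
        (λ x∈ → to (proj₂ W x∈))
        where
        W = stabilizer⊇ std p
        to : ∀ {x} → x ∈ image w F → x ∈ image w′ F
        to (x , x∈ , e′) = x , x∈ , ≈ᴹ-trans e′ (≈ᴹ-sym (e x))

      stabilizer≐ : F ∈ IsStandardFace Φ Π → stabilizer Φ F ≐ ReflectionGroup S
      stabilizer≐ std = stabilizer⊆ std , λ w∈ → generated⊆weylGroup S⊆Root w∈ , stabilizer⊇ std w∈

    image-standard : ∃[ l ] image (act l) F ∈ IsStandardFace Φ Π
    image-standard = cases nonempty?
      where
      transport : ∀ b → b ∈ relativeInterior F → ∃[ l ] act l b ∈ chamber Π → ∃[ l ] image (act l) F ∈ IsStandardFace Φ Π
      transport b b∈ (l , lb∈C) = l , image-isFace l F isFace , inj₁ (act l b ,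
        relativeInterior-map W (λ { e (x , x∈ , e′) → x , x∈ , ≈ᴹ-trans (≈ᴹ-sym e) e′ })
          (λ {x} x∈ → x , x∈ , ≈ᴹ-refl)
          (λ { (x , x∈ , e) → F-resp (≈ᴹ-sym (≈ᴹ-trans (map-cong (inverse-orthogonal W) e) (inverseˡ W x))) x∈ })
          b∈ , lb∈C)
        where W = act-orthogonal l

      nonempty : ∃[ b ] b ∈ relativeInterior F → ∃[ l ] image (act l) F ∈ IsStandardFace Φ Π
      nonempty (b , b∈) = transport b b∈ (dominant-representative b)

      cases : Dec (∃[ i ] Φ i ∈ F) → ∃[ l ] image (act l) F ∈ IsStandardFace Φ Π
      cases (yes p) = nonempty (∃relativeInterior p)
      cases (no ¬p) = [] , image-isFace [] F isFace , inj₂ (λ { _ (x , x∈ , _) → ¬p (root-in-F x∈) })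

    unique-standard : ∃! _≐_ (λ G → G ∈ orbit Φ F × G ∈ IsStandardFace Φ Π)
    unique-standard = G₀ , ((act l , simple∈weylGroup l , id , id) , proj₂ image-standard) ,
      λ { (in-orbit , std) → unique in-orbit std }
      where
      l = proj₁ image-standard
      W = act-orthogonal l

      G₀ : Subset
      G₀ = image (act l) F

      unique : ∀ {G} → G ∈ orbit Φ F → G ∈ IsStandardFace Φ Π → G₀ ≐ G
      unique {G} (w , w∈ , G⊆ , ⊇G) (G-face , G-std) = cases (proj₂ (proj₂ image-standard)) G-std
        where
        l′ = proj₁ (weyl-word w∈)
        w≈ = proj₂ (weyl-word w∈)

        nonempty⇒ : ∀ {y} → y ∈ G → ∃[ x ] x ∈ F
        nonempty⇒ y∈ = proj₁ (G⊆ y∈) , proj₁ (proj₂ (G⊆ y∈))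

        -- G and `G₀` are both images of F, so the word of `w` followed by the inverse of `l`
        -- carries `G₀` to G, which brings two standard faces into the form required by
        -- `dominant-unique`.
        G⊆image : ∀ {z} → z ∈ image w F → z ∈ image (act (l′ ++ reverse l)) G₀
        G⊆image {z} (x , x∈ , e) = act l x , (x , x∈ , ≈ᴹ-refl) , ≈ᴹ-trans e (≈ᴹ-trans (w≈ x)
          (≡.subst (act l′ x ≈ᴹ_) (≡.sym (act-++ l′ (reverse l) (act l x)))
            (map-cong (act-orthogonal l′) (≈ᴹ-sym (inverseˡ W x)))))

        image⊆G : ∀ {z} → z ∈ image (act (l′ ++ reverse l)) G₀ → z ∈ G
        image⊆G {z} (y , (x , x∈ , e) , e′) = ⊇G (x , x∈ , ≈ᴹ-trans e′ (≈ᴹ-trans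
          (≡.subst (_≈ᴹ act l′ x) (≡.sym (act-++ l′ (reverse l) y))
            (map-cong (act-orthogonal l′) (≈ᴹ-trans (map-cong (inverse-orthogonal W) e) (inverseˡ W x))))
          (≈ᴹ-sym (w≈ x))))

        cases : Meets G₀ ⊎ Empty G₀ → Meets G ⊎ Empty G → G₀ ≐ G
        cases (inj₂ e) _ = (λ x∈ → ⊥-elim (e _ x∈)) , λ y∈ → ⊥-elim (e _ (_ , proj₂ (nonempty⇒ y∈) , ≈ᴹ-refl))
        cases (inj₁ _) (inj₂ e) = (λ { (x , x∈ , _) → ⊥-elim (e _ (⊇G (x , x∈ , ≈ᴹ-refl))) }) , λ y∈ → ⊥-elim (e _ y∈)
        cases (inj₁ meets₀) (inj₁ meets) = proj₂ G≐G₀ , proj₁ G≐G₀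
          where
          G≐G₀ : G ≐ G₀
          -- Only the equality of faces is wanted here, so any `S` containing the simple roots will
          -- do.
          G≐G₀ = proj₁ (dominant-unique G₀ (image-isFace l F isFace) meets₀ {S = Root} _ (l′ ++ reverse l) ℕ.≤-refl
            (λ i _ → simpleRoots i) G G-face meets ((λ z∈ → G⊆image (G⊆ z∈)) , image⊆G))

theorem3p6 :
    ∀ {c ℓ₁ ℓ₂ m ℓm} (ℝ : RealField c ℓ₁ ℓ₂) (𝔼 : InnerProductSpace ℝ m ℓm) →
    let open InnerProductSpace 𝔼 using (Carrierᴹ)
        open Geometry 𝔼
    in
    ∀ {N r : ℕ} (Φ : Fin N → Carrierᴹ) (Π : Fin r → Carrierᴹ) →
    IsRootSystem Φ → IsSimpleSystem Φ Π →
    ∀ (F : Subset) → IsFaceOf (rootPolytope Φ) F →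
    (∀ β → β ∈ IsBarycenter F →
      (F ∈ IsStandardFace Φ Π ⇔ β ∈ chamber Π) ×
      (F ∈ IsStandardFace Φ Π →
        stabilizer Φ F ≐ ReflectionGroup (Range Π ∩ (β ⊥)))) ×
    ∃! _≐_ (λ G → G ∈ orbit Φ F × G ∈ IsStandardFace Φ Π)
theorem3p6 ℝ 𝔼 Φ Π isRootSystem isSimpleSystem F isFace =
  (λ β isBarycenter → let open Barycenter F isFace isBarycenter in
    mk⇔ standard⇒dominant dominant⇒standard , stabilizer≐) ,
  unique-standard F isFace
  where
  open StandardFaces 𝔼 Φ Π isRootSystem isSimpleSystem
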